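{- Let $n\ge2$, $\mu$ a partition with $\mu_n=0$, and let $(w,T)\in\overline{\mathcal F}(\mu)$. Put $\sigma=f(w,T)$ and $\tau=\mathrm{ord}(\sigma)$. Then \[\mathrm{level}(w,T)=\sum_{c\in\mathrm{Des}(\sigma)}\mathrm{arm}(c)=\mathrm{charge}(\mathrm{cw}_2(\tau)).\]
   Context: Setting (type $A_{n-1}$): permutations in $S_n$ in one-line notation; $\ell$ = number of inversions; $<$ is Bruhat order. For $1\le i<j\le n$, $(i,j)$ is the root $\varepsilon_i-\varepsilon_j$ and the transposition $t_{ij}$ (right multiplication swaps positions $i,j$). For $1\le k\le n-1$, $\Gamma(k)=((1,n),\dots,(1,k+1),(2,n),\dots,(2,k+1),\dots,(k,n),\dots,(k,k+1))$. $\Gamma=\Gamma^{\mu_1}\cdots\Gamma^1=(\beta_1,\dots,\beta_m)$ with $\Gamma^j=\Gamma(\mu'_j)$ ($\mu'$ the conjugate partition). The affine level of position $i$ is $l_i=\#\{j\le i:\beta_j=\beta_i\}$. Folding pair $(w,J)$: $w\in S_n$, $J=\{j_1<\dots<j_s\}\subseteq\{1,\dots,m\}$, $w_i=w\beta_{j_1}\cdots\beta_{j_i}$, $\mathrm{end}(w,J)=w_s$; $j_i$ is a negative folding if $w_{i-1}<w_i$; $J^-$ = set of negative foldings; $\mathrm{level}(w,J)=\sum_{j\in J^- }l_j$. With $\langle\rho,(a,b)^\vee\rangle=b-a$, $\overline{\mathcal F}(\mu)$ is the set of folding pairs with $\frac12(\ell(w)+\ell(\mathrm{end}(w,J))-\#J)+\sum_{j\in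 J^- }\langle\rho,\beta_j^\vee\rangle=0$. $J$ is identified with the subsequence $T=T^{\mu_1}\cdots T^1$ of $\Gamma$ ($T^j$ the part in $\Gamma^j$). With $\pi^j=wT^{\mu_1}\cdots T^{j+1}$, the filling $f(w,T)=C^{\mu_1}\cdots C^1$ of the Young diagram of $\mu$ has column $C^j=\pi^j(1)\cdots\pi^j(\mu'_j)$ (top to bottom), columns displayed left to right as $C^{\mu_1},\dots,C^1$ (shortest to longest); $C^j(i)$ is the entry in row $i$. $\mathrm{ord}$ sorts each column increasingly. Descents: a cell in row $i$ of column $C^j$ is a descent if $C^{j+1}$ exists and has a row $i$, and $C^j(i)>C^{j+1}(i)$; $\mathrm{Des}(\sigma)$ is the set of descents. $\mathrm{arm}(c)$ is the number of cells to the left of $c$ in its row. Charge word: for a filling $\tau$ with columns numbered $1,2,\dots$ from longest to shortest (so $C^j$ has number $j$), $\mathrm{cw}(\tau)$ is the biword with one biletter $\binom{k}{j}$ for each entry $k$ in column $j$, biletters ordered by decreasing $k$ and, for equal $k$, by decreasing $j$; $\mathrm{cw}_2(\tau)$ is the word of lower letters. Charge (Lascoux–Schützenberger) of a word $v$ over $\{1,\dots,n\}$ with partition content (at least as many $j$'s as $(j+1)$'s): scan $v$ from its right end and select letters $1,2,\dots$ in order up to the largest possible $k$: select the rightmost $1$; after selecting $j$, select the first (nearest) unselected $j+1$ to the left of the selected $j$; if there is none, select the rightmost $j+1$ and add $k-j$ to the charge. Then remove the selected letters and repeat until the word is empty; $\mathrm{charge}(v)$ is the total sum. -}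

module Defs where

open import Data.Nat using (ℕ; zero; suc; _+_; _*_; _∸_; _⊔_; _≥_; _≡ᵇ_; _<ᵇ_; _≤ᵇ_)
open import Data.Nat.Properties using (≤-decTotalOrder)
open import Data.Bool using (Bool; true; false; if_then_else_; _∧_; not)
open import Data.List using (List; []; _∷_; map; upTo; downFrom; take; zip; length;
  filterᵇ; concatMap; replicate; foldr)
open import Data.Nat.ListAction using (sum)
open import Data.Bool.ListAction using (any)
open import Data.List.Relation.Unary.Linked using (Linked)
open import Data.Maybe using (Maybe; just; nothing)
open import Data.Product using (_×_; _,_; proj₁; proj₂)
open import Data.List.Sort.InsertionSort.Base ≤-decTotalOrder using (sort)

-- Generic list helpers (positions are 1-indexed, default value 0)

[1…_] : ℕ → List ℕ
[1… n ] = map suc (upTo n)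

[_…1] : ℕ → List ℕ
[ n …1] = map suc (downFrom n)

nth : {A : Set} → A → List A → ℕ → A
nth d []       _             = d
nth d (x ∷ xs) zero          = d
nth d (x ∷ xs) (suc zero)    = x
nth d (x ∷ xs) (suc (suc i)) = nth d xs (suc i)

-- value of a list at a 1-indexed position (0 if out of range)
_⟨_⟩ : List ℕ → ℕ → ℕ
w ⟨ i ⟩ = nth 0 w i

count : {A : Set} → (A → Bool) → List A → ℕ
count p xs = length (filterᵇ p xs)

-- Permutations in one-line notation (lists of 1..n)

-- right multiplication by the transposition t_ab : swap positions a and b
swapPos : List ℕ → ℕ → ℕ → List ℕ
swapPos w a b =
  map (λ i → if i ≡ᵇ a then w ⟨ b ⟩ else (if i ≡ᵇ b then w ⟨ a ⟩ else w ⟨ i ⟩))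
      [1… length w ]

ℓ : List ℕ → ℕ
ℓ w = sum (map (λ i → count (λ j → (i <ᵇ j) ∧ (w ⟨ j ⟩ <ᵇ w ⟨ i ⟩)) [1… length w ])
               [1… length w ])

-- Bruhat comparison of w and w t (t a transposition):  w < w t  iff  ℓ(w) < ℓ(w t)
_<Bᵇ_ : List ℕ → List ℕ → Bool
u <Bᵇ v = ℓ u <ᵇ ℓ v

-- Partitions (weakly decreasing lists of naturals; trailing zeros allowed)

IsPartition : List ℕ → Set
IsPartition μ = Linked _≥_ μ

part : List ℕ → ℕ → ℕ
part μ i = μ ⟨ i ⟩

conj : List ℕ → ℕ → ℕ
conj μ j = count (λ x → j ≤ᵇ x) μ

-- Roots (a , b) = ε_a - ε_b and the λ-chain Γ

Root : Set
Root = ℕ × ℕ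

_==R_ : Root → Root → Bool
(a , b) ==R (c , d) = (a ≡ᵇ c) ∧ (b ≡ᵇ d)

Γk : ℕ → ℕ → List Root
Γk n k = concatMap (λ a → map (λ b → (a , b)) (map (k +_) [ n ∸ k …1])) [1… k ]

blocks : ℕ → List ℕ → List ℕ → List Root
blocks n μ js = concatMap (λ j → Γk n (conj μ j)) js

Γ : ℕ → List ℕ → List Root
Γ n μ = blocks n μ [ part μ 1 …1]

Γpre : ℕ → List ℕ → ℕ → List Root
Γpre n μ j = blocks n μ (filterᵇ (λ j′ → j <ᵇ j′) [ part μ 1 …1])

alevel : List Root → ℕ → ℕ
alevel βs i = count (λ β → β ==R nth (0 , 0) βs i) (take i βs)

-- Folding pairs (w , J); J ⊆ {1,…,m} encoded as a Bool mask of length m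

applySel : List ℕ → List Root → List Bool → List ℕ
applySel w ((a , b) ∷ βs) (true  ∷ bs) = applySel (swapPos w a b) βs bs
applySel w ((a , b) ∷ βs) (false ∷ bs) = applySel w βs bs
applySel w _ _ = w

endF : List ℕ → List Root → List Bool → List ℕ
endF = applySel

card : List Bool → ℕ
card J = count (λ b → b) J

-- positions (1-indexed in Γ) of the negative foldings J⁻:
-- j_i is negative iff w_{i-1} < w_i in Bruhat order
negFrom : ℕ → List ℕ → List Root → List Bool → List ℕ
negFrom p w ((a , b) ∷ βs) (true ∷ bs) =
  let w′ = swapPos w a b in
  if w <Bᵇ w′ then suc p ∷ negFrom (suc p) w′ βs bs else negFrom (suc p) w′ βs bs
negFrom p w ((a , b) ∷ βs) (false ∷ bs) = negFrom (suc p) w βs bs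
negFrom p w _ _ = []

Jneg : List ℕ → List Root → List Bool → List ℕ
Jneg w βs J = negFrom 0 w βs J

level : ℕ → List ℕ → List ℕ → List Bool → ℕ
level n μ w J = sum (map (alevel (Γ n μ)) (Jneg w (Γ n μ) J))

-- Σ_{j ∈ J⁻} ⟨ρ, β_j^∨⟩ with ⟨ρ,(a,b)^∨⟩ = b - a
ρsum : ℕ → List ℕ → List ℕ → List Bool → ℕ
ρsum n μ w J =
  sum (map (λ j → let (a , b) = nth (0 , 0) (Γ n μ) j in b ∸ a) (Jneg w (Γ n μ) J))

-- (w,J) ∈ F̄(μ):  ½(ℓ(w) + ℓ(end) − #J) + Σ_{J⁻} ⟨ρ,β^∨⟩ = 0,
-- equivalently (multiplying by 2)  ℓ(w) + ℓ(end) + 2 Σ = #J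
InFbar : ℕ → List ℕ → List ℕ → List Bool → Set
InFbar n μ w J = ℓ w + ℓ (endF w (Γ n μ) J) + 2 * ρsum n μ w J ≡ card J
  where open import Relation.Binary.PropositionalEquality using (_≡_)

-- Fillings: a filling is the list of its columns C^1, C^2, …, C^{μ_1}
-- (column number j = position in the list; C^1 longest), each column
-- listed top to bottom.

Filling : Set
Filling = List (List ℕ)

πj : ℕ → List ℕ → List ℕ → List Bool → ℕ → List ℕ
πj n μ w J j = applySel w (Γpre n μ j) (take (length (Γpre n μ j)) J)

fill : ℕ → List ℕ → List ℕ → List Bool → Filling
fill n μ w J = map (λ j → take (conj μ j) (πj n μ w J j)) [1… part μ 1 ]

ord : Filling → Filling
ord σ = map sort σ

colAt : Filling → ℕ → List ℕ
colAt σ j = nth [] σ j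

cells : Filling → List (ℕ × ℕ)
cells σ = concatMap (λ j → map (λ i → (i , j)) [1… length (colAt σ j) ]) [1… length σ ]

isDescent : Filling → ℕ × ℕ → Bool
isDescent σ (i , j) =
  (suc j ≤ᵇ length σ) ∧ ((i ≤ᵇ length (colAt σ (suc j))) ∧ (colAt σ (suc j) ⟨ i ⟩ <ᵇ colAt σ j ⟨ i ⟩))

Des : Filling → List (ℕ × ℕ)
Des σ = filterᵇ (isDescent σ) (cells σ)

-- arm(c) = number of cells to the left of c in its row
-- (the columns to the left of C^j are C^{j+1}, …, C^{μ_1})
arm : Filling → ℕ × ℕ → ℕ
arm σ (i , j) = count (λ j′ → (j <ᵇ j′) ∧ (i ≤ᵇ length (colAt σ j′))) [1… length σ ]

desArmSum : Filling → ℕ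
desArmSum σ = sum (map (arm σ) (Des σ))

-- Charge word: biletters (k over j) for each entry k of column j,
-- ordered by decreasing k, then decreasing j; cw₂ = lower letters.

maxEntry : Filling → ℕ
maxEntry σ = foldr (λ c m → foldr _⊔_ m c) 0 σ

cw : Filling → List (ℕ × ℕ)
cw τ = concatMap (λ k → concatMap (λ j → replicate (count (λ x → x ≡ᵇ k) (colAt τ j)) (k , j))
                                   [ length τ …1])
                 [ maxEntry τ …1]

cw₂ : Filling → List ℕ
cw₂ τ = map proj₂ (cw τ)

-- Lascoux–Schützenberger charge (positions in a word are 0-indexed here)

elemᵇ : ℕ → List ℕ → Bool
elemᵇ x v = any (λ y → x ≡ᵇ y) v

rightmost : ℕ → List ℕ → Maybe ℕ
rightmost x v = go 0 v nothing
  where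
  go : ℕ → List ℕ → Maybe ℕ → Maybe ℕ
  go i []       acc = acc
  go i (y ∷ ys) acc = go (suc i) ys (if x ≡ᵇ y then just i else acc)

nearestLeft : ℕ → ℕ → List ℕ → Maybe ℕ
nearestLeft x p v = rightmost x (take p v)

topLetter : List ℕ → ℕ
topLetter v = go 1 (suc (length v))
  where
  go : ℕ → ℕ → ℕ
  go j zero    = j ∸ 1
  go j (suc f) = if elemᵇ j v then go (suc j) f else j ∸ 1

-- having selected letter j at position p, select j+1, …, k (r = k - j steps left);
-- returns the selected positions and the charge contribution
selectFrom : ℕ → List ℕ → ℕ → ℕ → ℕ → List ℕ × ℕ
selectFrom k v j p zero = ([] , 0)
selectFrom k v j p (suc r) with nearestLeft (suc j) p v
... | just q = let (s , c) = selectFrom k v (suc j) q r in (q ∷ s , c)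
... | nothing with rightmost (suc j) v
...   | just q  = let (s , c) = selectFrom k v (suc j) q r in (q ∷ s , (k ∸ j) + c)
...   | nothing = ([] , 0)

removeAt : List ℕ → List ℕ → List ℕ
removeAt s v = map proj₂ (filterᵇ (λ iv → not (elemᵇ (proj₁ iv) s)) (zip (upTo (length v)) v))

chargeF : ℕ → List ℕ → ℕ
chargeF zero    v = 0
chargeF (suc f) v with rightmost 1 v
... | nothing = 0
... | just p  =
  let k = topLetter v
      (s , c) = selectFrom k v 1 p (k ∸ 1)
  in c + chargeF f (removeAt (p ∷ s) v)

charge : List ℕ → ℕ
charge v = chargeF (length v) v

{-# OPTIONS --safe #-}
module Submission where

open import Defs
open import Data.Nat
open import Data.Nat.Properties
open import Data.Nat.ListAction using (sum)
open import Data.Nat.ListAction.Properties using (sum-++)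
open import Data.Nat.Solver using (module +-*-Solver)
open import Data.Bool using (Bool; true; false; if_then_else_; _∧_; not; T)
open import Data.List using (List; []; _∷_; _++_; [_]; _∷ʳ_; map; upTo; applyUpTo; take; drop; zip; length; filterᵇ; concatMap; replicate; foldr; cartesianProduct)
open import Data.List.Properties hiding (sum-++)
open import Data.List.Membership.Propositional using (_∈_; _∉_; find; lose)
open import Data.List.Membership.Propositional.Properties
open import Data.List.Relation.Unary.Any using (here; there)
open import Data.List.Relation.Unary.All as All using (All; []; _∷_)
import Data.List.Relation.Unary.All.Properties as Allₚ
open import Data.List.Relation.Unary.AllPairs as AllPairs using (AllPairs; []; _∷_)
import Data.List.Relation.Unary.AllPairs.Properties as AllPairsₚ
open import Data.List.Relation.Unary.Linked as Linked using (Linked; []; [-]; _∷_)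
import Data.List.Relation.Unary.Linked.Properties as Linkedₚ
open import Data.List.Relation.Unary.Sorted.TotalOrder.Properties using (↗↭↗⇒≋)
open import Data.List.Relation.Binary.Pointwise using (Pointwise; []; _∷_; Pointwise-≡⇒≡)
open import Data.List.Relation.Unary.Unique.Propositional using (Unique)
import Data.List.Relation.Unary.Unique.Propositional.Properties as Uniqueₚ
open import Data.List.Relation.Binary.Permutation.Propositional using (_↭_; ↭-refl; ↭-sym; ↭-trans; prep; swap; ↭⇒↭ₛ)
open import Data.List.Relation.Binary.Permutation.Propositional.Properties using (↭-length; ∈-resp-↭; filter-↭; shift; ++⁺ˡ)
import Data.List.Relation.Binary.Permutation.Setoid.Properties as Permₛ
open import Data.Maybe using (Maybe; just; nothing)
open import Data.Product using (Σ; ∃; _×_; _,_; proj₁; proj₂)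
open import Data.Sum using (_⊎_; inj₁; inj₂)
open import Data.Empty using (⊥; ⊥-elim)
open import Data.Unit using (⊤; tt)
open import Function using (_∘_; id; case_of_)
open import Relation.Nullary using (¬_; yes; no; contradiction)
open import Relation.Binary.Definitions using (Tri; tri<; tri≈; tri>)
open import Relation.Binary.PropositionalEquality hiding ([_])
open import Data.List.Sort.InsertionSort.Base ≤-decTotalOrder using (sort)
open import Data.List.Sort.InsertionSort.Properties ≤-decTotalOrder using (sort-↭)

-- ℓ w + 2 Σ_{J⁻} ⟨ρ,β^∨⟩ − #J − ℓ(end) is a sum of nonnegative defects, one per folding, so a
-- folding pair lies in F̄(μ) exactly when it ends at the identity and each step w t_ab → w is an
-- edge of the quantum Bruhat graph. Within row a of a block Γ^j the value at position a then moves
-- down in the circular order, passing 1 at most once and never crossing an entry of C^j below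
-- row a. Passing 1 is the only negative folding of the row, and it happens iff the cell in row a
-- of C^{j-1} is a descent; its affine level is the arm of that cell. Not crossing an entry means
-- that C^j(a) is the first of C^j(a), C^j(a+1), … read circularly upwards from C^{j-1}(a), and that
-- C¹ increases because π⁰ is the identity. This is how the charge algorithm selects letters, so
-- its a-th pass removes row a, and it wraps around exactly at the descents.

-- The defects are nonnegative for the following reason. Swapping positions a < b changes ℓ by 2m +
-- 1 up or down, where m counts the positions strictly between a and b whose values lie strictly
-- between the swapped ones, so 0 ≤ m ≤ b - a - 1. A positive folding has defect 2m and a negative
-- one 2(b - a - 1 - m), and vanishing of either is one of the two extreme cases of m. All three
-- statistics are brought to one double sum of `descent j a` over columns j and rows a. Two
-- mismatches shape this. Foldings in Γ^{j+1} record descents of C^j, so blocks and columns are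
-- offset by one: Γ¹ has to contribute nothing, and so does the column C^{μ_1}, which has no left
-- neighbour. Moreover, foldings are organised by columns and charge by rows; the relation
-- `Circular` is the interface between them, and the summation order is exchanged at the end. The
-- charge word is that of the sorted filling while the selection is described by the unsorted
-- columns. Only membership in columns enters the description of the word, so sorting does not show.

variable
  A B : Set

-- Reflection of Boolean comparisons

T⇒≡true : ∀ {b} → T b → b ≡ true
T⇒≡true {true} _ = refl

¬T⇒≡false : ∀ {b} → ¬ T b → b ≡ false
¬T⇒≡false {false} _ = refl
¬T⇒≡false {true} f = ⊥-elim (f tt)

≡true⇒T : ∀ {b} → b ≡ true → T b
≡true⇒T refl = tt

<ᵇ-true : ∀ {m n} → m < n → (m <ᵇ n) ≡ true
<ᵇ-true = T⇒≡true ∘ <⇒<ᵇ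

<ᵇ-false : ∀ {m n} → n ≤ m → (m <ᵇ n) ≡ false
<ᵇ-false {m} {n} n≤m = ¬T⇒≡false (≤⇒≯ n≤m ∘ <ᵇ⇒< m n)

≤ᵇ-true : ∀ {m n} → m ≤ n → (m ≤ᵇ n) ≡ true
≤ᵇ-true = T⇒≡true ∘ ≤⇒≤ᵇ

≤ᵇ-false : ∀ {m n} → n < m → (m ≤ᵇ n) ≡ false
≤ᵇ-false {m} {n} n<m = ¬T⇒≡false (<⇒≱ n<m ∘ ≤ᵇ⇒≤ m n)

≡ᵇ-refl : ∀ m → (m ≡ᵇ m) ≡ true
≡ᵇ-refl m = T⇒≡true (≡⇒≡ᵇ m m refl)

≡ᵇ-false : ∀ {m n} → m ≢ n → (m ≡ᵇ n) ≡ false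
≡ᵇ-false {m} {n} m≢n = ¬T⇒≡false (m≢n ∘ ≡ᵇ⇒≡ m n)

-- Counting and summation

𝟙 : Bool → ℕ
𝟙 b = if b then 1 else 0

module _ (p : A → Bool) where

  count-∷ : ∀ x xs → count p (x ∷ xs) ≡ 𝟙 (p x) + count p xs
  count-∷ x xs with p x
  ... | true = refl
  ... | false = refl

  count-++ : ∀ xs ys → count p (xs ++ ys) ≡ count p xs + count p ys
  count-++ [] ys = refl
  count-++ (x ∷ xs) ys with p x
  ... | true = cong suc (count-++ xs ys)
  ... | false = count-++ xs ys

  count-↭ : ∀ {xs ys} → xs ↭ ys → count p xs ≡ count p ys
  count-↭ xs↭ys = ↭-length (filter-↭ _ xs↭ys)

  count≤length : ∀ xs → count p xs ≤ length xs
  count≤length = length-filter _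

count-map : (p : B → Bool) (f : A → B) (xs : List A) → count p (map f xs) ≡ count (p ∘ f) xs
count-map p f [] = refl
count-map p f (x ∷ xs) with p (f x)
... | true = cong suc (count-map p f xs)
... | false = count-map p f xs

count-cong : {p q : A → Bool} {xs : List A} → All (λ x → p x ≡ q x) xs → count p xs ≡ count q xs
count-cong [] = refl
count-cong {p = p} {q} {x ∷ xs} (px ∷ pxs) = begin
  count p (x ∷ xs)        ≡⟨ count-∷ p x xs ⟩
  𝟙 (p x) + count p xs    ≡⟨ cong₂ _+_ (cong 𝟙 px) (count-cong pxs) ⟩
  𝟙 (q x) + count q xs    ≡⟨ count-∷ q x xs ⟨
  count q (x ∷ xs)        ∎
  where open ≡-Reasoning

count-none : {p : A → Bool} {xs : List A} → All (λ x → p x ≡ false) xs → count p xs ≡ 0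
count-none [] = refl
count-none {p = p} {x ∷ xs} (px ∷ pxs) rewrite px = count-none pxs

sum-cong : {f g : A → ℕ} {xs : List A} → All (λ x → f x ≡ g x) xs → sum (map f xs) ≡ sum (map g xs)
sum-cong [] = refl
sum-cong (e ∷ es) = cong₂ _+_ e (sum-cong es)

sum-zero : {f : A → ℕ} {xs : List A} → All (λ x → f x ≡ 0) xs → sum (map f xs) ≡ 0
sum-zero [] = refl
sum-zero (e ∷ es) = cong₂ _+_ e (sum-zero es)

sum-+ : (f g : A → ℕ) (xs : List A) → sum (map (λ x → f x + g x) xs) ≡ sum (map f xs) + sum (map g xs)
sum-+ f g [] = refl
sum-+ f g (x ∷ xs) = begin
  f x + g x + sum (map (λ x → f x + g x) xs)      ≡⟨ cong (f x + g x +_) (sum-+ f g xs) ⟩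
  f x + g x + (sum (map f xs) + sum (map g xs))   ≡⟨ solve 4 (λ a b c d → a :+ b :+ (c :+ d) := a :+ c :+ (b :+ d)) refl (f x) (g x) _ _ ⟩
  f x + sum (map f xs) + (g x + sum (map g xs))   ∎
  where open ≡-Reasoning; open +-*-Solver

sum-swap : (f : A → B → ℕ) (xs : List A) (ys : List B) →
  sum (map (λ x → sum (map (f x) ys)) xs) ≡ sum (map (λ y → sum (map (λ x → f x y) xs)) ys)
sum-swap f [] ys = sym (sum-zero (All.universal (λ _ → refl) ys))
sum-swap f (x ∷ xs) ys = trans (cong (sum (map (f x) ys) +_) (sum-swap f xs ys))
  (sym (sum-+ (f x) _ ys))

count≡sum : (p : A → Bool) (xs : List A) → count p xs ≡ sum (map (𝟙 ∘ p) xs)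
count≡sum p [] = refl
count≡sum p (x ∷ xs) = trans (count-∷ p x xs) (cong (𝟙 (p x) +_) (count≡sum p xs))

sum-filter : (p : A → Bool) (f : A → ℕ) (xs : List A) →
  sum (map f (filterᵇ p xs)) ≡ sum (map (λ x → if p x then f x else 0) xs)
sum-filter p f [] = refl
sum-filter p f (x ∷ xs) with p x
... | true = cong (f x +_) (sum-filter p f xs)
... | false = sum-filter p f xs

sum-concatMap : (f : B → ℕ) (g : A → List B) (xs : List A) →
  sum (map f (concatMap g xs)) ≡ sum (map (λ x → sum (map f (g x))) xs)
sum-concatMap f g [] = refl
sum-concatMap f g (x ∷ xs) = begin
  sum (map f (g x ++ concatMap g xs))                   ≡⟨ cong sum (map-++ f (g x) _) ⟩
  sum (map f (g x) ++ map f (concatMap g xs))           ≡⟨ sum-++ (map f (g x)) _ ⟩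
  sum (map f (g x)) + sum (map f (concatMap g xs))      ≡⟨ cong (sum (map f (g x)) +_) (sum-concatMap f g xs) ⟩
  sum (map f (g x)) + sum (map (λ x → sum (map f (g x))) xs) ∎
  where open ≡-Reasoning

-- Intervals and 1-indexed lookup

[1…]-∷ʳ : ∀ n → [1… suc n ] ≡ [1… n ] ∷ʳ suc n
[1…]-∷ʳ n = trans (cong (map suc) (sym (upTo-∷ʳ n))) (map-++ suc (upTo n) [ n ])

length-[1…] : ∀ n → length [1… n ] ≡ n
length-[1…] n = trans (length-map suc (upTo n)) (length-upTo n)

∈-[1…]⁺ : ∀ {n i} → 1 ≤ i → i ≤ n → i ∈ [1… n ]
∈-[1…]⁺ {i = suc i} _ i≤n = ∈-map⁺ suc (∈-upTo⁺ i≤n)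

∈-[1…]⁻ : ∀ {n i} → i ∈ [1… n ] → 1 ≤ i × i ≤ n
∈-[1…]⁻ i∈ with ∈-map⁻ suc i∈
... | _ , j∈ , refl = s≤s z≤n , ∈-upTo⁻ j∈

∈-[…1]⁺ : ∀ {n i} → 1 ≤ i → i ≤ n → i ∈ [ n …1]
∈-[…1]⁺ {i = suc i} _ i≤n = ∈-map⁺ suc (∈-downFrom⁺ i≤n)

∈-[…1]⁻ : ∀ {n i} → i ∈ [ n …1] → 1 ≤ i × i ≤ n
∈-[…1]⁻ i∈ with ∈-map⁻ suc i∈
... | _ , j∈ , refl = s≤s z≤n , ∈-downFrom⁻ j∈

All-[1…] : ∀ {P : ℕ → Set} n → (∀ i → 1 ≤ i → i ≤ n → P i) → All P [1… n ]
All-[1…] n f = All.tabulate λ i∈ → let (l , u) = ∈-[1…]⁻ i∈ in f _ l u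

All-[…1] : ∀ {P : ℕ → Set} n → (∀ i → 1 ≤ i → i ≤ n → P i) → All P [ n …1]
All-[…1] n f = All.tabulate λ i∈ → let (l , u) = ∈-[…1]⁻ i∈ in f _ l u

∑ : ℕ → (ℕ → ℕ) → ℕ
∑ n f = sum (map f [1… n ])

∑-suc : ∀ n f → ∑ (suc n) f ≡ ∑ n f + f (suc n)
∑-suc n f = begin
  sum (map f [1… suc n ])             ≡⟨ cong (sum ∘ map f) ([1…]-∷ʳ n) ⟩
  sum (map f ([1… n ] ∷ʳ suc n))      ≡⟨ cong sum (map-++ f [1… n ] [ suc n ]) ⟩
  sum (map f [1… n ] ++ [ f (suc n) ]) ≡⟨ sum-++ (map f [1… n ]) _ ⟩
  ∑ n f + (f (suc n) + 0)             ≡⟨ cong (∑ n f +_) (+-identityʳ _) ⟩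
  ∑ n f + f (suc n)                   ∎
  where open ≡-Reasoning

∑-cong : ∀ n {f g} → (∀ i → 1 ≤ i → i ≤ n → f i ≡ g i) → ∑ n f ≡ ∑ n g
∑-cong n e = sum-cong (All-[1…] n e)

∑-extend : ∀ {m n} f → m ≤ n → (∀ i → m < i → i ≤ n → f i ≡ 0) → ∑ m f ≡ ∑ n f
∑-extend {m} {n} f m≤n z = go n m≤n z
  where
  open ≡-Reasoning
  go : ∀ n → m ≤ n → (∀ i → m < i → i ≤ n → f i ≡ 0) → ∑ m f ≡ ∑ n f
  go n m≤n z with m ≟ n
  ... | yes refl = refl
  go zero z≤n z | no m≢n = contradiction refl m≢n
  go (suc n) m≤n z | no m≢n = begin
    ∑ m f             ≡⟨ go n (≤-pred m<n) (λ i m<i i≤n → z i m<i (m≤n⇒m≤1+n i≤n)) ⟩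
    ∑ n f             ≡⟨ +-identityʳ _ ⟨
    ∑ n f + 0         ≡⟨ cong (∑ n f +_) (z (suc n) m<n ≤-refl) ⟨
    ∑ n f + f (suc n) ≡⟨ ∑-suc n f ⟨
    ∑ (suc n) f       ∎
    where
    m<n : m < suc n
    m<n = ≤∧≢⇒< m≤n m≢n

sum-[…1] : ∀ n f → sum (map f [ n …1]) ≡ ∑ n f
sum-[…1] zero f = refl
sum-[…1] (suc n) f = begin
  f (suc n) + sum (map f [ n …1]) ≡⟨ cong (f (suc n) +_) (sum-[…1] n f) ⟩
  f (suc n) + ∑ n f               ≡⟨ +-comm (f (suc n)) _ ⟩
  ∑ n f + f (suc n)               ≡⟨ ∑-suc n f ⟨
  ∑ (suc n) f                     ∎
  where open ≡-Reasoning

-- Affine levels and arms both count the columns beyond column `i` that reach a given row; in terms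
-- of the conjugate partition these columns form an interval.
∑-interval : ∀ M i m → m ≤ M → ∑ M (λ j → 𝟙 ((i <ᵇ j) ∧ (j ≤ᵇ m))) ≡ m ∸ i
-- The induction on `M` passes through values below `m`, so the upper end is generalized to `m ⊓ M`.
∑-interval M i m m≤M = trans (go M) (cong (_∸ i) (m≤n⇒m⊓n≡m m≤M))
  where
  open ≡-Reasoning
  step : ∀ M → m ⊓ M ∸ i + 𝟙 ((i <ᵇ suc M) ∧ (suc M ≤ᵇ m)) ≡ m ⊓ suc M ∸ i
  step M with m ≤? M
  ... | yes m≤M rewrite ≤ᵇ-false (s≤s m≤M) | m≤n⇒m⊓n≡m m≤M | m≤n⇒m⊓n≡m (m≤n⇒m≤1+n m≤M) with i <ᵇ suc M
  ...   | true = +-identityʳ _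
  ...   | false = +-identityʳ _
  step M | no m≰M rewrite ≤ᵇ-true (≰⇒> m≰M) | m≥n⇒m⊓n≡n (≰⇒≥ m≰M) | m≥n⇒m⊓n≡n (≰⇒> m≰M) with i ≤? M
  ...   | yes i≤M rewrite <ᵇ-true (s≤s i≤M) | +-∸-assoc 1 i≤M = +-comm _ 1
  ...   | no i≰M rewrite <ᵇ-false (≰⇒> i≰M) | m≤n⇒m∸n≡0 (≰⇒> i≰M) | m≤n⇒m∸n≡0 (≰⇒≥ i≰M) = refl
  go : ∀ M → ∑ M (λ j → 𝟙 ((i <ᵇ j) ∧ (j ≤ᵇ m))) ≡ m ⊓ M ∸ i
  go zero rewrite ⊓-zeroʳ m | 0∸n≡0 i = refl
  go (suc M) = begin
    _               ≡⟨ ∑-suc M _ ⟩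
    _               ≡⟨ cong (_+ 𝟙 ((i <ᵇ suc M) ∧ (suc M ≤ᵇ m))) (go M) ⟩
    _               ≡⟨ step M ⟩
    m ⊓ suc M ∸ i   ∎

nth-applyUpTo : (d : A) (f : ℕ → A) → ∀ {n i} → i < n → nth d (applyUpTo f n) (suc i) ≡ f i
nth-applyUpTo d f {suc n} {zero} _ = refl
nth-applyUpTo d f {suc n} {suc i} (s≤s i<n) = nth-applyUpTo d (f ∘ suc) i<n

nth-map-[1…] : (d : A) (f : ℕ → A) → ∀ {n i} → 1 ≤ i → i ≤ n → nth d (map f [1… n ]) i ≡ f i
nth-map-[1…] d f {n} {suc i} _ i<n = begin
  nth d (map f [1… n ]) (suc i)            ≡⟨ cong (λ l → nth d l (suc i)) (map-∘ (upTo n)) ⟨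
  nth d (map (f ∘ suc) (upTo n)) (suc i)   ≡⟨ cong (λ l → nth d l (suc i)) (map-upTo (f ∘ suc) n) ⟩
  nth d (applyUpTo (f ∘ suc) n) (suc i)    ≡⟨ nth-applyUpTo d (f ∘ suc) i<n ⟩
  f (suc i)                                ∎
  where open ≡-Reasoning

nth-[1…] : ∀ {n i} → 1 ≤ i → i ≤ n → [1… n ] ⟨ i ⟩ ≡ i
nth-[1…] {n} 1≤i i≤n = trans (cong (_⟨ _ ⟩) (sym (map-id [1… n ]))) (nth-map-[1…] 0 id 1≤i i≤n)

applyUpTo-nth : (d : A) (xs : List A) → applyUpTo (λ t → nth d xs (suc t)) (length xs) ≡ xs
applyUpTo-nth d [] = refl
applyUpTo-nth d (x ∷ xs) = cong (x ∷_) (applyUpTo-nth d xs)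

map-nth-upTo : (d : A) (xs : List A) → map (λ t → nth d xs (suc t)) (upTo (length xs)) ≡ xs
map-nth-upTo d xs = trans (map-upTo _ (length xs)) (applyUpTo-nth d xs)

nth-∈ : (d : A) → ∀ {xs i} → 1 ≤ i → i ≤ length xs → nth d xs i ∈ xs
nth-∈ d {x ∷ xs} {suc zero} _ _ = here refl
nth-∈ d {x ∷ xs} {suc (suc i)} _ (s≤s i<n) = there (nth-∈ d (s≤s z≤n) i<n)

∈-nth : (d : A) → ∀ {x xs} → x ∈ xs → ∃ λ i → 1 ≤ i × i ≤ length xs × nth d xs i ≡ x
∈-nth d (here refl) = 1 , ≤-refl , s≤s z≤n , refl
∈-nth d (there x∈) with ∈-nth d x∈
... | suc i , 1≤i , i≤n , e = suc (suc i) , s≤s z≤n , s≤s i≤n , e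

nth-injective : (d : A) → ∀ {xs i j} → Unique xs → 1 ≤ i → i ≤ length xs → 1 ≤ j → j ≤ length xs →
  nth d xs i ≡ nth d xs j → i ≡ j
nth-injective d {i = suc zero} {suc zero} _ _ _ _ _ _ = refl
nth-injective d {x ∷ xs} {suc zero} {suc (suc j)} (x∉ ∷ _) _ _ _ (s≤s j≤) e =
  contradiction e (All.lookup x∉ (nth-∈ d (s≤s z≤n) j≤))
nth-injective d {x ∷ xs} {suc (suc i)} {suc zero} (x∉ ∷ _) _ (s≤s i≤) _ _ e =
  contradiction (sym e) (All.lookup x∉ (nth-∈ d (s≤s z≤n) i≤))
nth-injective d {x ∷ xs} {suc (suc i)} {suc (suc j)} (_ ∷ u) _ (s≤s i≤) _ (s≤s j≤) e =
  cong suc (nth-injective d u (s≤s z≤n) i≤ (s≤s z≤n) j≤ e)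

nth-take : (d : A) → ∀ k xs {i} → i ≤ k → nth d (take k xs) i ≡ nth d xs i
nth-take d zero [] z≤n = refl
nth-take d zero (x ∷ xs) z≤n = refl
nth-take d (suc k) [] _ = refl
nth-take d (suc k) (x ∷ xs) {zero} _ = refl
nth-take d (suc k) (x ∷ xs) {suc zero} _ = refl
nth-take d (suc k) (x ∷ xs) {suc (suc i)} (s≤s i≤k) = nth-take d k xs i≤k

nth-++ʳ : (d : A) → ∀ xs {ys i} → 1 ≤ i → nth d (xs ++ ys) (length xs + i) ≡ nth d ys i
nth-++ʳ d [] _ = refl
nth-++ʳ d (x ∷ []) {i = suc i} _ = refl
nth-++ʳ d (x ∷ y ∷ xs) 1≤i = nth-++ʳ d (y ∷ xs) 1≤i

nth-++ˡ : (d : A) → ∀ xs {ys i} → i ≤ length xs → 1 ≤ i → nth d (xs ++ ys) i ≡ nth d xs i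
nth-++ˡ d (x ∷ xs) {i = suc zero} _ _ = refl
nth-++ˡ d (x ∷ xs) {i = suc (suc i)} (s≤s i≤) _ = nth-++ˡ d xs i≤ (s≤s z≤n)

-- Lengths of permutations

-- The recursive form of `ℓ`. It splits along `_++_`, and this is how the effect of exchanging two
-- entries is computed.
inv : List ℕ → ℕ
inv [] = 0
inv (x ∷ xs) = count (_<ᵇ x) xs + inv xs

sum-map-map : (f : B → ℕ) (g : A → B) (xs : List A) → sum (map f (map g xs)) ≡ sum (map (f ∘ g) xs)
sum-map-map f g xs = cong sum (sym (map-∘ xs))

sum-front : ∀ f n → sum (map f (map suc (applyUpTo suc n))) ≡ sum (map (f ∘ suc ∘ suc) (upTo n))
sum-front f n = begin
  sum (map f (map suc (applyUpTo suc n)))      ≡⟨ sum-map-map f suc (applyUpTo suc n) ⟩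
  sum (map (f ∘ suc) (applyUpTo suc n))        ≡⟨ cong (sum ∘ map (f ∘ suc)) (map-upTo suc n) ⟨
  sum (map (f ∘ suc) (map suc (upTo n)))       ≡⟨ sum-map-map (f ∘ suc) suc (upTo n) ⟩
  sum (map (f ∘ suc ∘ suc) (upTo n))           ∎
  where open ≡-Reasoning

ℓ≡inv : ∀ w → ℓ w ≡ inv w
ℓ≡inv [] = refl
ℓ≡inv (x ∷ xs) = cong₂ _+_ first rest
  where
  open ≡-Reasoning
  N = length xs
  I : List ℕ → ℕ → ℕ → Bool
  I w i j = (i <ᵇ j) ∧ (w ⟨ j ⟩ <ᵇ w ⟨ i ⟩)
  tail-[1…] : applyUpTo suc N ≡ [1… N ]
  tail-[1…] = sym (map-upTo suc N)
  first : count (I (x ∷ xs) 1) [1… suc N ] ≡ count (_<ᵇ x) xs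
  first = begin
    count (I (x ∷ xs) 1) (map suc (applyUpTo suc N))                ≡⟨ cong (count (I (x ∷ xs) 1) ∘ map suc) tail-[1…] ⟩
    count (I (x ∷ xs) 1) (map suc (map suc (upTo N)))               ≡⟨ count-map _ suc (map suc (upTo N)) ⟩
    count (I (x ∷ xs) 1 ∘ suc) (map suc (upTo N))                   ≡⟨ count-map _ suc (upTo N) ⟩
    count (λ t → xs ⟨ suc t ⟩ <ᵇ x) (upTo N)                        ≡⟨ count-map (_<ᵇ x) (λ t → xs ⟨ suc t ⟩) (upTo N) ⟨
    count (_<ᵇ x) (map (λ t → xs ⟨ suc t ⟩) (upTo N))               ≡⟨ cong (count (_<ᵇ x)) (map-nth-upTo 0 xs) ⟩
    count (_<ᵇ x) xs                                                ∎
  shifted : ∀ t → count (I (x ∷ xs) (suc (suc t))) [1… suc N ] ≡ count (I xs (suc t)) [1… N ]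
  shifted t = begin
    count (I (x ∷ xs) (suc (suc t))) (map suc (applyUpTo suc N))    ≡⟨ cong (count (I (x ∷ xs) (suc (suc t))) ∘ map suc) tail-[1…] ⟩
    count (I (x ∷ xs) (suc (suc t))) (map suc (map suc (upTo N)))   ≡⟨ count-map _ suc (map suc (upTo N)) ⟩
    count (I (x ∷ xs) (suc (suc t)) ∘ suc) (map suc (upTo N))       ≡⟨ count-map _ suc (upTo N) ⟩
    count (I xs (suc t) ∘ suc) (upTo N)                             ≡⟨ count-map _ suc (upTo N) ⟨
    count (I xs (suc t)) [1… N ]                                    ∎
  h : ℕ → ℕ
  h i = count (I (x ∷ xs) i) [1… suc N ]
  rest : sum (map h (map suc (applyUpTo suc N))) ≡ inv xs
  rest = begin
    sum (map h (map suc (applyUpTo suc N)))                  ≡⟨ sum-front h N ⟩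
    sum (map (h ∘ suc ∘ suc) (upTo N))                       ≡⟨ sum-cong (All.universal shifted (upTo N)) ⟩
    sum (map (λ t → count (I xs (suc t)) [1… N ]) (upTo N))  ≡⟨ sum-map-map (λ i → count (I xs i) [1… N ]) suc (upTo N) ⟨
    ℓ xs                                                     ≡⟨ ℓ≡inv xs ⟩
    inv xs                                                   ∎

cross : List ℕ → List ℕ → ℕ
cross xs ys = sum (map (λ x → count (_<ᵇ x) ys) xs)

inv-++ : ∀ xs ys → inv (xs ++ ys) ≡ inv xs + cross xs ys + inv ys
inv-++ [] ys = refl
inv-++ (x ∷ xs) ys = begin
  count (_<ᵇ x) (xs ++ ys) + inv (xs ++ ys)
    ≡⟨ cong₂ _+_ (count-++ (_<ᵇ x) xs ys) (inv-++ xs ys) ⟩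
  count (_<ᵇ x) xs + count (_<ᵇ x) ys + (inv xs + cross xs ys + inv ys)
    ≡⟨ solve 5 (λ a b c d e → a :+ b :+ (c :+ d :+ e) := a :+ c :+ (b :+ d) :+ e) refl (count (_<ᵇ x) xs) _ (inv xs) _ _ ⟩
  count (_<ᵇ x) xs + inv xs + (count (_<ᵇ x) ys + cross xs ys) + inv ys ∎
  where open ≡-Reasoning; open +-*-Solver

cross-∷ : ∀ xs q zs → cross xs (q ∷ zs) ≡ count (q <ᵇ_) xs + cross xs zs
cross-∷ xs q zs = begin
  sum (map (λ x → count (_<ᵇ x) (q ∷ zs)) xs)
    ≡⟨ sum-cong (All.universal (λ x → count-∷ (_<ᵇ x) q zs) xs) ⟩
  sum (map (λ x → 𝟙 (q <ᵇ x) + count (_<ᵇ x) zs) xs)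
    ≡⟨ sum-+ (λ x → 𝟙 (q <ᵇ x)) _ xs ⟩
  sum (map (λ x → 𝟙 (q <ᵇ x)) xs) + cross xs zs
    ≡⟨ cong (_+ cross xs zs) (count≡sum (q <ᵇ_) xs) ⟨
  count (q <ᵇ_) xs + cross xs zs ∎
  where open ≡-Reasoning

between : ℕ → ℕ → ℕ → Bool
between q p y = (q <ᵇ y) ∧ (y <ᵇ p)

module _ {p q : ℕ} (q<p : q < p) where

  count-below : ∀ {ys} → All (λ y → y ≢ q) ys →
    count (_<ᵇ p) ys ≡ count (_<ᵇ q) ys + count (between q p) ys
  count-below [] = refl
  count-below {y ∷ ys} (y≢q ∷ ys≢) with <-cmp y q
  ... | tri≈ _ y≡q _ = contradiction y≡q y≢q
  ... | tri< y<q _ _ rewrite <ᵇ-true (<-trans y<q q<p) | <ᵇ-true y<q | <ᵇ-false (<⇒≤ y<q) = cong suc (count-below ys≢)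
  ... | tri> _ _ q<y rewrite <ᵇ-false (<⇒≤ q<y) | <ᵇ-true q<y with y <ᵇ p
  ...   | true = trans (cong suc (count-below ys≢)) (sym (+-suc _ _))
  ...   | false = count-below ys≢

  count-above : ∀ {ys} → All (λ y → y ≢ p) ys →
    count (q <ᵇ_) ys ≡ count (p <ᵇ_) ys + count (between q p) ys
  count-above [] = refl
  count-above {y ∷ ys} (y≢p ∷ ys≢) with <-cmp y p
  ... | tri≈ _ y≡p _ = contradiction y≡p y≢p
  ... | tri> _ _ p<y rewrite <ᵇ-true (<-trans q<p p<y) | <ᵇ-true p<y | <ᵇ-false (<⇒≤ p<y) = cong suc (count-above ys≢)
  ... | tri< y<p _ _ rewrite <ᵇ-false (<⇒≤ y<p) | <ᵇ-true y<p with q <ᵇ y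
  ...   | true = trans (cong suc (count-above ys≢)) (sym (+-suc _ _))
  ...   | false = count-above ys≢

  -- The pair (p , q) itself gives the 1. An entry of `ys` strictly between `q` and `p` is inverted
  -- with both of them on the left side and with neither on the right; any other entry of `ys` forms
  -- equally many inversions on both sides. Entries of `zs` have both values before them either way.
  inv-exchange : ∀ {ys} zs → All (_≢ p) ys → All (_≢ q) ys →
    inv (p ∷ ys ++ q ∷ zs) ≡ suc (2 * count (between q p) ys) + inv (q ∷ ys ++ p ∷ zs)
  inv-exchange {ys} zs ys≢p ys≢q = begin
    inv (p ∷ ys ++ q ∷ zs)
      ≡⟨ expand p q ⟩
    _
      ≡⟨ cong₂ (λ a b → a + (𝟙 (q <ᵇ p) + c p) + (inv ys + (b + cross ys zs) + (c q + inv zs))) (count-below ys≢q) (count-above ys≢p) ⟩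
    _
      ≡⟨ cong (λ b → count (_<ᵇ q) ys + m + (𝟙 b + c p) + (inv ys + (count (p <ᵇ_) ys + m + cross ys zs) + (c q + inv zs))) (<ᵇ-true q<p) ⟩
    _
      ≡⟨ solve 8 (λ a m cp i d x cq z →
           a :+ m :+ (con 1 :+ cp) :+ (i :+ (d :+ m :+ x) :+ (cq :+ z))
             := con 1 :+ (con 2 :* m) :+ (a :+ cq :+ (i :+ (d :+ x) :+ (cp :+ z))))
           refl (count (_<ᵇ q) ys) m (c p) (inv ys) (count (p <ᵇ_) ys) (cross ys zs) (c q) (inv zs) ⟩
    suc (2 * m) + (count (_<ᵇ q) ys + c q + (inv ys + (count (p <ᵇ_) ys + cross ys zs) + (c p + inv zs)))
      ≡⟨ cong (λ b → suc (2 * m) + (count (_<ᵇ q) ys + (𝟙 b + c q) + (inv ys + (count (p <ᵇ_) ys + cross ys zs) + (c p + inv zs)))) (<ᵇ-false (<⇒≤ q<p)) ⟨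
    _
      ≡⟨ cong (suc (2 * m) +_) (expand q p) ⟨
    suc (2 * m) + inv (q ∷ ys ++ p ∷ zs) ∎
    where
    open ≡-Reasoning
    open +-*-Solver
    m = count (between q p) ys
    c : ℕ → ℕ
    c x = count (_<ᵇ x) zs
    expand : ∀ p q → inv (p ∷ ys ++ q ∷ zs) ≡
      count (_<ᵇ p) ys + (𝟙 (q <ᵇ p) + c p) + (inv ys + (count (q <ᵇ_) ys + cross ys zs) + (c q + inv zs))
    expand p q = cong₂ _+_
      (trans (count-++ (_<ᵇ p) ys (q ∷ zs)) (cong (count (_<ᵇ p) ys +_) (count-∷ (_<ᵇ p) q zs)))
      (trans (inv-++ ys (q ∷ zs)) (cong (λ t → inv ys + t + (c q + inv zs)) (cross-∷ ys q zs)))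

-- Transpositions acting on lists

exchange-↭ : (xs : List A) (p : A) (ys : List A) (q : A) (zs : List A) →
  xs ++ q ∷ ys ++ p ∷ zs ↭ xs ++ p ∷ ys ++ q ∷ zs
exchange-↭ xs p ys q zs = ++⁺ˡ xs (↭-trans (prep q (shift p ys zs))
  (↭-trans (swap q p ↭-refl) (prep p (↭-sym (shift q ys zs)))))

length-swapPos : ∀ w a b → length (swapPos w a b) ≡ length w
length-swapPos w a b = trans (length-map _ [1… length w ]) (length-[1…] (length w))

module _ {w : List ℕ} {a b : ℕ} where

  swapPos-left : 1 ≤ a → a ≤ length w → swapPos w a b ⟨ a ⟩ ≡ w ⟨ b ⟩
  swapPos-left 1≤a a≤n = trans (nth-map-[1…] 0 _ 1≤a a≤n) value
    where
    value : (if a ≡ᵇ a then w ⟨ b ⟩ else (if a ≡ᵇ b then w ⟨ a ⟩ else w ⟨ a ⟩)) ≡ w ⟨ b ⟩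
    value rewrite ≡ᵇ-refl a = refl

  swapPos-right : 1 ≤ b → b ≤ length w → swapPos w a b ⟨ b ⟩ ≡ w ⟨ a ⟩
  swapPos-right 1≤b b≤n = trans (nth-map-[1…] 0 _ 1≤b b≤n) value
    where
    value : (if b ≡ᵇ a then w ⟨ b ⟩ else (if b ≡ᵇ b then w ⟨ a ⟩ else w ⟨ b ⟩)) ≡ w ⟨ a ⟩
    value rewrite ≡ᵇ-refl b with b ≡ᵇ a in e
    ... | true = cong (w ⟨_⟩) (≡ᵇ⇒≡ b a (≡true⇒T e))
    ... | false = refl

  swapPos-other : ∀ {i} → i ≢ a → i ≢ b → 1 ≤ i → i ≤ length w → swapPos w a b ⟨ i ⟩ ≡ w ⟨ i ⟩
  swapPos-other {i} i≢a i≢b 1≤i i≤n = trans (nth-map-[1…] 0 _ 1≤i i≤n) value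
    where
    value : (if i ≡ᵇ a then w ⟨ b ⟩ else (if i ≡ᵇ b then w ⟨ a ⟩ else w ⟨ i ⟩)) ≡ w ⟨ i ⟩
    value rewrite ≡ᵇ-false i≢a | ≡ᵇ-false i≢b = refl

nth-ext : (xs ys : List ℕ) → length xs ≡ length ys → (∀ i → 1 ≤ i → i ≤ length xs → xs ⟨ i ⟩ ≡ ys ⟨ i ⟩) → xs ≡ ys
nth-ext [] [] _ _ = refl
nth-ext (x ∷ xs) (y ∷ ys) e f = cong₂ _∷_ (f 1 ≤-refl (s≤s z≤n))
  (nth-ext xs ys (suc-injective e) λ { (suc i) _ i≤ → f (suc (suc i)) (s≤s z≤n) (s≤s i≤) })

swapPos-involutive : ∀ w {a b} → 1 ≤ a → a < b → b ≤ length w → swapPos (swapPos w a b) a b ≡ w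
swapPos-involutive w {a} {b} 1≤a a<b b≤n = nth-ext _ _ len value
  where
  1≤b = ≤-trans 1≤a (<⇒≤ a<b)
  a≤n = ≤-trans (<⇒≤ a<b) b≤n
  len′ = length-swapPos w a b
  len = trans (length-swapPos (swapPos w a b) a b) len′
  a≤n′ = subst (a ≤_) (sym len′) a≤n
  b≤n′ = subst (b ≤_) (sym len′) b≤n
  value : ∀ i → 1 ≤ i → i ≤ length (swapPos (swapPos w a b) a b) → swapPos (swapPos w a b) a b ⟨ i ⟩ ≡ w ⟨ i ⟩
  value i 1≤i i≤ with i ≟ a | i ≟ b
  ... | yes refl | _ = trans (swapPos-left {swapPos w a b} 1≤a a≤n′) (swapPos-right {w} 1≤b b≤n)
  ... | no _ | yes refl = trans (swapPos-right {swapPos w a b} 1≤b b≤n′) (swapPos-left {w} 1≤a a≤n)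
  ... | no i≢a | no i≢b = trans (swapPos-other {swapPos w a b} i≢a i≢b 1≤i (subst (i ≤_) (length-swapPos (swapPos w a b) a b) i≤))
                                (swapPos-other {w} i≢a i≢b 1≤i (subst (i ≤_) len i≤))

nth-split : (d : A) (w : List A) → ∀ {a} → 1 ≤ a → a ≤ length w →
  ∃ λ xs → ∃ λ ys → w ≡ xs ++ nth d w a ∷ ys × suc (length xs) ≡ a
nth-split d (x ∷ w) {suc zero} _ _ = [] , w , refl , refl
nth-split d (x ∷ w) {suc (suc a)} _ (s≤s a≤) with nth-split d w (s≤s z≤n) a≤
... | xs , ys , e , l = x ∷ xs , ys , cong (x ∷_) e , cong suc l

nth-mid : (d : A) → ∀ xs p zs → nth d (xs ++ p ∷ zs) (suc (length xs)) ≡ p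
nth-mid d [] p zs = refl
nth-mid d (x ∷ xs) p zs = nth-mid d xs p zs

nth-mid-other : ∀ xs p q zs {i} → i ≢ suc (length xs) → (xs ++ p ∷ zs) ⟨ i ⟩ ≡ (xs ++ q ∷ zs) ⟨ i ⟩
nth-mid-other [] p q zs {zero} _ = refl
nth-mid-other [] p q zs {suc zero} i≢ = contradiction refl i≢
nth-mid-other [] p q zs {suc (suc i)} _ = refl
nth-mid-other (x ∷ xs) p q zs {zero} _ = refl
nth-mid-other (x ∷ xs) p q zs {suc zero} _ = refl
nth-mid-other (x ∷ xs) p q zs {suc (suc i)} i≢ = nth-mid-other xs p q zs (i≢ ∘ cong suc)

-- Translates between positions and pieces: `swapPos` is given by positions, the inversion count by
-- concatenation. The piece `ys` holds the values strictly between positions `a` and `b`.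
record Cut (w : List ℕ) (a b : ℕ) : Set where
  field
    xs ys zs : List ℕ
    w≡ : w ≡ xs ++ w ⟨ a ⟩ ∷ ys ++ w ⟨ b ⟩ ∷ zs
    a≡ : suc (length xs) ≡ a
    b≡ : a + suc (length ys) ≡ b

cut : ∀ w {a b} → 1 ≤ a → a < b → b ≤ length w → Cut w a b
cut w {a} {b} 1≤a a<b b≤n with nth-split 0 w 1≤a (≤-trans (<⇒≤ a<b) b≤n)
... | xs , r , e , la with nth-split 0 r {b ∸ a} (m<n⇒0<n∸m a<b) b∸a≤
  where
  lenw : length w ≡ a + length r
  lenw = trans (cong length e) (trans (length-++ xs) (trans (+-suc (length xs) _) (cong (_+ length r) la)))
  b∸a≤ : b ∸ a ≤ length r
  b∸a≤ = ≤-trans (∸-monoˡ-≤ a (≤-trans b≤n (≤-reflexive lenw))) (≤-reflexive (m+n∸m≡n a (length r)))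
... | ys , zs , e′ , lb = record
  { xs = xs ; ys = ys ; zs = zs
  ; w≡ = trans e (cong (λ t → xs ++ w ⟨ a ⟩ ∷ t) (trans e′ (cong (λ t → ys ++ t ∷ zs) (sym wb))))
  ; a≡ = la
  ; b≡ = trans (cong (a +_) lb) (m+[n∸m]≡n (<⇒≤ a<b)) }
  where
  open ≡-Reasoning
  1≤d : 1 ≤ b ∸ a
  1≤d = m<n⇒0<n∸m a<b
  wb : w ⟨ b ⟩ ≡ r ⟨ b ∸ a ⟩
  wb = begin
    w ⟨ b ⟩                                            ≡⟨ cong (_⟨ b ⟩) e ⟩
    (xs ++ w ⟨ a ⟩ ∷ r) ⟨ b ⟩                          ≡⟨ cong (_⟨ b ⟩) (++-assoc xs [ w ⟨ a ⟩ ] r) ⟨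
    ((xs ++ [ w ⟨ a ⟩ ]) ++ r) ⟨ b ⟩                   ≡⟨ cong (((xs ++ [ w ⟨ a ⟩ ]) ++ r) ⟨_⟩) b≡′ ⟩
    ((xs ++ [ w ⟨ a ⟩ ]) ++ r) ⟨ length (xs ++ [ w ⟨ a ⟩ ]) + (b ∸ a) ⟩ ≡⟨ nth-++ʳ 0 (xs ++ [ w ⟨ a ⟩ ]) 1≤d ⟩
    r ⟨ b ∸ a ⟩                                        ∎
    where
    b≡′ : b ≡ length (xs ++ [ w ⟨ a ⟩ ]) + (b ∸ a)
    b≡′ = begin
      b ≡⟨ m+[n∸m]≡n (<⇒≤ a<b) ⟨
      a + (b ∸ a) ≡⟨ cong (_+ (b ∸ a)) (trans (sym la) (trans (+-comm 1 _) (sym (length-++ xs)))) ⟩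
      length (xs ++ [ w ⟨ a ⟩ ]) + (b ∸ a) ∎

module _ {w : List ℕ} {a b : ℕ} (1≤a : 1 ≤ a) (a<b : a < b) (b≤n : b ≤ length w) (C : Cut w a b) where
  private
    module C = Cut C
    p = w ⟨ a ⟩
    q = w ⟨ b ⟩

  swapPos-cut : swapPos w a b ≡ C.xs ++ q ∷ C.ys ++ p ∷ C.zs
  swapPos-cut = nth-ext _ _ len value
    where
    open ≡-Reasoning
    lenw : length w ≡ length (C.xs ++ q ∷ C.ys ++ p ∷ C.zs)
    lenw = trans (cong length C.w≡) (↭-length (exchange-↭ C.xs q C.ys p C.zs))
    len = trans (length-swapPos w a b) lenw
    assoc : ∀ x y → (C.xs ++ x ∷ C.ys) ++ y ∷ C.zs ≡ C.xs ++ x ∷ C.ys ++ y ∷ C.zs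
    assoc x y = ++-assoc C.xs (x ∷ C.ys) (y ∷ C.zs)
    lenb : ∀ x → suc (length (C.xs ++ x ∷ C.ys)) ≡ b
    lenb x = trans (cong suc (length-++ C.xs)) (trans (cong (_+ suc (length C.ys)) C.a≡) C.b≡)
    value : ∀ i → 1 ≤ i → i ≤ length (swapPos w a b) → swapPos w a b ⟨ i ⟩ ≡ (C.xs ++ q ∷ C.ys ++ p ∷ C.zs) ⟨ i ⟩
    value i 1≤i i≤ with i ≟ a | i ≟ b
    ... | yes refl | _ = trans (swapPos-left {w} 1≤a (≤-trans (<⇒≤ a<b) b≤n))
      (sym (trans (cong ((C.xs ++ q ∷ C.ys ++ p ∷ C.zs) ⟨_⟩) (sym C.a≡)) (nth-mid 0 C.xs q _)))
    ... | no _ | yes refl = trans (swapPos-right {w} (≤-trans 1≤a (<⇒≤ a<b)) b≤n)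
      (sym (trans (cong₂ _⟨_⟩ (sym (assoc q p)) (sym (lenb q))) (nth-mid 0 (C.xs ++ q ∷ C.ys) p C.zs)))
    ... | no i≢a | no i≢b = begin
      swapPos w a b ⟨ i ⟩                      ≡⟨ swapPos-other {w} i≢a i≢b 1≤i (subst (i ≤_) (length-swapPos w a b) i≤) ⟩
      w ⟨ i ⟩                                  ≡⟨ cong (_⟨ i ⟩) C.w≡ ⟩
      -- One position is changed at a time, passing through the list that has `q` at both places.
      (C.xs ++ p ∷ C.ys ++ q ∷ C.zs) ⟨ i ⟩     ≡⟨ nth-mid-other C.xs p q _ (λ e → i≢a (trans e C.a≡)) ⟩
      (C.xs ++ q ∷ C.ys ++ q ∷ C.zs) ⟨ i ⟩     ≡⟨ cong (_⟨ i ⟩) (assoc q q) ⟨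
      ((C.xs ++ q ∷ C.ys) ++ q ∷ C.zs) ⟨ i ⟩   ≡⟨ nth-mid-other (C.xs ++ q ∷ C.ys) q p C.zs (λ e → i≢b (trans e (lenb q))) ⟩
      ((C.xs ++ q ∷ C.ys) ++ p ∷ C.zs) ⟨ i ⟩   ≡⟨ cong (_⟨ i ⟩) (assoc q p) ⟩
      (C.xs ++ q ∷ C.ys ++ p ∷ C.zs) ⟨ i ⟩     ∎

  nth-inner : ∀ {c} → a < c → c < b → w ⟨ c ⟩ ∈ C.ys
  nth-inner {c} a<c c<b = subst (_∈ C.ys) (sym value) (nth-∈ 0 1≤d d≤)
    where
    open ≡-Reasoning
    1≤d : 1 ≤ c ∸ a
    1≤d = m<n⇒0<n∸m a<c
    d≤ : c ∸ a ≤ length C.ys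
    d≤ = ≤-pred (+-cancelˡ-< a _ _ (subst₂ _<_ (sym (m+[n∸m]≡n (<⇒≤ a<c))) (sym C.b≡) c<b))
    len : length (C.xs ++ [ p ]) ≡ a
    len = trans (length-++ C.xs) (trans (+-comm _ 1) C.a≡)
    value : w ⟨ c ⟩ ≡ C.ys ⟨ c ∸ a ⟩
    value = begin
      w ⟨ c ⟩                                                  ≡⟨ cong₂ _⟨_⟩ C.w≡ (sym (m+[n∸m]≡n (<⇒≤ a<c))) ⟩
      (C.xs ++ p ∷ C.ys ++ q ∷ C.zs) ⟨ a + (c ∸ a) ⟩           ≡⟨ cong₂ _⟨_⟩ (++-assoc C.xs [ p ] _) (cong (_+ (c ∸ a)) len) ⟨
      ((C.xs ++ [ p ]) ++ C.ys ++ q ∷ C.zs) ⟨ length (C.xs ++ [ p ]) + (c ∸ a) ⟩ ≡⟨ nth-++ʳ 0 (C.xs ++ [ p ]) 1≤d ⟩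
      (C.ys ++ q ∷ C.zs) ⟨ c ∸ a ⟩                             ≡⟨ nth-++ˡ 0 C.ys d≤ 1≤d ⟩
      C.ys ⟨ c ∸ a ⟩                                           ∎

swapPos-↭ : ∀ {w a b} → 1 ≤ a → a < b → b ≤ length w → swapPos w a b ↭ w
swapPos-↭ {w} {a} {b} 1≤a a<b b≤n = go (cut w 1≤a a<b b≤n)
  where
  go : Cut w a b → swapPos w a b ↭ w
  go C = subst₂ _↭_ (sym (swapPos-cut 1≤a a<b b≤n C)) (sym w≡) (exchange-↭ xs (w ⟨ a ⟩) ys (w ⟨ b ⟩) zs)
    where open Cut C

Unique-++ʳ : (xs : List A) {ys : List A} → Unique (xs ++ ys) → Unique ys
Unique-++ʳ [] u = u
Unique-++ʳ (_ ∷ xs) (_ ∷ u) = Unique-++ʳ xs u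

inv-exchange-++ : ∀ xs {p} ys {q} zs → Unique (xs ++ p ∷ ys ++ q ∷ zs) → q < p →
  inv (xs ++ p ∷ ys ++ q ∷ zs) ≡ suc (2 * count (between q p) ys) + inv (xs ++ q ∷ ys ++ p ∷ zs)
inv-exchange-++ xs {p} ys {q} zs unique q<p = begin
  inv (xs ++ R)                             ≡⟨ inv-++ xs R ⟩
  inv xs + cross xs R + inv R               ≡⟨ cong₂ (λ s t → inv xs + s + t) cross-swap (inv-exchange q<p zs ys≢p ys≢q) ⟩
  inv xs + cross xs R′ + (M + inv R′)       ≡⟨ rearrange (inv xs + cross xs R′) M (inv R′) ⟩
  M + (inv xs + cross xs R′ + inv R′)       ≡⟨ cong (M +_) (inv-++ xs R′) ⟨
  M + inv (xs ++ R′)                        ∎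
  where
  open ≡-Reasoning
  open +-*-Solver
  R = p ∷ ys ++ q ∷ zs
  R′ = q ∷ ys ++ p ∷ zs
  M = suc (2 * count (between q p) ys)
  rearrange : ∀ x m r → x + (m + r) ≡ m + (x + r)
  rearrange = solve 3 (λ x m r → x :+ (m :+ r) := m :+ (x :+ r)) refl
  -- Inversions with an entry of `xs` depend on the rest only up to reordering.
  cross-swap : cross xs R ≡ cross xs R′
  cross-swap = sum-cong (All.universal (λ x → count-↭ (_<ᵇ x) (exchange-↭ [] q ys p zs)) xs)
  ys≢p : All (_≢ p) ys
  ys≢p with Unique-++ʳ xs unique
  ... | p∉ ∷ _ = All.map (λ ne e → ne (sym e)) (Allₚ.++⁻ˡ ys p∉)
  ys≢q : All (_≢ q) ys
  ys≢q with Unique-++ʳ xs unique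
  ... | _ ∷ u = go ys u
    where
    go : ∀ ys → Unique (ys ++ q ∷ zs) → All (_≢ q) ys
    go [] _ = []
    go (y ∷ ys) (y∉ ∷ u) = All.lookup y∉ (∈-insert ys) ∷ go ys u

count-zero : {p : A → Bool} {xs : List A} → count p xs ≡ 0 → All (λ x → p x ≡ false) xs
count-zero {xs = []} _ = []
count-zero {p = p} {x ∷ xs} e with p x in px
... | false = px ∷ count-zero e

count-full : {p : A → Bool} (xs : List A) → count p xs ≡ length xs → All (λ x → p x ≡ true) xs
count-full [] _ = []
count-full {p = p} (x ∷ xs) e with p x in px
... | true = px ∷ count-full xs (suc-injective e)
... | false = contradiction (count≤length p xs) (<⇒≱ (≤-reflexive (sym e)))

-- Permutations and the change of length under a transposition

Unique-[1…] : ∀ n → Unique [1… n ]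
Unique-[1…] n = Uniqueₚ.map⁺ suc-injective (Uniqueₚ.upTo⁺ n)

Perm : ℕ → List ℕ → Set
Perm n w = w ↭ [1… n ]

module _ {n : ℕ} {w : List ℕ} (w∈S : Perm n w) where

  Perm-length : length w ≡ n
  Perm-length = trans (↭-length w∈S) (length-[1…] n)

  Perm-Unique : Unique w
  Perm-Unique = Permₛ.Unique-resp-↭ (setoid ℕ) (↭⇒↭ₛ (↭-sym w∈S)) (Unique-[1…] n)

  Perm-injective : ∀ {i j} → 1 ≤ i → i ≤ n → 1 ≤ j → j ≤ n → w ⟨ i ⟩ ≡ w ⟨ j ⟩ → i ≡ j
  Perm-injective {i} {j} 1≤i i≤n 1≤j j≤n = nth-injective 0 Perm-Unique
    1≤i (subst (i ≤_) (sym Perm-length) i≤n) 1≤j (subst (j ≤_) (sym Perm-length) j≤n)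

  Perm-range : ∀ {i} → 1 ≤ i → i ≤ n → 1 ≤ w ⟨ i ⟩ × w ⟨ i ⟩ ≤ n
  Perm-range {i} 1≤i i≤n = ∈-[1…]⁻ (∈-resp-↭ w∈S (nth-∈ 0 1≤i (subst (i ≤_) (sym Perm-length) i≤n)))

Perm-swapPos : ∀ {n w a b} → Perm n w → 1 ≤ a → a < b → b ≤ n → Perm n (swapPos w a b)
Perm-swapPos {b = b} w∈S 1≤a a<b b≤n =
  ↭-trans (swapPos-↭ 1≤a a<b (subst (b ≤_) (sym (Perm-length w∈S)) b≤n)) w∈S

∧-true : ∀ {x y} → x ∧ y ≡ true → x ≡ true × y ≡ true
∧-true {true} {true} _ = refl , refl

-- m is the number of positions strictly between a and b whose values lie strictly
-- between those at a and b; the sharp cases m = 0 and m = b − a − 1 are spelled out.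
record Exchange (w : List ℕ) (a b lo hi : ℕ) : Set where
  field
    m : ℕ
    e : ℕ
    m+e : suc (m + e) ≡ b ∸ a
    none : m ≡ 0 → ∀ c → a < c → c < b → lo < w ⟨ c ⟩ → w ⟨ c ⟩ < hi → ⊥
    all : e ≡ 0 → ∀ c → a < c → c < b → lo < w ⟨ c ⟩ × w ⟨ c ⟩ < hi

between-true : ∀ {q p y} → between q p y ≡ true → q < y × y < p
between-true {q} {p} {y} e = let (l , r) = ∧-true e in <ᵇ⇒< q y (≡true⇒T l) , <ᵇ⇒< y p (≡true⇒T r)

between-false : ∀ {q p y} → between q p y ≡ false → q < y → y < p → ⊥
between-false {q} {p} {y} e q<y y<p = case trans (sym e) (cong₂ _∧_ (<ᵇ-true q<y) (<ᵇ-true y<p)) of λ ()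

ℓ-exchange : ∀ {n w} → Perm n w → ∀ {a b} → 1 ≤ a → a < b → b ≤ n → w ⟨ b ⟩ < w ⟨ a ⟩ →
  Σ (Exchange w a b (w ⟨ b ⟩) (w ⟨ a ⟩)) λ X → ℓ w ≡ suc (2 * Exchange.m X) + ℓ (swapPos w a b)
ℓ-exchange {n} {w} w∈S {a} {b} 1≤a a<b b≤n q<p = go (cut w 1≤a a<b b≤len)
  where
  b≤len : b ≤ length w
  b≤len = subst (b ≤_) (sym (Perm-length w∈S)) b≤n
  p = w ⟨ a ⟩
  q = w ⟨ b ⟩
  go : Cut w a b → Σ (Exchange w a b q p) λ X → ℓ w ≡ suc (2 * Exchange.m X) + ℓ (swapPos w a b)
  -- `e` counts the positions between `a` and `b` whose values are not between the swapped ones;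
  -- twice this number will be the defect of an upward step.
  go C = record { m = m ; e = length ys ∸ m ; m+e = m+e ; none = none ; all = all } , lengths
    where
    open ≡-Reasoning
    open Cut C
    m = count (between q p) ys
    m≤ : m ≤ length ys
    m≤ = count≤length (between q p) ys
    m+e : suc (m + (length ys ∸ m)) ≡ b ∸ a
    m+e = trans (cong suc (m+[n∸m]≡n m≤)) (trans (sym (m+n∸m≡n a (suc (length ys)))) (cong (_∸ a) b≡))
    none : m ≡ 0 → ∀ c → a < c → c < b → q < w ⟨ c ⟩ → w ⟨ c ⟩ < p → ⊥
    none m≡0 c a<c c<b = between-false (All.lookup (count-zero {p = between q p} {ys} m≡0) (nth-inner 1≤a a<b b≤len C a<c c<b))
    all : length ys ∸ m ≡ 0 → ∀ c → a < c → c < b → q < w ⟨ c ⟩ × w ⟨ c ⟩ < p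
    all e≡0 c a<c c<b = between-true (All.lookup (count-full {p = between q p} ys (≤-antisym m≤ (m∸n≡0⇒m≤n e≡0))) (nth-inner 1≤a a<b b≤len C a<c c<b))
    lengths : ℓ w ≡ suc (2 * m) + ℓ (swapPos w a b)
    lengths = begin
      ℓ w                                         ≡⟨ ℓ≡inv w ⟩
      inv w                                       ≡⟨ cong inv w≡ ⟩
      inv (xs ++ p ∷ ys ++ q ∷ zs)                ≡⟨ inv-exchange-++ xs ys zs (subst Unique w≡ (Perm-Unique w∈S)) q<p ⟩
      suc (2 * m) + inv (xs ++ q ∷ ys ++ p ∷ zs)  ≡⟨ cong (λ t → suc (2 * m) + inv t) (swapPos-cut 1≤a a<b b≤len C) ⟨
      suc (2 * m) + inv (swapPos w a b)           ≡⟨ cong (suc (2 * m) +_) (ℓ≡inv (swapPos w a b)) ⟨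
      suc (2 * m) + ℓ (swapPos w a b)             ∎

module _ {n : ℕ} {w : List ℕ} (w∈S : Perm n w) {a b : ℕ} (1≤a : 1 ≤ a) (a<b : a < b) (b≤n : b ≤ n) where

  private
    w′ = swapPos w a b
    1≤b = ≤-trans 1≤a (<⇒≤ a<b)
    b≤len : b ≤ length w
    b≤len = subst (b ≤_) (sym (Perm-length w∈S)) b≤n
    a≤len : a ≤ length w
    a≤len = ≤-trans (<⇒≤ a<b) b≤len
    wa′ : w′ ⟨ a ⟩ ≡ w ⟨ b ⟩
    wa′ = swapPos-left {w} 1≤a a≤len
    wb′ : w′ ⟨ b ⟩ ≡ w ⟨ a ⟩
    wb′ = swapPos-right {w} 1≤b b≤len

    w″≡w : swapPos w′ a b ≡ w
    w″≡w = swapPos-involutive w 1≤a a<b b≤len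
    inner : ∀ {c} → a < c → c < b → w′ ⟨ c ⟩ ≡ w ⟨ c ⟩
    inner a<c c<b = swapPos-other {w} (<⇒≢ a<c ∘ sym) (<⇒≢ c<b) (≤-trans 1≤a (<⇒≤ a<c)) (≤-trans (<⇒≤ c<b) b≤len)

  -- This is `ℓ-exchange` read from the other end: `swapPos` is an involution and leaves the values
  -- strictly between the two positions alone.
  ℓ-exchange-up : w ⟨ a ⟩ < w ⟨ b ⟩ →
    Σ (Exchange w a b (w ⟨ a ⟩) (w ⟨ b ⟩)) λ X → ℓ (swapPos w a b) ≡ suc (2 * Exchange.m X) + ℓ w
  ℓ-exchange-up wa<wb = go (ℓ-exchange (Perm-swapPos w∈S 1≤a a<b b≤n) 1≤a a<b b≤n (subst₂ _<_ (sym wb′) (sym wa′) wa<wb))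
    where
    go : (Σ (Exchange w′ a b (w′ ⟨ b ⟩) (w′ ⟨ a ⟩)) λ X → ℓ w′ ≡ suc (2 * Exchange.m X) + ℓ (swapPos w′ a b)) →
      Σ (Exchange w a b (w ⟨ a ⟩) (w ⟨ b ⟩)) λ X → ℓ w′ ≡ suc (2 * Exchange.m X) + ℓ w
    go (X , e) = record
      { m = X.m ; e = X.e ; m+e = X.m+e
      ; none = λ z c a<c c<b l u → X.none z c a<c c<b
          (subst₂ _<_ (sym wb′) (sym (inner a<c c<b)) l) (subst₂ _<_ (sym (inner a<c c<b)) (sym wa′) u)
      ; all = λ z c a<c c<b → let (l , u) = X.all z c a<c c<b in
          subst₂ _<_ wb′ (inner a<c c<b) l , subst₂ _<_ (inner a<c c<b) wa′ u }
      , trans e (cong (λ t → suc (2 * X.m) + ℓ t) w″≡w)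
      where module X = Exchange X

-- Foldings along edges of the quantum Bruhat graph

-- down: w covers w t_ab in Bruhat order;  up: ℓ (w t_ab) − ℓ w = 2 (b − a) − 1 is maximal.
-- These are the two kinds of edges w t_ab → w of the quantum Bruhat graph.
data QStep (w : List ℕ) (a b : ℕ) : Set where
  down : w ⟨ b ⟩ < w ⟨ a ⟩ → (w <Bᵇ swapPos w a b) ≡ false →
    (∀ c → a < c → c < b → w ⟨ b ⟩ < w ⟨ c ⟩ → w ⟨ c ⟩ < w ⟨ a ⟩ → ⊥) → QStep w a b
  up : w ⟨ a ⟩ < w ⟨ b ⟩ → (w <Bᵇ swapPos w a b) ≡ true →
    (∀ c → a < c → c < b → w ⟨ a ⟩ < w ⟨ c ⟩ × w ⟨ c ⟩ < w ⟨ b ⟩) → QStep w a b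

QPath : List ℕ → List Root → List Bool → Set
QPath w ((a , b) ∷ βs) (true ∷ bs) = QStep w a b × QPath (swapPos w a b) βs bs
QPath w ((a , b) ∷ βs) (false ∷ bs) = QPath w βs bs
QPath w _ _ = ⊤

IsRoot : ℕ → Root → Set
IsRoot n (a , b) = 1 ≤ a × a < b × b ≤ n

-- Sums over the negative foldings with a weight that depends on the root and not on its position in
-- Γ. Height is such a weight on all of Γ; the affine level becomes one inside a single block, where
-- it depends only on the row.
negSum : (Root → ℕ) → List ℕ → List Root → List Bool → ℕ
negSum g w ((a , b) ∷ βs) (true ∷ bs) =
  (if w <Bᵇ swapPos w a b then g (a , b) else 0) + negSum g (swapPos w a b) βs bs
negSum g w ((a , b) ∷ βs) (false ∷ bs) = negSum g w βs bs
negSum g w _ _ = 0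

height : Root → ℕ
height (a , b) = b ∸ a

-- The defect `D` is 2m for a step down and 2e for a step up, with `m` and `e` from `Exchange`.
-- Hence `D ≡ 0` is exactly the sharp case that an edge of the quantum Bruhat graph requires.
step-defect : ∀ {n w a b} → Perm n w → IsRoot n (a , b) →
  ∃ λ D → suc (ℓ (swapPos w a b)) + D ≡ ℓ w + 2 * (if w <Bᵇ swapPos w a b then b ∸ a else 0) × (D ≡ 0 → QStep w a b)
step-defect {n} {w} {a} {b} w∈S (1≤a , a<b , b≤n) = go (<-cmp (w ⟨ b ⟩) (w ⟨ a ⟩))
  where
  open ≡-Reasoning
  open +-*-Solver
  w′ = swapPos w a b
  Goal : Set
  Goal = ∃ λ D → suc (ℓ w′) + D ≡ ℓ w + 2 * (if ℓ w <ᵇ ℓ w′ then b ∸ a else 0) × (D ≡ 0 → QStep w a b)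
  weight-false : ∀ {t} → t ≡ false → ∀ l → l ≡ l + 2 * (if t then b ∸ a else 0)
  weight-false refl l = sym (+-identityʳ l)
  weight-true : ∀ {t} → t ≡ true → ∀ l → l + 2 * (b ∸ a) ≡ l + 2 * (if t then b ∸ a else 0)
  weight-true refl l = refl
  arith : ∀ m e l → suc (suc (2 * m) + l) + 2 * e ≡ l + 2 * suc (m + e)
  arith = solve 3 (λ m e l → con 1 :+ (con 1 :+ con 2 :* m :+ l) :+ con 2 :* e := l :+ con 2 :* (con 1 :+ (m :+ e))) refl
  go↓ : w ⟨ b ⟩ < w ⟨ a ⟩ → (Σ (Exchange w a b (w ⟨ b ⟩) (w ⟨ a ⟩)) λ X → ℓ w ≡ suc (2 * Exchange.m X) + ℓ w′) → Goal
  go↓ wb<wa (X , e) = 2 * X.m , trans (trans (cong suc (+-comm (ℓ w′) (2 * X.m))) (sym e)) (weight-false not-up (ℓ w)) ,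
      λ z → down wb<wa not-up (X.none (m+n≡0⇒m≡0 X.m z))
    where
    module X = Exchange X
    not-up : (ℓ w <ᵇ ℓ w′) ≡ false
    not-up = <ᵇ-false (≤-trans (m≤n+m (ℓ w′) (suc (2 * X.m))) (≤-reflexive (sym e)))
  go↑ : w ⟨ a ⟩ < w ⟨ b ⟩ → (Σ (Exchange w a b (w ⟨ a ⟩) (w ⟨ b ⟩)) λ X → ℓ w′ ≡ suc (2 * Exchange.m X) + ℓ w) → Goal
  go↑ wa<wb (X , e) = 2 * X.e , trans eq (weight-true is-up (ℓ w)) , λ z → up wa<wb is-up (X.all (m+n≡0⇒m≡0 X.e z))
    where
    module X = Exchange X
    is-up : (ℓ w <ᵇ ℓ w′) ≡ true
    is-up = <ᵇ-true (≤-trans (s≤s (m≤n+m (ℓ w) (2 * X.m))) (≤-reflexive (sym e)))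
    eq : suc (ℓ w′) + 2 * X.e ≡ ℓ w + 2 * (b ∸ a)
    eq = begin
      suc (ℓ w′) + 2 * X.e                     ≡⟨ cong (λ t → suc t + 2 * X.e) e ⟩
      suc (suc (2 * X.m) + ℓ w) + 2 * X.e      ≡⟨ arith X.m X.e (ℓ w) ⟩
      ℓ w + 2 * suc (X.m + X.e)                ≡⟨ cong (λ t → ℓ w + 2 * t) X.m+e ⟩
      ℓ w + 2 * (b ∸ a)                        ∎
  go : Tri (w ⟨ b ⟩ < w ⟨ a ⟩) (w ⟨ b ⟩ ≡ w ⟨ a ⟩) (w ⟨ a ⟩ < w ⟨ b ⟩) → Goal
  go (tri≈ _ e _) = contradiction (Perm-injective w∈S 1≤a (≤-trans (<⇒≤ a<b) b≤n) (≤-trans 1≤a (<⇒≤ a<b)) b≤n (sym e)) (<⇒≢ a<b)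
  go (tri< wb<wa _ _) = go↓ wb<wa (ℓ-exchange w∈S 1≤a a<b b≤n wb<wa)
  go (tri> _ _ wa<wb) = go↑ wa<wb (ℓ-exchange-up w∈S 1≤a a<b b≤n wa<wb)

-- Lengths telescope along the path, so the step defects add up, and a vanishing sum of naturals
-- makes every step sharp.
path-defect : ∀ {n w} βs bs → Perm n w → All (IsRoot n) βs → length bs ≡ length βs →
  ∃ λ D → card bs + ℓ (applySel w βs bs) + D ≡ ℓ w + 2 * negSum height w βs bs × (D ≡ 0 → QPath w βs bs)
path-defect {w = w} [] [] _ _ _ = 0 , refl , λ _ → tt
path-defect {w = w} ((a , b) ∷ βs) (false ∷ bs) w∈S (_ ∷ rs) len = path-defect βs bs w∈S rs (suc-injective len)
path-defect {n} {w} ((a , b) ∷ βs) (true ∷ bs) w∈S (r@(1≤a , a<b , b≤n) ∷ rs) len =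
  combine (card bs) (ℓ u) (ℓ w) (ℓ w′) (if ℓ w <ᵇ ℓ w′ then b ∸ a else 0) (negSum height w′ βs bs)
    (step-defect w∈S r) (path-defect βs bs (Perm-swapPos w∈S 1≤a a<b b≤n) rs (suc-injective len))
  where
  open ≡-Reasoning
  open +-*-Solver
  w′ = swapPos w a b
  u = applySel w′ βs bs
  combine : ∀ c e l l′ t ν {P Q : Set} → (∃ λ D → suc l′ + D ≡ l + 2 * t × (D ≡ 0 → P)) →
    (∃ λ D → c + e + D ≡ l′ + 2 * ν × (D ≡ 0 → Q)) →
    ∃ λ D → suc c + e + D ≡ l + 2 * (t + ν) × (D ≡ 0 → P × Q)
  combine c e l l′ t ν (D , eq , P) (D′ , eq′ , Q) = D + D′ ,
    (begin
      suc c + e + (D + D′)          ≡⟨ solve 4 (λ c e d d′ → con 1 :+ c :+ e :+ (d :+ d′) := con 1 :+ d :+ (c :+ e :+ d′)) refl c e D D′ ⟩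
      suc D + (c + e + D′)          ≡⟨ cong (suc D +_) eq′ ⟩
      suc D + (l′ + 2 * ν)          ≡⟨ solve 3 (λ d l v → con 1 :+ d :+ (l :+ v) := con 1 :+ l :+ d :+ v) refl D l′ (2 * ν) ⟩
      suc l′ + D + 2 * ν            ≡⟨ cong (_+ 2 * ν) eq ⟩
      l + 2 * t + 2 * ν             ≡⟨ solve 3 (λ l t v → l :+ con 2 :* t :+ con 2 :* v := l :+ con 2 :* (t :+ v)) refl l t ν ⟩
      l + 2 * (t + ν)               ∎)
    , λ z → P (m+n≡0⇒m≡0 D z) , Q (m+n≡0⇒n≡0 D z)

-- Combining the membership equation with the balance of `path-defect` leaves 2 ℓ(end) + D = 0, so
-- both terms vanish.
QPath-end : ∀ {n w} βs bs → Perm n w → All (IsRoot n) βs → length bs ≡ length βs →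
  ℓ w + ℓ (applySel w βs bs) + 2 * negSum height w βs bs ≡ card bs → QPath w βs bs × ℓ (applySel w βs bs) ≡ 0
QPath-end {w = w} βs bs w∈S rs len eq =
  combine (card bs) (ℓ (applySel w βs bs)) (ℓ w) (negSum height w βs bs) eq (path-defect βs bs w∈S rs len)
  where
  open ≡-Reasoning
  open +-*-Solver
  combine : ∀ c e l ν {P : Set} → l + e + 2 * ν ≡ c → (∃ λ D → c + e + D ≡ l + 2 * ν × (D ≡ 0 → P)) → P × e ≡ 0
  combine c e l ν eq (D , eq′ , P) = P (m+n≡0⇒n≡0 (2 * e) total) , m+n≡0⇒m≡0 e (m+n≡0⇒m≡0 (2 * e) total)
    where
    total : 2 * e + D ≡ 0
    total = +-cancelˡ-≡ c _ _ (begin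
      c + (2 * e + D)     ≡⟨ solve 3 (λ c e d → c :+ (con 2 :* e :+ d) := e :+ (c :+ e :+ d)) refl c e D ⟩
      e + (c + e + D)     ≡⟨ cong (e +_) eq′ ⟩
      e + (l + 2 * ν)     ≡⟨ solve 3 (λ e l v → e :+ (l :+ v) := l :+ e :+ v) refl e l (2 * ν) ⟩
      l + e + 2 * ν       ≡⟨ eq ⟩
      c                   ≡⟨ +-identityʳ _ ⟨
      c + 0               ∎)

applySel-Perm : ∀ {n w} βs bs → Perm n w → All (IsRoot n) βs → Perm n (applySel w βs bs)
applySel-Perm [] bs w∈S _ = w∈S
applySel-Perm (_ ∷ βs) [] w∈S _ = w∈S
applySel-Perm (_ ∷ βs) (false ∷ bs) w∈S (_ ∷ rs) = applySel-Perm βs bs w∈S rs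
applySel-Perm (_ ∷ βs) (true ∷ bs) w∈S ((1≤a , a<b , b≤n) ∷ rs) = applySel-Perm βs bs (Perm-swapPos w∈S 1≤a a<b b≤n) rs

inv≡0⇒increasing : ∀ xs → inv xs ≡ 0 → Linked _≤_ xs
inv≡0⇒increasing [] _ = []
inv≡0⇒increasing (x ∷ []) _ = [-]
inv≡0⇒increasing (x ∷ ys@(y ∷ _)) e =
  ≮⇒≥ (λ y<x → case trans (sym (All.head none)) (<ᵇ-true y<x) of λ ())
  ∷ inv≡0⇒increasing ys (m+n≡0⇒n≡0 (count (_<ᵇ x) ys) e)
  where none = count-zero {p = _<ᵇ x} {ys} (m+n≡0⇒m≡0 (count (_<ᵇ x) ys) e)

[1…]-increasing : ∀ n → Linked _≤_ [1… n ]
[1…]-increasing n = subst (Linked _≤_) (sym (map-upTo suc n)) (Linkedₚ.applyUpTo⁺₂ suc n (λ i → n≤1+n (suc i)))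

ℓ≡0⇒identity : ∀ {n w} → Perm n w → ℓ w ≡ 0 → w ≡ [1… n ]
ℓ≡0⇒identity {n} {w} w∈S e = Pointwise-≡⇒≡ (↗↭↗⇒≋ ≤-totalOrder
  (inv≡0⇒increasing w (trans (sym (ℓ≡inv w)) e)) ([1…]-increasing n) (↭⇒↭ₛ w∈S))

QPath-++ : ∀ {w} xs {ys} bs {cs} → length bs ≡ length xs → QPath w (xs ++ ys) (bs ++ cs) →
  QPath w xs bs × QPath (applySel w xs bs) ys cs
QPath-++ [] [] _ P = tt , P
QPath-++ (_ ∷ xs) (false ∷ bs) len P = QPath-++ xs bs (suc-injective len) P
QPath-++ (_ ∷ xs) (true ∷ bs) len (s , P) = let (l , r) = QPath-++ xs bs (suc-injective len) P in (s , l) , r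

applySel-++ : ∀ w xs {ys} bs {cs} → length bs ≡ length xs →
  applySel w (xs ++ ys) (bs ++ cs) ≡ applySel (applySel w xs bs) ys cs
applySel-++ w [] [] _ = refl
applySel-++ w (_ ∷ xs) (false ∷ bs) len = applySel-++ w xs bs (suc-injective len)
applySel-++ w ((a , b) ∷ xs) (true ∷ bs) len = applySel-++ (swapPos w a b) xs bs (suc-injective len)

negSum-++ : ∀ g w xs {ys} bs {cs} → length bs ≡ length xs →
  negSum g w (xs ++ ys) (bs ++ cs) ≡ negSum g w xs bs + negSum g (applySel w xs bs) ys cs
negSum-++ g w [] [] _ = refl
negSum-++ g w (_ ∷ xs) (false ∷ bs) len = negSum-++ g w xs bs (suc-injective len)
negSum-++ g w ((a , b) ∷ xs) (true ∷ bs) len = trans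
  (cong ((if w <Bᵇ swapPos w a b then g (a , b) else 0) +_) (negSum-++ g (swapPos w a b) xs bs (suc-injective len)))
  (sym (+-assoc (if w <Bᵇ swapPos w a b then g (a , b) else 0) _ _))

sumNeg-++ : ∀ (h : ℕ → ℕ) p w xs {ys} bs {cs} → length bs ≡ length xs →
  sum (map h (negFrom p w (xs ++ ys) (bs ++ cs))) ≡
    sum (map h (negFrom p w xs bs)) + sum (map h (negFrom (p + length xs) (applySel w xs bs) ys cs))
sumNeg-++ h p w [] {ys} [] {cs} _ = cong (λ t → sum (map h (negFrom t w ys cs))) (sym (+-identityʳ p))
sumNeg-++ h p w (_ ∷ xs) {ys} (false ∷ bs) {cs} len = trans (sumNeg-++ h (suc p) w xs bs (suc-injective len))
  (cong (λ t → sum (map h (negFrom (suc p) w xs bs)) + sum (map h (negFrom t (applySel w xs bs) ys cs))) (sym (+-suc p (length xs))))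
sumNeg-++ h p w ((a , b) ∷ xs) {ys} (true ∷ bs) {cs} len
  with w <Bᵇ swapPos w a b | trans (sumNeg-++ h (suc p) (swapPos w a b) xs {ys} bs {cs} (suc-injective len))
         (cong (λ t → sum (map h (negFrom (suc p) (swapPos w a b) xs bs)) + sum (map h (negFrom t (applySel (swapPos w a b) xs bs) ys cs))) (sym (+-suc p (length xs))))
... | true | e = trans (cong (h (suc p) +_) e) (sym (+-assoc (h (suc p)) _ _))
... | false | e = e

-- The offset `p` is the number of roots before the segment, since `negFrom` reports positions in
-- all of Γ.
sumNeg≡negSum : ∀ (h : ℕ → ℕ) (g : Root → ℕ) p w βs bs →
  (∀ i → 1 ≤ i → i ≤ length βs → h (p + i) ≡ g (nth (0 , 0) βs i)) →
  sum (map h (negFrom p w βs bs)) ≡ negSum g w βs bs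
sumNeg≡negSum h g p w [] bs e = refl
sumNeg≡negSum h g p w (_ ∷ βs) [] e = refl
sumNeg≡negSum h g p w (β ∷ βs) (false ∷ bs) e = sumNeg≡negSum h g (suc p) w βs bs
  λ { (suc i) 1≤i i≤ → trans (cong h (sym (+-suc p (suc i)))) (e (suc (suc i)) (s≤s z≤n) (s≤s i≤)) }
sumNeg≡negSum h g p w ((a , b) ∷ βs) (true ∷ bs) e
  with w <Bᵇ swapPos w a b | sumNeg≡negSum h g (suc p) (swapPos w a b) βs bs
    (λ { (suc i) 1≤i i≤ → trans (cong h (sym (+-suc p (suc i)))) (e (suc (suc i)) (s≤s z≤n) (s≤s i≤)) })
... | true | r = cong₂ _+_ (trans (cong h (sym (+-comm p 1))) (e 1 ≤-refl (s≤s z≤n))) r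
... | false | r = r

-- Rows and blocks of Γ

-- The roots of Γ(k) with first index `a`, when m = n - k. The length stays free because processing
-- the row removes its first root (a , k + m).
row : ℕ → ℕ → ℕ → List Root
row k a m = map (λ b → (a , b)) (map (k +_) [ m …1])

-- While a row is processed, the value at position a moves down in the circular order.
-- x₀ is the value at a when the row was entered; positions a < c ≤ t are still unused
-- and avoid the circular interval traversed so far.
Unwrapped : ℕ → List ℕ → ℕ → ℕ → Set
Unwrapped x₀ v a t = v ⟨ a ⟩ ≤ x₀ × (∀ c → a < c → c ≤ t → v ⟨ c ⟩ < v ⟨ a ⟩ ⊎ x₀ < v ⟨ c ⟩)

-- The traversed interval has now passed 1: it consists of the values up to `x₀` and those from
-- `v ⟨ a ⟩` upwards, and the gap in between holds the later entries.
Wrapped : ℕ → List ℕ → ℕ → ℕ → Set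
Wrapped x₀ v a t = x₀ < v ⟨ a ⟩ × (∀ c → a < c → c ≤ t → x₀ < v ⟨ c ⟩ × v ⟨ c ⟩ < v ⟨ a ⟩)

if-false-+ : ∀ {t x y} → t ≡ false → (if t then x else 0) + y ≡ y
if-false-+ refl = refl

if-true-+ : ∀ {t x y} → t ≡ true → (if t then x else 0) + y ≡ x + y
if-true-+ refl = refl

module Row {n k a : ℕ} (1≤a : 1 ≤ a) (a≤k : a ≤ k) (g : ℕ → ℕ) where

  private
    G : Root → ℕ
    G (a , _) = g a

    root : ∀ {m} → k + suc m ≤ n → IsRoot n (a , k + suc m)
    root {m} b≤n = 1≤a , ≤-trans (s≤s a≤k) (≤-trans (≤-reflexive (+-comm 1 k)) (+-monoʳ-≤ k (s≤s z≤n))) , b≤n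

    smaller : ∀ {m} → k + suc m ≤ n → k + m ≤ n
    smaller = ≤-trans (+-monoʳ-≤ k (n≤1+n _))

    c<b : ∀ {m c} → c ≤ k + m → c < k + suc m
    c<b {m} c≤ = ≤-trans (s≤s c≤) (≤-reflexive (sym (+-suc k m)))

  row-roots : ∀ m → k + m ≤ n → All (IsRoot n) (row k a m)
  row-roots zero _ = []
  row-roots (suc m) b≤n = root b≤n ∷ row-roots m (smaller b≤n)

  module Swap {m v} (v∈S : Perm n v) (b≤n : k + suc m ≤ n) where
    b = k + suc m
    v′ = swapPos v a b
    a<b = proj₁ (proj₂ (root b≤n))
    1≤b = ≤-trans 1≤a (<⇒≤ a<b)
    b≤len : b ≤ length v
    b≤len = subst (b ≤_) (sym (Perm-length v∈S)) b≤n
    perm : Perm n v′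
    perm = Perm-swapPos v∈S 1≤a a<b b≤n
    at-a : v′ ⟨ a ⟩ ≡ v ⟨ b ⟩
    at-a = swapPos-left {v} 1≤a (≤-trans (<⇒≤ a<b) b≤len)
    at-c : ∀ {c} → 1 ≤ c → c ≢ a → c ≤ k + m → v′ ⟨ c ⟩ ≡ v ⟨ c ⟩
    at-c 1≤c c≢a c≤ = swapPos-other {v} c≢a (<⇒≢ (c<b c≤)) 1≤c (≤-trans (<⇒≤ (c<b c≤)) b≤len)
    at-later : ∀ {c} → a < c → c ≤ k + m → v′ ⟨ c ⟩ ≡ v ⟨ c ⟩
    at-later a<c = at-c (≤-trans 1≤a (<⇒≤ a<c)) (<⇒≢ a<c ∘ sym)
    distinct : ∀ {c} → a < c → c ≤ k + m → v ⟨ c ⟩ ≢ v ⟨ b ⟩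
    distinct a<c c≤ e = <⇒≢ (c<b c≤) (Perm-injective v∈S (≤-trans 1≤a (<⇒≤ a<c)) (≤-trans (<⇒≤ (c<b c≤)) b≤n) 1≤b b≤n e)

  -- Each root of the row exchanges position `a` with a position beyond `k`.
  row-frame : ∀ m v bs → Perm n v → k + m ≤ n → ∀ {i} → 1 ≤ i → i ≤ k → i ≢ a →
    applySel v (row k a m) bs ⟨ i ⟩ ≡ v ⟨ i ⟩
  row-frame zero v bs _ _ _ _ _ = refl
  row-frame (suc m) v [] _ _ _ _ _ = refl
  row-frame (suc m) v (false ∷ bs) v∈S b≤n = row-frame m v bs v∈S (smaller b≤n)
  row-frame (suc m) v (true ∷ bs) v∈S b≤n 1≤i i≤k i≢a =
    trans (row-frame m v′ bs perm (smaller b≤n) 1≤i i≤k i≢a) (at-c 1≤i i≢a (≤-trans i≤k (m≤m+n k m)))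
    where open Swap v∈S b≤n

  Unwrapped-weaken : ∀ v {x₀ s t} → s ≤ t → Unwrapped x₀ v a t → Unwrapped x₀ v a s
  Unwrapped-weaken v s≤t (l , f) = l , λ c a<c c≤s → f c a<c (≤-trans c≤s s≤t)

  Wrapped-weaken : ∀ v {x₀ s t} → s ≤ t → Wrapped x₀ v a t → Wrapped x₀ v a s
  Wrapped-weaken v s≤t (l , f) = l , λ c a<c c≤s → f c a<c (≤-trans c≤s s≤t)

  k+m≤ : ∀ m → k + m ≤ k + suc m
  k+m≤ m = +-monoʳ-≤ k (n≤1+n m)

  -- After a step down no later entry lies between the new and the old value at `a`, so entries
  -- below the old value are below the new one and the invariant persists.
  row-wrapped : ∀ {x₀} m v bs → Perm n v → k + m ≤ n → Wrapped x₀ v a (k + m) → QPath v (row k a m) bs →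
    negSum G v (row k a m) bs ≡ 0 × Wrapped x₀ (applySel v (row k a m) bs) a k
  row-wrapped zero v bs _ _ W _ = refl , Wrapped-weaken v (m≤m+n k 0) W
  row-wrapped (suc m) v [] _ _ W _ = refl , Wrapped-weaken v (m≤m+n k (suc m)) W
  row-wrapped (suc m) v (false ∷ bs) v∈S b≤n W P =
    row-wrapped m v bs v∈S (smaller b≤n) (Wrapped-weaken v (k+m≤ m) W) P
  -- A second passage of 1 would need a later entry above `v ⟨ a ⟩`, which the invariant excludes.
  row-wrapped (suc m) v (true ∷ bs) v∈S b≤n (_ , W) (up va<vb _ _ , _) =
    contradiction (proj₂ (W _ (proj₁ (proj₂ (root b≤n))) ≤-refl)) (<⇒≯ va<vb)
  row-wrapped {x₀} (suc m) v (true ∷ bs) v∈S b≤n (_ , W) (down vb<va not-up none , P) =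
    let (ν , W″) = row-wrapped m v′ bs perm (smaller b≤n) W′ P in trans (if-false-+ not-up) ν , W″
    where
    open Swap v∈S b≤n
    W′ : Wrapped x₀ v′ a (k + m)
    W′ = subst (x₀ <_) (sym at-a) (proj₁ (W b a<b ≤-refl)) , λ c a<c c≤ →
      let (l , u) = W c a<c (≤-trans c≤ (k+m≤ m)) in
      subst (x₀ <_) (sym (at-later a<c c≤)) l ,
      subst₂ _<_ (sym (at-later a<c c≤)) (sym at-a)
        (≤∧≢⇒< (≮⇒≥ (λ vb<vc → none c a<c (c<b c≤) vb<vc u)) (distinct a<c c≤))

  -- The first step up switches from one invariant to the other and contributes `g a`; from then on
  -- `row-wrapped` gives weight 0. Steps down preserve the unwrapped invariant.
  row-unwrapped : ∀ {x₀} m v bs → Perm n v → k + m ≤ n → Unwrapped x₀ v a (k + m) → QPath v (row k a m) bs →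
    (negSum G v (row k a m) bs ≡ 0 × Unwrapped x₀ (applySel v (row k a m) bs) a k) ⊎
    (negSum G v (row k a m) bs ≡ g a × Wrapped x₀ (applySel v (row k a m) bs) a k)
  row-unwrapped zero v bs _ _ U _ = inj₁ (refl , Unwrapped-weaken v (m≤m+n k 0) U)
  row-unwrapped (suc m) v [] _ _ U _ = inj₁ (refl , Unwrapped-weaken v (m≤m+n k (suc m)) U)
  row-unwrapped (suc m) v (false ∷ bs) v∈S b≤n U P =
    row-unwrapped m v bs v∈S (smaller b≤n) (Unwrapped-weaken v (k+m≤ m) U) P
  row-unwrapped {x₀} (suc m) v (true ∷ bs) v∈S b≤n (va≤x₀ , U) (up va<vb is-up all , P) =
    let (ν , W″) = row-wrapped m v′ bs perm (smaller b≤n) W′ P in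
    inj₂ (trans (if-true-+ is-up) (trans (cong (g a +_) ν) (+-identityʳ _)) , W″)
    where
    open Swap v∈S b≤n
    -- An upward edge puts all entries between the two positions above `v ⟨ a ⟩`; having avoided the
    -- traversed interval, they must even lie above `x₀`.
    above : ∀ {c} → a < c → c ≤ b → v ⟨ a ⟩ < v ⟨ c ⟩ → x₀ < v ⟨ c ⟩
    above {c} a<c c≤ va<vc with U c a<c c≤
    ... | inj₁ vc<va = contradiction va<vc (<⇒≯ vc<va)
    ... | inj₂ x₀<vc = x₀<vc
    W′ : Wrapped x₀ v′ a (k + m)
    W′ = subst (x₀ <_) (sym at-a) (above a<b ≤-refl va<vb) , λ c a<c c≤ →
      let (l , u) = all c a<c (c<b c≤) in
      subst (x₀ <_) (sym (at-later a<c c≤)) (above a<c (<⇒≤ (c<b c≤)) l) ,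
      subst₂ _<_ (sym (at-later a<c c≤)) (sym at-a) u
  row-unwrapped {x₀} (suc m) v (true ∷ bs) v∈S b≤n (va≤x₀ , U) (down vb<va not-up none , P) =
    helper (row-unwrapped m v′ bs perm (smaller b≤n) U′ P)
    where
    open Swap v∈S b≤n
    U′ : Unwrapped x₀ v′ a (k + m)
    U′ = ≤-trans (≤-reflexive at-a) (≤-trans (<⇒≤ vb<va) va≤x₀) , λ c a<c c≤ → avoid a<c c≤ (U c a<c (<⇒≤ (c<b c≤)))
      where
      avoid : ∀ {c} → a < c → c ≤ k + m → v ⟨ c ⟩ < v ⟨ a ⟩ ⊎ x₀ < v ⟨ c ⟩ → v′ ⟨ c ⟩ < v′ ⟨ a ⟩ ⊎ x₀ < v′ ⟨ c ⟩
      avoid a<c c≤ (inj₁ vc<va) = inj₁ (subst₂ _<_ (sym (at-later a<c c≤)) (sym at-a)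
        (≤∧≢⇒< (≮⇒≥ (λ vb<vc → none _ a<c (c<b c≤) vb<vc vc<va)) (distinct a<c c≤)))
      avoid a<c c≤ (inj₂ x₀<vc) = inj₂ (subst (x₀ <_) (sym (at-later a<c c≤)) x₀<vc)
    u = applySel v′ (row k a m) bs
    ν = negSum G v′ (row k a m) bs
    helper : (ν ≡ 0 × Unwrapped x₀ u a k) ⊎ (ν ≡ g a × Wrapped x₀ u a k) →
      ((if v <Bᵇ v′ then g a else 0) + ν ≡ 0 × Unwrapped x₀ u a k) ⊎
      ((if v <Bᵇ v′ then g a else 0) + ν ≡ g a × Wrapped x₀ u a k)
    helper (inj₁ (e , U″)) = inj₁ (trans (if-false-+ not-up) e , U″)
    helper (inj₂ (e , W″)) = inj₂ (trans (if-false-+ not-up) e , W″)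

-- x, x₀, z are C^{j-1}(a), C^j(a), C^j(c) with a < c: read circularly upwards from x, x₀ comes before z.
Circular : ℕ → ℕ → ℕ → Set
Circular x x₀ z = (x ≤ x₀ × (z < x ⊎ x₀ < z)) ⊎ (x₀ < x × x₀ < z × z < x)

-- For `r` equal to `k` this unfolds to `Γk n k`; smaller `r` serve the induction over rows.
rows : ℕ → ℕ → ℕ → List Root
rows n k r = concatMap (λ a → row k a (n ∸ k)) [1… r ]

rows-suc : ∀ n k r → rows n k (suc r) ≡ rows n k r ++ row k (suc r) (n ∸ k)
rows-suc n k r = begin
  concatMap f [1… suc r ]              ≡⟨ cong (concatMap f) ([1…]-∷ʳ r) ⟩
  concatMap f ([1… r ] ∷ʳ suc r)       ≡⟨ concatMap-++ f [1… r ] [ suc r ] ⟩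
  rows n k r ++ (f (suc r) ++ [])      ≡⟨ cong (rows n k r ++_) (++-identityʳ (f (suc r))) ⟩
  rows n k r ++ f (suc r)              ∎
  where
  open ≡-Reasoning
  f = λ a → row k a (n ∸ k)

rows-roots : ∀ {n k} → k ≤ n → ∀ r → r ≤ k → All (IsRoot n) (rows n k r)
rows-roots k≤n zero _ = []
rows-roots {n} {k} k≤n (suc r) r<k = subst (All (IsRoot n)) (sym (rows-suc n k r))
  (Allₚ.++⁺ (rows-roots k≤n r (<⇒≤ r<k)) (Row.row-roots (s≤s z≤n) r<k id (n ∸ k) (≤-reflexive (m+[n∸m]≡n k≤n))))

-- The state `u` after the first `r` rows of Γ(k) have been applied to `v`, with total weight `ν`.
-- For a whole block, `v` and `u` are π^j and π^{j-1}; `apart` is what the treatment of the first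
-- column rests on.
record BlockResult (n k : ℕ) (g : ℕ → ℕ) (v u : List ℕ) (ν r : ℕ) : Set where
  field
    perm : Perm n u
    frame : ∀ {i} → r < i → i ≤ k → u ⟨ i ⟩ ≡ v ⟨ i ⟩
    circular : ∀ {a c} → 1 ≤ a → a ≤ r → a < c → c ≤ k → Circular (u ⟨ a ⟩) (v ⟨ a ⟩) (v ⟨ c ⟩)
    apart : ∀ {a c} → 1 ≤ a → a ≤ r → a < c → c ≤ k → u ⟨ a ⟩ ≢ v ⟨ c ⟩
    weight : ν ≡ ∑ r (λ a → if v ⟨ a ⟩ <ᵇ u ⟨ a ⟩ then g a else 0)

-- Among the first `k` positions row a changes only position a. Hence the entries below the current
-- row are still those of `v`, and what was shown for earlier rows stays valid.
rows-result : ∀ {n k} (g : ℕ → ℕ) v → k ≤ n → Perm n v → ∀ r bs → r ≤ k → length bs ≡ length (rows n k r) →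
  QPath v (rows n k r) bs → BlockResult n k g v (applySel v (rows n k r) bs) (negSum (g ∘ proj₁) v (rows n k r) bs) r
rows-result g v k≤n v∈S zero bs _ _ _ = record
  { perm = v∈S ; frame = λ _ _ → refl
  ; circular = λ 1≤a a≤0 → contradiction (≤-trans 1≤a a≤0) λ ()
  ; apart = λ 1≤a a≤0 → contradiction (≤-trans 1≤a a≤0) λ ()
  ; weight = refl }
rows-result {n} {k} g v k≤n v∈S (suc r) bs r<k len P =
  subst₂ (λ u ν → BlockResult n k g v u ν (suc r)) (sym u≡) (sym ν≡)
    (extend (row-unwrapped (n ∸ k) u₀ cs (IH.perm) k+≤n start (proj₂ P′)))
  where
  open ≡-Reasoning
  open Row {n} {k} {suc r} (s≤s z≤n) r<k g
  R = rows n k r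
  S = row k (suc r) (n ∸ k)
  L = length R
  as = take L bs
  cs = drop L bs
  u₀ = applySel v R as
  u = applySel u₀ S cs
  k+≤n : k + (n ∸ k) ≤ n
  k+≤n = ≤-reflexive (m+[n∸m]≡n k≤n)
  bs≡ : bs ≡ as ++ cs
  bs≡ = sym (take++drop≡id L bs)
  len-as : length as ≡ L
  len-as = trans (length-take L bs) (m≤n⇒m⊓n≡m
    (subst (L ≤_) (trans (sym (length-++ R)) (trans (cong length (sym (rows-suc n k r))) (sym len))) (m≤m+n L (length S))))
  P′ = QPath-++ R as len-as (subst₂ (QPath v) (rows-suc n k r) bs≡ P)
  module IH = BlockResult (rows-result g v k≤n v∈S r as (<⇒≤ r<k) len-as (proj₁ P′))
  u≡ : applySel v (rows n k (suc r)) bs ≡ u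
  u≡ = trans (cong₂ (applySel v) (rows-suc n k r) bs≡) (applySel-++ v R as len-as)
  ν≡ : negSum (g ∘ proj₁) v (rows n k (suc r)) bs ≡ negSum (g ∘ proj₁) v R as + negSum (g ∘ proj₁) u₀ S cs
  ν≡ = trans (cong₂ (negSum (g ∘ proj₁) v) (rows-suc n k r) bs≡) (negSum-++ (g ∘ proj₁) v R as len-as)
  x₀ = v ⟨ suc r ⟩
  x₀≡ : u₀ ⟨ suc r ⟩ ≡ x₀
  x₀≡ = IH.frame ≤-refl r<k
  -- On entering the row the traversed interval is the single value `x₀`, which no other position
  -- holds.
  start : Unwrapped x₀ u₀ (suc r) (k + (n ∸ k))
  start = ≤-reflexive x₀≡ , λ c r<c c≤ → avoid (<-cmp (u₀ ⟨ c ⟩) (u₀ ⟨ suc r ⟩)) r<c (≤-trans c≤ k+≤n)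
    where
    avoid : ∀ {c} → Tri (u₀ ⟨ c ⟩ < u₀ ⟨ suc r ⟩) (u₀ ⟨ c ⟩ ≡ u₀ ⟨ suc r ⟩) (u₀ ⟨ suc r ⟩ < u₀ ⟨ c ⟩) →
      suc r < c → c ≤ n → u₀ ⟨ c ⟩ < u₀ ⟨ suc r ⟩ ⊎ x₀ < u₀ ⟨ c ⟩
    avoid (tri< l _ _) _ _ = inj₁ l
    avoid {c} (tri> _ _ l) _ _ = inj₂ (subst (_< u₀ ⟨ c ⟩) x₀≡ l)
    avoid (tri≈ _ e _) r<c c≤n = contradiction
      (Perm-injective IH.perm (≤-trans (s≤s z≤n) r<c) c≤n (s≤s z≤n) (≤-trans r<k k≤n) e) (<⇒≢ r<c ∘ sym)
  u∈S : Perm n u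
  u∈S = applySel-Perm S cs IH.perm (row-roots (n ∸ k) k+≤n)
  same : ∀ {i} → 1 ≤ i → i ≤ k → i ≢ suc r → u ⟨ i ⟩ ≡ u₀ ⟨ i ⟩
  same = row-frame (n ∸ k) u₀ cs IH.perm k+≤n
  frame : ∀ {i} → suc r < i → i ≤ k → u ⟨ i ⟩ ≡ v ⟨ i ⟩
  frame r<i i≤k = trans (same (≤-trans (s≤s z≤n) r<i) i≤k (<⇒≢ r<i ∘ sym)) (IH.frame (<⇒≤ r<i) i≤k)
  old : ∀ {a} → 1 ≤ a → a ≤ r → u ⟨ a ⟩ ≡ u₀ ⟨ a ⟩
  old 1≤a a≤r = same 1≤a (≤-trans a≤r (<⇒≤ r<k)) (<⇒≢ (s≤s a≤r))
  module _ (new : ∀ {c} → suc r < c → c ≤ k → Circular (u ⟨ suc r ⟩) x₀ (v ⟨ c ⟩))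
           (ν : negSum (g ∘ proj₁) u₀ S cs ≡ (if x₀ <ᵇ u ⟨ suc r ⟩ then g (suc r) else 0)) where
    circular : ∀ {a c} → 1 ≤ a → a ≤ suc r → a < c → c ≤ k → Circular (u ⟨ a ⟩) (v ⟨ a ⟩) (v ⟨ c ⟩)
    circular {a} 1≤a a≤ a<c c≤k with a ≟ suc r
    ... | yes refl = new a<c c≤k
    ... | no a≢ = subst (λ t → Circular t _ _) (sym (old 1≤a a≤r)) (IH.circular 1≤a a≤r a<c c≤k)
      where a≤r = ≤-pred (≤∧≢⇒< a≤ a≢)
    apart : ∀ {a c} → 1 ≤ a → a ≤ suc r → a < c → c ≤ k → u ⟨ a ⟩ ≢ v ⟨ c ⟩
    apart {a} {c} 1≤a a≤ a<c c≤k e with a ≟ suc r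
    ... | yes refl = <⇒≢ a<c (Perm-injective u∈S 1≤a (≤-trans r<k k≤n) (≤-trans 1≤a (<⇒≤ a<c)) (≤-trans c≤k k≤n)
                       (trans e (sym (frame a<c c≤k))))
    ... | no a≢ = IH.apart 1≤a a≤r a<c c≤k (trans (sym (old 1≤a a≤r)) e)
      where a≤r = ≤-pred (≤∧≢⇒< a≤ a≢)
    weight : negSum (g ∘ proj₁) v R as + negSum (g ∘ proj₁) u₀ S cs ≡ ∑ (suc r) (λ a → if v ⟨ a ⟩ <ᵇ u ⟨ a ⟩ then g a else 0)
    weight = trans (cong₂ _+_ (trans IH.weight (∑-cong r λ a 1≤a a≤r → cong (λ t → if v ⟨ a ⟩ <ᵇ t then g a else 0) (sym (old 1≤a a≤r)))) ν)
      (sym (∑-suc r _))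
    result : BlockResult n k g v u (negSum (g ∘ proj₁) v R as + negSum (g ∘ proj₁) u₀ S cs) (suc r)
    result = record { perm = u∈S ; frame = frame ; circular = circular ; apart = apart ; weight = weight }
  extend : (negSum (g ∘ proj₁) u₀ S cs ≡ 0 × Unwrapped x₀ u (suc r) k) ⊎ (negSum (g ∘ proj₁) u₀ S cs ≡ g (suc r) × Wrapped x₀ u (suc r) k) →
    BlockResult n k g v u (negSum (g ∘ proj₁) v R as + negSum (g ∘ proj₁) u₀ S cs) (suc r)
  -- The two outcomes of the row are the two alternatives of `Circular`, and the comparison of the
  -- new value with `x₀` tells them apart; this turns the weight into the test in `weight`.
  extend (inj₁ (ν , x≤x₀ , U)) = result
    (λ {c} r<c c≤k → inj₁ (x≤x₀ , subst (λ t → t < _ ⊎ x₀ < t) (frame r<c c≤k) (U c r<c c≤k)))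
    (trans ν (cong (λ t → if t then g (suc r) else 0) (sym (<ᵇ-false x≤x₀))))
  extend (inj₂ (ν , x₀<x , W)) = result
    (λ {c} r<c c≤k → inj₂ (x₀<x , subst (λ t → x₀ < t × t < _) (frame r<c c≤k) (W c r<c c≤k)))
    (trans ν (cong (λ t → if t then g (suc r) else 0) (sym (<ᵇ-true x₀<x))))

-- Conjugate partitions

AllPairs-≥ : ∀ {μ} → IsPartition μ → AllPairs _≥_ μ
AllPairs-≥ = Linkedₚ.Linked⇒AllPairs (λ x≥y y≥z → ≤-trans y≥z x≥y)

private
  conj-small : ∀ {x j μ} → All (x ≥_) μ → x < j → conj μ j ≡ 0
  conj-small all x<j = count-none (All.map (λ y≤x → ≤ᵇ-false (≤-trans (s≤s y≤x) x<j)) all)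

  part-small : ∀ {x μ} → All (x ≥_) μ → ∀ r → part μ r ≤ x
  part-small [] r = z≤n
  part-small (p ∷ ps) zero = z≤n
  part-small (p ∷ ps) (suc zero) = p
  part-small (p ∷ ps) (suc (suc r)) = part-small ps (suc r)

  head-≥ : ∀ {x μ} → All (x ≥_) μ → ∀ r → part (x ∷ μ) r ≤ x
  head-≥ ps = part-small (≤-refl ∷ ps)

-- Both sides say that the diagram has a cell in row `r` and column `j`. The head has to dominate
-- the whole tail: a column beyond the head then meets no row at all.
conj⇒part : ∀ {μ} → AllPairs _≥_ μ → ∀ {r j} → 1 ≤ r → r ≤ conj μ j → j ≤ part μ r
conj⇒part [] 1≤r r≤0 = contradiction (≤-trans 1≤r r≤0) λ ()
conj⇒part {x ∷ μ} (ps ∷ pps) {suc r} {j} _ r≤ with j ≤? x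
conj⇒part {x ∷ μ} (ps ∷ pps) {suc zero} {j} _ r≤ | yes j≤x = j≤x
conj⇒part {x ∷ μ} (ps ∷ pps) {suc (suc r)} {j} _ r≤ | yes j≤x rewrite ≤ᵇ-true j≤x = conj⇒part pps (s≤s z≤n) (≤-pred r≤)
... | no j≰x rewrite ≤ᵇ-false (≰⇒> j≰x) | conj-small ps (≰⇒> j≰x) = contradiction r≤ λ ()

part⇒conj : ∀ {μ} → AllPairs _≥_ μ → ∀ {r j} → 1 ≤ r → 1 ≤ j → j ≤ part μ r → r ≤ conj μ j
part⇒conj [] _ 1≤j j≤0 = contradiction (≤-trans 1≤j j≤0) λ ()
part⇒conj {x ∷ μ} (ps ∷ pps) {suc r} {j} 1≤r 1≤j j≤ with j ≤? x
part⇒conj {x ∷ μ} (ps ∷ pps) {suc zero} {j} 1≤r 1≤j j≤ | yes j≤x rewrite ≤ᵇ-true j≤x = s≤s z≤n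
part⇒conj {x ∷ μ} (ps ∷ pps) {suc (suc r)} {j} 1≤r 1≤j j≤ | yes j≤x rewrite ≤ᵇ-true j≤x = s≤s (part⇒conj pps (s≤s z≤n) 1≤j j≤)
... | no j≰x = contradiction (≤-trans j≤ (head-≥ ps (suc r))) j≰x

module Conjugate {μ : List ℕ} (μ-part : AllPairs _≥_ μ) where

  part-≤-first : ∀ {r} → 1 ≤ r → part μ r ≤ part μ 1
  part-≤-first {r} 1≤r with part μ r in e
  ... | zero = z≤n
  -- The last cell of row `r` lies in a column with at least `r` cells, which therefore has a cell
  -- in row 1.
  ... | suc m = conj⇒part μ-part ≤-refl (≤-trans 1≤r (part⇒conj μ-part 1≤r (s≤s z≤n) (≤-reflexive (sym e))))

  conj-antitone : ∀ {i j} → 1 ≤ i → i ≤ j → conj μ j ≤ conj μ i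
  conj-antitone {i} {j} 1≤i i≤j with conj μ j in e
  ... | zero = z≤n
  ... | suc m = part⇒conj μ-part (s≤s z≤n) 1≤i (≤-trans i≤j (conj⇒part μ-part (s≤s z≤n) (≤-reflexive (sym e))))

  conj<n : ∀ {n} → 1 ≤ n → part μ n ≡ 0 → ∀ {j} → 1 ≤ j → conj μ j < n
  conj<n 1≤n μn≡0 1≤j = ≰⇒> λ n≤ → case ≤-trans 1≤j (≤-trans (conj⇒part μ-part 1≤n n≤) (≤-reflexive μn≡0)) of λ ()

  ≤ᵇ-conj : ∀ {r j} → 1 ≤ r → 1 ≤ j → (r ≤ᵇ conj μ j) ≡ (j ≤ᵇ part μ r)
  ≤ᵇ-conj {r} {j} 1≤r 1≤j with j ≤? part μ r
  ... | yes j≤ = trans (≤ᵇ-true (part⇒conj μ-part 1≤r 1≤j j≤)) (sym (≤ᵇ-true j≤))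
  ... | no j≰ = trans (≤ᵇ-false (≰⇒> (j≰ ∘ conj⇒part μ-part 1≤r))) (sym (≤ᵇ-false (≰⇒> j≰)))

-- Multiplicities of roots in Γ

concatMap≡cartesianProduct : (xs : List A) (ys : List B) →
  concatMap (λ x → map (λ y → (x , y)) ys) xs ≡ cartesianProduct xs ys
concatMap≡cartesianProduct [] ys = refl
concatMap≡cartesianProduct (x ∷ xs) ys = cong (map (x ,_) ys ++_) (concatMap≡cartesianProduct xs ys)

Γk-Unique : ∀ n k → Unique (Γk n k)
Γk-Unique n k = subst Unique (sym (concatMap≡cartesianProduct [1… k ] _))
  (Uniqueₚ.cartesianProduct⁺ (Unique-[1…] k)
    (Uniqueₚ.map⁺ (+-cancelˡ-≡ k _ _) (Uniqueₚ.map⁺ suc-injective (Uniqueₚ.downFrom⁺ (n ∸ k)))))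

∈-Γk⁺ : ∀ {n k a b} → 1 ≤ a → a ≤ k → k < b → b ≤ n → (a , b) ∈ Γk n k
∈-Γk⁺ {n} {k} {a} {b} 1≤a a≤k k<b b≤n = subst ((a , b) ∈_) (sym (concatMap≡cartesianProduct [1… k ] _))
  (∈-cartesianProduct⁺ (∈-[1…]⁺ 1≤a a≤k)
    (subst (_∈ map (k +_) [ n ∸ k …1]) (m+[n∸m]≡n (<⇒≤ k<b)) (∈-map⁺ (k +_) (∈-[…1]⁺ (m<n⇒0<n∸m k<b) (∸-monoˡ-≤ k b≤n)))))

∈-Γk⁻ : ∀ {n k a b} → (a , b) ∈ Γk n k → 1 ≤ a × a ≤ k × k < b
∈-Γk⁻ {n} {k} {a} {b} ∈Γ with ∈-cartesianProduct⁻ [1… k ] _ (subst ((a , b) ∈_) (concatMap≡cartesianProduct [1… k ] _) ∈Γ)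
... | a∈ , b∈ with ∈-map⁻ (k +_) b∈
... | y , y∈ , refl = proj₁ (∈-[1…]⁻ a∈) , proj₂ (∈-[1…]⁻ a∈) ,
  ≤-trans (≤-reflexive (+-comm 1 k)) (+-monoʳ-≤ k (proj₁ (∈-[…1]⁻ y∈)))

==R-refl : ∀ β → (β ==R β) ≡ true
==R-refl (a , b) = cong₂ _∧_ (≡ᵇ-refl a) (≡ᵇ-refl b)

==R-false : ∀ {β γ} → β ≢ γ → (β ==R γ) ≡ false
==R-false {β@(a , b)} {γ@(c , d)} β≢γ with β ==R γ in e
... | false = refl
... | true = contradiction (cong₂ _,_ (≡ᵇ⇒≡ a c (≡true⇒T (proj₁ (∧-true e)))) (≡ᵇ⇒≡ b d (≡true⇒T (proj₂ (∧-true {a ≡ᵇ c} e))))) β≢γ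

count-∉ : ∀ {β xs} → β ∉ xs → count (_==R β) xs ≡ 0
count-∉ {β} {xs} β∉ = count-none (All.tabulate λ {γ} γ∈ → ==R-false λ e → β∉ (subst (_∈ xs) e γ∈))

count-∈-Unique : ∀ {β xs} → Unique xs → β ∈ xs → count (_==R β) xs ≡ 1
count-∈-Unique {β} {.β ∷ xs} u@(_ ∷ _) (here refl) = trans (count-∷ (_==R β) β xs)
  (cong₂ _+_ (cong 𝟙 (==R-refl β)) (count-∉ {xs = xs} (Uniqueₚ.Unique[x∷xs]⇒x∉xs u)))
count-∈-Unique {β} {x ∷ xs} (x∉ ∷ u) (there β∈) = trans (count-∷ (_==R β) x xs)
  (cong₂ _+_ (cong 𝟙 (==R-false (All.lookup x∉ β∈))) (count-∈-Unique u β∈))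

count-Γk : ∀ {n a b} k → 1 ≤ a → k < b → b ≤ n → count (_==R (a , b)) (Γk n k) ≡ 𝟙 (a ≤ᵇ k)
count-Γk {n} {a} {b} k 1≤a k<b b≤n with a ≤? k
... | yes a≤k = trans (count-∈-Unique (Γk-Unique n k) (∈-Γk⁺ 1≤a a≤k k<b b≤n)) (cong 𝟙 (sym (≤ᵇ-true a≤k)))
... | no a≰k = trans (count-∉ {xs = Γk n k} (a≰k ∘ proj₁ ∘ proj₂ ∘ ∈-Γk⁻ {n})) (cong 𝟙 (sym (≤ᵇ-false (≰⇒> a≰k))))

-- Γ(k) contains (a , b) once if a ≤ k < b ≤ n and not otherwise; with k < b assured, only the
-- comparison of `a` with the column height remains.
count-blocks : ∀ n μ {a b} js → 1 ≤ a → b ≤ n → All (λ j → conj μ j < b) js →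
  count (_==R (a , b)) (blocks n μ js) ≡ count (λ j → a ≤ᵇ conj μ j) js
count-blocks n μ [] _ _ _ = refl
count-blocks n μ {a} {b} (j ∷ js) 1≤a b≤n (k<b ∷ all) = begin
  count (_==R (a , b)) (Γk n (conj μ j) ++ blocks n μ js)                              ≡⟨ count-++ (_==R (a , b)) (Γk n (conj μ j)) _ ⟩
  count (_==R (a , b)) (Γk n (conj μ j)) + count (_==R (a , b)) (blocks n μ js)
    ≡⟨ cong₂ _+_ (count-Γk {n} (conj μ j) 1≤a k<b b≤n) (count-blocks n μ js 1≤a b≤n all) ⟩
  𝟙 (a ≤ᵇ conj μ j) + count (λ j → a ≤ᵇ conj μ j) js                                  ≡⟨ count-∷ (λ j → a ≤ᵇ conj μ j) j js ⟨
  count (λ j → a ≤ᵇ conj μ j) (j ∷ js)                                                ∎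
  where open ≡-Reasoning

count-filter : (p q : A → Bool) (xs : List A) → count p (filterᵇ q xs) ≡ count (λ x → q x ∧ p x) xs
count-filter p q [] = refl
count-filter p q (x ∷ xs) with q x
... | false = count-filter p q xs
... | true with p x
...   | true = cong suc (count-filter p q xs)
...   | false = count-filter p q xs

filter-<-none : ∀ M j → M ≤ j → filterᵇ (j <ᵇ_) [ M …1] ≡ []
filter-<-none zero j _ = refl
filter-<-none (suc M) j M<j rewrite <ᵇ-false M<j = filter-<-none M j (<⇒≤ M<j)

filter-<-suc : ∀ M i → i < M → filterᵇ (i <ᵇ_) [ M …1] ≡ filterᵇ (suc i <ᵇ_) [ M …1] ∷ʳ suc i
filter-<-suc (suc M) i (s≤s i≤M) with i ≟ M
... | yes refl rewrite <ᵇ-true (n<1+n i) | filter-<-none i i ≤-refl | filter-<-none (suc i) (suc i) ≤-refl = refl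
... | no i≢M rewrite <ᵇ-true (s≤s i≤M) | <ᵇ-true (s≤s (≤∧≢⇒< i≤M i≢M)) = cong (suc M ∷_) (filter-<-suc M i (≤∧≢⇒< i≤M i≢M))

filter-0< : ∀ M → filterᵇ (0 <ᵇ_) [ M …1] ≡ [ M …1]
filter-0< zero = refl
filter-0< (suc M) = cong (suc M ∷_) (filter-0< M)

take-+ : ∀ m k (xs : List A) → take (m + k) xs ≡ take m xs ++ take k (drop m xs)
take-+ zero k xs = refl
take-+ (suc m) k [] = sym (take-[] k)
take-+ (suc m) k (x ∷ xs) = cong (x ∷_) (take-+ m k xs)

take-++ : (xs ys : List A) → ∀ t → take (length xs + t) (xs ++ ys) ≡ xs ++ take t ys
take-++ [] ys t = refl
take-++ (x ∷ xs) ys t = cong (x ∷_) (take-++ xs ys t)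

take-++ˡ : (xs ys : List A) → ∀ {t} → t ≤ length xs → take t (xs ++ ys) ≡ take t xs
take-++ˡ xs ys {zero} _ = refl
take-++ˡ (x ∷ xs) ys {suc t} (s≤s t≤) = cong (x ∷_) (take-++ˡ xs ys t≤)

length-take-≤ : ∀ {m} {xs : List A} → m ≤ length xs → length (take m xs) ≡ m
length-take-≤ {m = m} {xs} m≤ = trans (length-take m xs) (m≤n⇒m⊓n≡m m≤)

blocks-++ : ∀ n μ is js → blocks n μ (is ++ js) ≡ blocks n μ is ++ blocks n μ js
blocks-++ n μ = concatMap-++ (λ j → Γk n (conj μ j))

-- On values at least `x`, the circular order starting at `x` is the usual order.
Circular-increasing : ∀ {x x₀ z} → x ≤ x₀ → x ≤ z → Circular x x₀ z → x₀ < z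
Circular-increasing _ _ (inj₁ (_ , inj₂ x₀<z)) = x₀<z
Circular-increasing _ x≤z (inj₁ (_ , inj₁ z<x)) = contradiction x≤z (<⇒≱ z<x)
Circular-increasing x≤x₀ _ (inj₂ (x₀<x , _)) = contradiction x≤x₀ (<⇒≱ x₀<x)

if-false : ∀ {t : Bool} {x : ℕ} → t ≡ false → (if t then x else 0) ≡ 0
if-false refl = refl

∧-falseˡ : ∀ {s t} → s ≡ false → s ∧ t ≡ false
∧-falseˡ refl = refl

if-zero : ∀ t {x} → x ≡ 0 → (if t then x else 0) ≡ 0
if-zero true e = e
if-zero false _ = refl

-- The chain π^{μ₁} , … , π¹ , π⁰ and the level statistic

module Chain (n : ℕ) (μ w : List ℕ) (J : List Bool) (1≤n : 1 ≤ n) (μ-part : AllPairs _≥_ μ) (μn≡0 : part μ n ≡ 0)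
  (w∈S : Perm n w) (lenJ : length J ≡ length (Γ n μ)) (w,J∈F̄ : InFbar n μ w J) where

  open Conjugate μ-part
  open ≡-Reasoning

  M : ℕ
  M = part μ 1

  π : ℕ → List ℕ
  π = πj n μ w J

  k≤n : ∀ {j} → 1 ≤ j → conj μ j ≤ n
  k≤n 1≤j = <⇒≤ (conj<n 1≤n μn≡0 1≤j)

  -- Cutting Γ and the folding set at the block boundaries

  private
    block : ℕ → List Root
    block j = Γk n (conj μ j)

    Pre : ℕ → List Root
    Pre = Γpre n μ

    Post : ℕ → List Root
    Post j = blocks n μ [ j …1]

    L : ℕ → ℕ
    L j = length (Pre j)

    suf : ℕ → List Bool
    suf j = drop (L j) J

    mask : ℕ → List Bool
    mask j = take (length (block j)) (suf j)

    blocks-roots : ∀ js → All (1 ≤_) js → All (IsRoot n) (blocks n μ js)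
    blocks-roots [] _ = []
    blocks-roots (j ∷ js) (1≤j ∷ 1≤js) = Allₚ.++⁺ (rows-roots (k≤n 1≤j) (conj μ j) ≤-refl) (blocks-roots js 1≤js)

    Γ-roots : All (IsRoot n) (Γ n μ)
    Γ-roots = blocks-roots [ M …1] (All-[…1] M λ _ 1≤i _ → 1≤i)

    Pre-suc : ∀ {i} → i < M → Pre i ≡ Pre (suc i) ++ block (suc i)
    Pre-suc {i} i<M = begin
      blocks n μ (filterᵇ (i <ᵇ_) [ M …1])                        ≡⟨ cong (blocks n μ) (filter-<-suc M i i<M) ⟩
      blocks n μ (filterᵇ (suc i <ᵇ_) [ M …1] ∷ʳ suc i)           ≡⟨ blocks-++ n μ (filterᵇ (suc i <ᵇ_) [ M …1]) [ suc i ] ⟩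
      Pre (suc i) ++ (block (suc i) ++ [])                        ≡⟨ cong (Pre (suc i) ++_) (++-identityʳ (block (suc i))) ⟩
      Pre (suc i) ++ block (suc i)                                ∎

    Γ-split : ∀ {j} → j ≤ M → Γ n μ ≡ Pre j ++ Post j
    Γ-split {zero} _ = sym (trans (++-identityʳ (Pre 0)) (cong (blocks n μ) (filter-0< M)))
    Γ-split {suc i} i<M = begin
      Γ n μ                                     ≡⟨ Γ-split (<⇒≤ i<M) ⟩
      Pre i ++ Post i                           ≡⟨ cong (_++ Post i) (Pre-suc i<M) ⟩
      (Pre (suc i) ++ block (suc i)) ++ Post i  ≡⟨ ++-assoc (Pre (suc i)) (block (suc i)) (Post i) ⟩
      Pre (suc i) ++ Post (suc i)               ∎

    L-suc : ∀ {i} → i < M → L i ≡ L (suc i) + length (block (suc i))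
    L-suc {i} i<M = trans (cong length (Pre-suc i<M)) (length-++ (Pre (suc i)))

    L≤ : ∀ {j} → j ≤ M → L j ≤ length J
    L≤ {j} j≤M = subst (L j ≤_) (sym (trans lenJ (trans (cong length (Γ-split j≤M)) (length-++ (Pre j))))) (m≤m+n (L j) _)

    length-pre : ∀ {j} → j ≤ M → length (take (L j) J) ≡ length (Pre j)
    length-pre j≤M = length-take-≤ (L≤ j≤M)

    length-suf : ∀ {j} → j ≤ M → length (suf j) ≡ length (Post j)
    length-suf {j} j≤M = begin
      length (drop (L j) J)               ≡⟨ length-drop (L j) J ⟩
      length J ∸ L j                      ≡⟨ cong (_∸ L j) (trans lenJ (trans (cong length (Γ-split j≤M)) (length-++ (Pre j)))) ⟩
      L j + length (Post j) ∸ L j         ≡⟨ m+n∸m≡n (L j) _ ⟩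
      length (Post j)                     ∎

    length-mask : ∀ {i} → i < M → length (mask (suc i)) ≡ length (block (suc i))
    length-mask {i} i<M = length-take-≤ (subst (length (block (suc i)) ≤_)
      (sym (trans (length-suf i<M) (length-++ (block (suc i))))) (m≤m+n _ _))

    suf-suc : ∀ {i} → i < M → suf (suc i) ≡ mask (suc i) ++ suf i
    suf-suc {i} i<M = begin
      suf (suc i)                                                      ≡⟨ take++drop≡id (length (block (suc i))) (suf (suc i)) ⟨
      mask (suc i) ++ drop (length (block (suc i))) (suf (suc i))      ≡⟨ cong (mask (suc i) ++_) (drop-drop (L (suc i)) _ J) ⟩
      mask (suc i) ++ drop (L (suc i) + length (block (suc i))) J      ≡⟨ cong (λ t → mask (suc i) ++ drop t J) (L-suc i<M) ⟨
      mask (suc i) ++ suf i                                            ∎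

    ρ≡ : ρsum n μ w J ≡ negSum height w (Γ n μ) J
    ρ≡ = sumNeg≡negSum _ height 0 w (Γ n μ) J (λ _ _ _ → refl)

    Γ-path : QPath w (Γ n μ) J × ℓ (applySel w (Γ n μ) J) ≡ 0
    Γ-path = QPath-end (Γ n μ) J w∈S Γ-roots lenJ
      (trans (cong (λ t → ℓ w + ℓ (applySel w (Γ n μ) J) + 2 * t) (sym ρ≡)) w,J∈F̄)

    path : ∀ {j} → j ≤ M → QPath (π j) (Post j) (suf j)
    path {j} j≤M = proj₂ (QPath-++ (Pre j) (take (L j) J) (length-pre j≤M)
      (subst₂ (QPath w) (Γ-split j≤M) (sym (take++drop≡id (L j) J)) (proj₁ Γ-path)))

    block-path : ∀ {i} → i < M → QPath (π (suc i)) (block (suc i)) (mask (suc i))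
    block-path {i} i<M = proj₁ (QPath-++ (block (suc i)) (mask (suc i)) (length-mask i<M)
      (subst (QPath (π (suc i)) (Post (suc i))) (suf-suc i<M) (path i<M)))

    π-suc : ∀ {i} → i < M → π i ≡ applySel (π (suc i)) (block (suc i)) (mask (suc i))
    π-suc {i} i<M = begin
      applySel w (Pre i) (take (L i) J)
        ≡⟨ cong₂ (applySel w) (Pre-suc i<M) (trans (cong (λ t → take t J) (L-suc i<M)) (take-+ (L (suc i)) _ J)) ⟩
      applySel w (Pre (suc i) ++ block (suc i)) (take (L (suc i)) J ++ mask (suc i))
        ≡⟨ applySel-++ w (Pre (suc i)) (take (L (suc i)) J) (length-pre i<M) ⟩
      applySel (π (suc i)) (block (suc i)) (mask (suc i)) ∎

  π∈S : ∀ {j} → Perm n (π j)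
  π∈S {j} = applySel-Perm (Pre j) (take (L j) J) w∈S
    (blocks-roots (filterᵇ (j <ᵇ_) [ M …1]) (Allₚ.filter⁺ _ (All-[…1] M λ _ 1≤i _ → 1≤i)))

  π⁰≡id : π 0 ≡ [1… n ]
  π⁰≡id = ℓ≡0⇒identity π∈S (trans (cong ℓ eq) (proj₂ Γ-path))
    where
    Pre0 : Pre 0 ≡ Γ n μ
    Pre0 = cong (blocks n μ) (filter-0< M)
    eq : π 0 ≡ applySel w (Γ n μ) J
    eq = cong₂ (applySel w) Pre0 (take-all _ J (≤-reflexive (trans lenJ (cong length (sym Pre0)))))

  private
    -- Γ^{i+1} is preceded by one copy of (a , b) for each column j > i + 1 with at least a rows.
    alevel-block : ∀ {i} → i < M → ∀ t → 1 ≤ t → t ≤ length (block (suc i)) →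
      alevel (Γ n μ) (L (suc i) + t) ≡ part μ (proj₁ (nth (0 , 0) (block (suc i)) t)) ∸ i
    alevel-block {i} i<M t 1≤t t≤ = begin
      count (_==R nth (0 , 0) (Γ n μ) (L (suc i) + t)) (take (L (suc i) + t) (Γ n μ))
        ≡⟨ cong (λ γ → count (_==R γ) (take (L (suc i) + t) (Γ n μ))) root≡ ⟩
      count (_==R β) (take (L (suc i) + t) (Γ n μ))
        ≡⟨ cong (count (_==R β)) initial ⟩
      count (_==R β) (Pre (suc i) ++ take t (block (suc i)))
        ≡⟨ count-++ (_==R β) (Pre (suc i)) _ ⟩
      count (_==R β) (Pre (suc i)) + count (_==R β) (take t (block (suc i)))
        ≡⟨ cong₂ _+_ before (count-∈-Unique (Uniqueₚ.take⁺ t (Γk-Unique n (conj μ (suc i)))) here′) ⟩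
      (part μ a ∸ suc i) + 1
        ≡⟨ +-comm _ 1 ⟩
      1 + (part μ a ∸ suc i)
        -- A root of row a in this block has a ≤ μ'_{i+1}, that is i + 1 ≤ μ_a, so the truncated
        -- subtraction is exact.
        ≡⟨ +-∸-assoc 1 (conj⇒part μ-part 1≤a a≤k) ⟨
      part μ a ∸ i ∎
      where
      β = nth (0 , 0) (block (suc i)) t
      a = proj₁ β
      b = proj₂ β
      β∈ : β ∈ block (suc i)
      β∈ = nth-∈ (0 , 0) 1≤t t≤
      bounds : 1 ≤ a × a ≤ conj μ (suc i) × conj μ (suc i) < b
      bounds = ∈-Γk⁻ {n} β∈
      1≤a = proj₁ bounds
      a≤k = proj₁ (proj₂ bounds)
      b≤n : b ≤ n
      b≤n = proj₂ (proj₂ (All.lookup (rows-roots (k≤n (s≤s z≤n)) (conj μ (suc i)) ≤-refl) β∈))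
      root≡ : nth (0 , 0) (Γ n μ) (L (suc i) + t) ≡ β
      root≡ = begin
        nth (0 , 0) (Γ n μ) (L (suc i) + t)                         ≡⟨ cong (λ γ → nth (0 , 0) γ (L (suc i) + t)) (Γ-split i<M) ⟩
        nth (0 , 0) (Pre (suc i) ++ Post (suc i)) (L (suc i) + t)   ≡⟨ nth-++ʳ (0 , 0) (Pre (suc i)) 1≤t ⟩
        nth (0 , 0) (block (suc i) ++ Post i) t                     ≡⟨ nth-++ˡ (0 , 0) (block (suc i)) t≤ 1≤t ⟩
        β                                                           ∎
      initial : take (L (suc i) + t) (Γ n μ) ≡ Pre (suc i) ++ take t (block (suc i))
      initial = begin
        take (L (suc i) + t) (Γ n μ)                                ≡⟨ cong (take (L (suc i) + t)) (Γ-split i<M) ⟩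
        take (L (suc i) + t) (Pre (suc i) ++ Post (suc i))          ≡⟨ take-++ (Pre (suc i)) _ t ⟩
        Pre (suc i) ++ take t (block (suc i) ++ Post i)             ≡⟨ cong (Pre (suc i) ++_) (take-++ˡ (block (suc i)) (Post i) t≤) ⟩
        Pre (suc i) ++ take t (block (suc i))                       ∎
      here′ : β ∈ take t (block (suc i))
      here′ = subst (_∈ take t (block (suc i))) (nth-take (0 , 0) t (block (suc i)) ≤-refl)
        (nth-∈ (0 , 0) 1≤t (≤-reflexive (sym (length-take-≤ t≤))))
      -- Columns further to the left are no taller, so `b` exceeds their heights too, as
      -- `count-blocks` requires.
      later : All (λ j → conj μ j < b) (filterᵇ (suc i <ᵇ_) [ M …1])
      later = All.tabulate λ {j} j∈ → let (_ , i<j) = ∈-filter⁻ _ {xs = [ M …1]} j∈ in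
        ≤-trans (s≤s (conj-antitone (s≤s z≤n) (<⇒≤ (<ᵇ⇒< (suc i) j i<j)))) (proj₂ (proj₂ bounds))
      before : count (_==R β) (Pre (suc i)) ≡ part μ a ∸ suc i
      before = begin
        count (_==R β) (Pre (suc i))                                                 ≡⟨ count-blocks n μ (filterᵇ (suc i <ᵇ_) [ M …1]) 1≤a b≤n later ⟩
        count (λ j → a ≤ᵇ conj μ j) (filterᵇ (suc i <ᵇ_) [ M …1])                    ≡⟨ count-filter (λ j → a ≤ᵇ conj μ j) (suc i <ᵇ_) [ M …1] ⟩
        count (λ j → (suc i <ᵇ j) ∧ (a ≤ᵇ conj μ j)) [ M …1]
          ≡⟨ count-cong (All-[…1] M λ j 1≤j _ → cong ((suc i <ᵇ j) ∧_) (≤ᵇ-conj 1≤a 1≤j)) ⟩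
        count (λ j → (suc i <ᵇ j) ∧ (j ≤ᵇ part μ a)) [ M …1]                         ≡⟨ count≡sum (λ j → (suc i <ᵇ j) ∧ (j ≤ᵇ part μ a)) [ M …1] ⟩
        sum (map (λ j → 𝟙 ((suc i <ᵇ j) ∧ (j ≤ᵇ part μ a))) [ M …1])                 ≡⟨ sum-[…1] M (λ j → 𝟙 ((suc i <ᵇ j) ∧ (j ≤ᵇ part μ a))) ⟩
        ∑ M (λ j → 𝟙 ((suc i <ᵇ j) ∧ (j ≤ᵇ part μ a)))                               ≡⟨ ∑-interval M (suc i) (part μ a) (part-≤-first 1≤a) ⟩
        part μ a ∸ suc i                                                             ∎

  private
    result : ∀ {i} → i < M → BlockResult n (conj μ (suc i)) (λ a → part μ a ∸ i) (π (suc i)) (π i)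
      (negSum ((λ a → part μ a ∸ i) ∘ proj₁) (π (suc i)) (block (suc i)) (mask (suc i))) (conj μ (suc i))
    result {i} i<M = subst
      (λ u → BlockResult n (conj μ (suc i)) (λ a → part μ a ∸ i) (π (suc i)) u
        (negSum ((λ a → part μ a ∸ i) ∘ proj₁) (π (suc i)) (block (suc i)) (mask (suc i))) (conj μ (suc i)))
      (sym (π-suc i<M))
      (rows-result (λ a → part μ a ∸ i) (π (suc i)) (k≤n (s≤s z≤n)) π∈S (conj μ (suc i)) (mask (suc i)) ≤-refl (length-mask i<M) (block-path i<M))

  π-circular : ∀ {i} → i < M → ∀ {a c} → 1 ≤ a → a < c → c ≤ conj μ (suc i) →
    Circular (π i ⟨ a ⟩) (π (suc i) ⟨ a ⟩) (π (suc i) ⟨ c ⟩)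
  π-circular i<M 1≤a a<c c≤k = BlockResult.circular (result i<M) 1≤a (≤-trans (<⇒≤ a<c) c≤k) a<c c≤k

  -- The level as a sum over blocks

  private
    h : ℕ → ℕ
    h = alevel (Γ n μ)

    -- The contribution of the block Γ^{i+1} to the level. The weight μ_a - i is at once the affine
    -- level of the roots in row a of this block and the arm of the cell in row a of C^i.
    rowSum : ℕ → ℕ
    rowSum zero = 0
    rowSum (suc i) = ∑ (conj μ (suc i)) (λ a → if π (suc i) ⟨ a ⟩ <ᵇ π i ⟨ a ⟩ then part μ a ∸ i else 0)

    blockSum : ∀ {i} → i < M → sum (map h (negFrom (L (suc i)) (π (suc i)) (block (suc i)) (mask (suc i)))) ≡ rowSum (suc i)
    blockSum {i} i<M = trans
      (sumNeg≡negSum h ((λ a → part μ a ∸ i) ∘ proj₁) (L (suc i)) (π (suc i)) (block (suc i)) (mask (suc i)) (alevel-block i<M))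
      (BlockResult.weight (result i<M))

    tailSum : ∀ {j} → j ≤ M → sum (map h (negFrom (L j) (π j) (Post j) (suf j))) ≡ ∑ j rowSum
    tailSum {zero} _ = refl
    tailSum {suc i} i<M = begin
      sum (map h (negFrom (L (suc i)) (π (suc i)) (block (suc i) ++ Post i) (suf (suc i))))
        ≡⟨ cong (λ s → sum (map h (negFrom (L (suc i)) (π (suc i)) (block (suc i) ++ Post i) s))) (suf-suc i<M) ⟩
      sum (map h (negFrom (L (suc i)) (π (suc i)) (block (suc i) ++ Post i) (mask (suc i) ++ suf i)))
        ≡⟨ sumNeg-++ h (L (suc i)) (π (suc i)) (block (suc i)) (mask (suc i)) (length-mask i<M) ⟩
      sum (map h (negFrom (L (suc i)) (π (suc i)) (block (suc i)) (mask (suc i)))) +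
      sum (map h (negFrom (L (suc i) + length (block (suc i))) (applySel (π (suc i)) (block (suc i)) (mask (suc i))) (Post i) (suf i)))
        ≡⟨ cong₂ _+_ (blockSum i<M) (cong₂ (λ l u → sum (map h (negFrom l u (Post i) (suf i)))) (sym (L-suc i<M)) (sym (π-suc i<M))) ⟩
      rowSum (suc i) + sum (map h (negFrom (L i) (π i) (Post i) (suf i)))
        ≡⟨ cong (rowSum (suc i) +_) (tailSum (<⇒≤ i<M)) ⟩
      rowSum (suc i) + ∑ i rowSum
        ≡⟨ +-comm (rowSum (suc i)) _ ⟩
      ∑ i rowSum + rowSum (suc i)
        ≡⟨ ∑-suc i rowSum ⟨
      ∑ (suc i) rowSum ∎

    level≡∑rowSum : level n μ w J ≡ ∑ M rowSum
    level≡∑rowSum = trans (cong (λ xs → sum (map h xs)) start) (tailSum ≤-refl)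
      where
      Pre-M : Pre M ≡ []
      Pre-M = cong (blocks n μ) (filter-<-none M M ≤-refl)
      -- Offset, permutation and remaining mask all depend on the prefix `Pre M`; with a variable in
      -- its place, the single fact that it is empty settles all three.
      empty-prefix : ∀ {X : List Root} → X ≡ [] → negFrom 0 w (Γ n μ) J ≡ negFrom (length X) (applySel w X (take (length X) J)) (Γ n μ) (drop (length X) J)
      empty-prefix refl = refl
      start : negFrom 0 w (Γ n μ) J ≡ negFrom (L M) (π M) (Post M) (suf M)
      start = empty-prefix Pre-M

  private
    -- Suppose row c ≥ a of C¹ held a value x < a. As π⁰ is the identity, π⁰ has x in row x, above
    -- row c; but a value arriving in row x is never one that stood below it in C¹, by `apart`.
    first-column : ∀ {a} → 0 < M → 1 ≤ a → a ≤ conj μ 1 → a ≤ π 1 ⟨ a ⟩ × (∀ {c} → a < c → c ≤ conj μ 1 → a ≤ π 1 ⟨ c ⟩)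
    first-column {a} 0<M 1≤a a≤k = large ≤-refl a≤k , λ a<c → large (<⇒≤ a<c)
      where
      large : ∀ {c} → a ≤ c → c ≤ conj μ 1 → a ≤ π 1 ⟨ c ⟩
      large {c} a≤c c≤k = ≮⇒≥ λ x<a →
        let 1≤x = proj₁ (Perm-range π∈S (≤-trans 1≤a a≤c) (≤-trans c≤k (k≤n ≤-refl)))
            x<c = ≤-trans x<a a≤c
        in BlockResult.apart (result 0<M) 1≤x (≤-trans (<⇒≤ x<c) c≤k) x<c c≤k
             (trans (cong (_⟨ π 1 ⟨ c ⟩ ⟩) π⁰≡id) (nth-[1…] 1≤x (≤-trans (<⇒≤ x<c) (≤-trans c≤k (k≤n ≤-refl)))))

    π⁰ : ∀ {a} → 1 ≤ a → a ≤ conj μ 1 → π 0 ⟨ a ⟩ ≡ a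
    π⁰ {a} 1≤a a≤k = trans (cong (_⟨ a ⟩) π⁰≡id) (nth-[1…] 1≤a (≤-trans a≤k (k≤n ≤-refl)))

  -- Since π⁰ is the identity, the circular condition says that C¹ increases.
  first-increasing : 0 < M → ∀ {a c} → 1 ≤ a → a < c → c ≤ conj μ 1 → π 1 ⟨ a ⟩ < π 1 ⟨ c ⟩
  first-increasing 0<M {a} {c} 1≤a a<c c≤k =
    Circular-increasing (proj₁ large) (proj₂ large a<c c≤k) (subst (λ x → Circular x (π 1 ⟨ a ⟩) (π 1 ⟨ c ⟩)) (π⁰ 1≤a a≤k) (π-circular 0<M 1≤a a<c c≤k))
    where
    a≤k = ≤-trans (<⇒≤ a<c) c≤k
    large = first-column 0<M 1≤a a≤k

  private
    -- There is no column C⁰ whose descents could account for foldings in Γ¹. Indeed π⁰(a) = a ≤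
    -- π¹(a), so no row of Γ¹ passes 1.
    rowSum-1 : 0 < M → rowSum 1 ≡ 0
    rowSum-1 0<M = sum-zero (All-[1…] (conj μ 1) λ a 1≤a a≤k →
      cong (λ t → if t then part μ a ∸ 0 else 0)
        (<ᵇ-false (≤-trans (≤-reflexive (π⁰ 1≤a a≤k)) (proj₁ (first-column 0<M 1≤a a≤k)))))

  -- The arm of the cell in row a of C^j if that cell is a descent.
  descent : ℕ → ℕ → ℕ
  descent j a = if (a ≤ᵇ conj μ (suc j)) ∧ (π (suc j) ⟨ a ⟩ <ᵇ π j ⟨ a ⟩) then part μ a ∸ j else 0

  ∑descent : ∀ j → ∑ n (descent j) ≡ rowSum (suc j)
  ∑descent j = begin
    ∑ n (descent j)                    ≡⟨ ∑-extend (descent j) (k≤n (s≤s z≤n)) outside ⟨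
    ∑ (conj μ (suc j)) (descent j)     ≡⟨ ∑-cong (conj μ (suc j)) inside ⟩
    rowSum (suc j)                     ∎
    where
    test : ℕ → Bool
    test a = π (suc j) ⟨ a ⟩ <ᵇ π j ⟨ a ⟩
    outside : ∀ a → conj μ (suc j) < a → a ≤ n → descent j a ≡ 0
    outside a k<a _ = cong (λ t → if t ∧ test a then part μ a ∸ j else 0) (≤ᵇ-false k<a)
    inside : ∀ a → 1 ≤ a → a ≤ conj μ (suc j) → descent j a ≡ (if test a then part μ a ∸ j else 0)
    inside a _ a≤k = cong (λ t → if t ∧ test a then part μ a ∸ j else 0) (≤ᵇ-true a≤k)

  -- The column C^{M+1} does not exist, but whatever the comparison yields, the arm μ_a ∸ M is 0
  -- because μ_a ≤ μ_1.
  descent-last : ∀ a → 1 ≤ a → descent M a ≡ 0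
  descent-last a 1≤a = if-zero ((a ≤ᵇ conj μ (suc M)) ∧ (π (suc M) ⟨ a ⟩ <ᵇ π M ⟨ a ⟩)) (m≤n⇒m∸n≡0 (part-≤-first 1≤a))

  -- The sums over blocks and over columns differ by a shift of the index: the term for Γ¹ drops out
  -- by `rowSum-1`, and the term added at the far end is 0 by `descent-last`.
  level≡∑descent : level n μ w J ≡ ∑ M (λ j → ∑ n (descent j))
  level≡∑descent = trans level≡∑rowSum (trans (shifted M refl) (∑-cong M λ j _ _ → sym (∑descent j)))
    where
    telescope : ∀ m → rowSum 1 ≡ 0 → ∑ (suc m) rowSum ≡ ∑ m (rowSum ∘ suc)
    telescope zero z = trans (+-identityʳ (rowSum 1)) z
    telescope (suc m) z = begin
      ∑ (suc (suc m)) rowSum                      ≡⟨ ∑-suc (suc m) rowSum ⟩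
      ∑ (suc m) rowSum + rowSum (suc (suc m))     ≡⟨ cong (_+ rowSum (suc (suc m))) (telescope m z) ⟩
      ∑ m (rowSum ∘ suc) + rowSum (suc (suc m))   ≡⟨ ∑-suc m (rowSum ∘ suc) ⟨
      ∑ (suc m) (rowSum ∘ suc)                    ∎
    last : rowSum (suc M) ≡ 0
    last = trans (sym (∑descent M)) (sum-zero (All-[1…] n λ a 1≤a _ → descent-last a 1≤a))
    -- `M` is replaced by a variable so that the empty diagram can be split off; the vanishing of
    -- the first block needs 0 < M.
    shifted : ∀ m → m ≡ M → ∑ m rowSum ≡ ∑ m (rowSum ∘ suc)
    shifted zero _ = refl
    shifted (suc m) e = begin
      ∑ (suc m) rowSum                           ≡⟨ telescope m (rowSum-1 (subst (0 <_) e (s≤s z≤n))) ⟩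
      ∑ m (rowSum ∘ suc)                         ≡⟨ +-identityʳ _ ⟨
      ∑ m (rowSum ∘ suc) + 0                     ≡⟨ cong (∑ m (rowSum ∘ suc) +_) (trans (cong (rowSum ∘ suc) e) last) ⟨
      ∑ m (rowSum ∘ suc) + rowSum (suc (suc m))  ≡⟨ ∑-suc m (rowSum ∘ suc) ⟨
      ∑ (suc m) (rowSum ∘ suc)                   ∎

-- Selecting letters in a word

rightmostFrom : ℕ → ℕ → List ℕ → Maybe ℕ → Maybe ℕ
rightmostFrom x i [] acc = acc
rightmostFrom x i (y ∷ ys) acc = rightmostFrom x (suc i) ys (if x ≡ᵇ y then just i else acc)

-- The local functions of rightmost and topLetter cannot be named outside Defs. Abstracting over
-- their initial arguments lets unification find them for the underscores.
mutual
  rightmost≡ : ∀ x v → rightmost x v ≡ rightmostFrom x 0 v nothing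
  rightmost≡ x v with 0 | nothing {A = ℕ}
  ... | i | acc = rightmostFrom≡ x i v acc

  rightmostFrom≡ : ∀ x i ys acc → _ ≡ rightmostFrom x i ys acc
  rightmostFrom≡ x i [] acc = refl
  rightmostFrom≡ x i (y ∷ ys) acc = rightmostFrom≡ x (suc i) ys _

topFrom : List ℕ → ℕ → ℕ → ℕ
topFrom v j zero = j ∸ 1
topFrom v j (suc f) = if elemᵇ j v then topFrom v (suc j) f else j ∸ 1

mutual
  topLetter≡ : ∀ v → topLetter v ≡ topFrom v 1 (suc (length v))
  topLetter≡ v with elemᵇ 1 v
  ... | false = refl
  ... | true with length v | 2
  ...   | f | j = topFrom≡ v j f

  topFrom≡ : ∀ v j f → _ ≡ topFrom v j f
  topFrom≡ v j zero = refl
  topFrom≡ v j (suc f) with elemᵇ j v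
  ... | true = topFrom≡ v (suc j) f
  ... | false = refl

rightmostFrom-∉ : ∀ {x} i {v} acc → x ∉ v → rightmostFrom x i v acc ≡ acc
rightmostFrom-∉ i {[]} acc _ = refl
rightmostFrom-∉ i {y ∷ v} acc x∉ rewrite ≡ᵇ-false (x∉ ∘ here) = rightmostFrom-∉ (suc i) acc (x∉ ∘ there)

rightmost-∉ : ∀ {x v} → x ∉ v → rightmost x v ≡ nothing
rightmost-∉ {x} {v} x∉ = trans (rightmost≡ x v) (rightmostFrom-∉ 0 nothing x∉)

rightmost-last : ∀ x pre {suf} → x ∉ suf → rightmost x (pre ++ x ∷ suf) ≡ just (length pre)
rightmost-last x pre {suf} x∉ = trans (rightmost≡ x (pre ++ x ∷ suf)) (go 0 pre nothing)
  where
  go : ∀ i pre acc → rightmostFrom x i (pre ++ x ∷ suf) acc ≡ just (i + length pre)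
  go i [] acc rewrite ≡ᵇ-refl x | +-identityʳ i = rightmostFrom-∉ (suc i) (just i) x∉
  go i (y ∷ pre) acc = trans (go (suc i) pre _) (cong just (sym (+-suc i (length pre))))

elemᵇ-true : ∀ {x v} → x ∈ v → elemᵇ x v ≡ true
elemᵇ-true {x} (here refl) rewrite ≡ᵇ-refl x = refl
elemᵇ-true {x} {y ∷ v} (there x∈) with x ≡ᵇ y
... | true = refl
... | false = elemᵇ-true x∈

elemᵇ-sound : ∀ {x} v → elemᵇ x v ≡ true → x ∈ v
elemᵇ-sound {x} (y ∷ v) e with x ≡ᵇ y in xy
... | true = here (≡ᵇ⇒≡ x y (≡true⇒T xy))
... | false = there (elemᵇ-sound v e)

elemᵇ-false : ∀ {x v} → x ∉ v → elemᵇ x v ≡ false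
elemᵇ-false {x} {v} x∉ with elemᵇ x v in e
... | false = refl
... | true = contradiction (elemᵇ-sound v e) x∉

-- A pigeonhole argument, which shows that the fuel of `topLetter` lasts until the first missing
-- letter: an occurrence of k + 1 is deleted, and the smaller letters survive.
[1…]⊆⇒≤length : ∀ k {v : List ℕ} → (∀ j → 1 ≤ j → j ≤ k → j ∈ v) → k ≤ length v
[1…]⊆⇒≤length zero _ = z≤n
[1…]⊆⇒≤length (suc k) {v} all with ∈-∃++ (all (suc k) (s≤s z≤n) ≤-refl)
... | xs , ys , refl = begin
  suc k                          ≤⟨ s≤s ([1…]⊆⇒≤length k rest) ⟩
  suc (length (xs ++ ys))        ≡⟨ cong suc (length-++ xs) ⟩
  suc (length xs + length ys)    ≡⟨ +-suc (length xs) (length ys) ⟨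
  length xs + suc (length ys)    ≡⟨ length-++ xs ⟨
  length (xs ++ [ suc k ] ++ ys) ∎
  where
  open ≤-Reasoning
  rest : ∀ j → 1 ≤ j → j ≤ k → j ∈ xs ++ ys
  rest j 1≤j j≤k with ∈-++⁻ xs (all j 1≤j (m≤n⇒m≤1+n j≤k))
  ... | inj₁ j∈ = ∈-++⁺ˡ j∈
  ... | inj₂ (here j≡) = contradiction j≤k (<⇒≱ (≤-reflexive (sym j≡)))
  ... | inj₂ (there j∈) = ∈-++⁺ʳ xs j∈

topLetter-max : ∀ k v → (∀ j → 1 ≤ j → j ≤ k → j ∈ v) → suc k ∉ v → topLetter v ≡ k
topLetter-max k v all k+1∉ = trans (topLetter≡ v)
  (go 1 (suc (length v)) ≤-refl (s≤s z≤n) (s≤s (m≤n⇒m≤1+n ([1…]⊆⇒≤length k all))))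
  where
  go : ∀ j f → 1 ≤ j → j ≤ suc k → suc k ≤ j + f → topFrom v j f ≡ k
  go j zero _ j≤ k≤ = cong (_∸ 1) (≤-antisym j≤ (subst (suc k ≤_) (+-identityʳ j) k≤))
  go j (suc f) 1≤j j≤ k≤ with j ≟ suc k
  ... | yes refl rewrite elemᵇ-false k+1∉ = refl
  ... | no j≢ rewrite elemᵇ-true (all j 1≤j (≤-pred (≤∧≢⇒< j≤ j≢))) =
    go (suc j) f (s≤s z≤n) (≤∧≢⇒< j≤ j≢) (subst (suc k ≤_) (+-suc j f) k≤)

module _ {k : ℕ} {v : List ℕ} {j p q : ℕ} where

  selectFrom-near : ∀ r → nearestLeft (suc j) p v ≡ just q →
    selectFrom k v j p (suc r) ≡ (q ∷ proj₁ (selectFrom k v (suc j) q r) , proj₂ (selectFrom k v (suc j) q r))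
  selectFrom-near r e rewrite e = refl

  selectFrom-far : ∀ r → nearestLeft (suc j) p v ≡ nothing → rightmost (suc j) v ≡ just q →
    selectFrom k v j p (suc r) ≡ (q ∷ proj₁ (selectFrom k v (suc j) q r) , (k ∸ j) + proj₂ (selectFrom k v (suc j) q r))
  selectFrom-far r e e′ rewrite e | e′ = refl

chargeF-step : ∀ f {v k p} → rightmost 1 v ≡ just p → topLetter v ≡ k →
  chargeF (suc f) v ≡ proj₂ (selectFrom k v 1 p (k ∸ 1)) + chargeF f (removeAt (p ∷ proj₁ (selectFrom k v 1 p (k ∸ 1))) v)
chargeF-step f e refl rewrite e = refl

chargeF-stop : ∀ f {v} → rightmost 1 v ≡ nothing → chargeF f v ≡ 0
chargeF-stop zero _ = refl
chargeF-stop (suc f) e rewrite e = refl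

-- Biwords

Biletter : Set
Biletter = ℕ × ℕ

infix 4 _≻_
-- The order of biletters in the charge word: the larger one stands further to the left.
_≻_ : Biletter → Biletter → Set
(k , j) ≻ (k′ , j′) = k′ < k ⊎ (k ≡ k′ × j′ < j)

≻-asym : ∀ {x y} → x ≻ y → ¬ y ≻ x
≻-asym (inj₁ l) (inj₁ l′) = <-asym l l′
≻-asym (inj₁ l) (inj₂ (refl , _)) = <-irrefl refl l
≻-asym (inj₂ (refl , _)) (inj₁ l) = <-irrefl refl l
≻-asym (inj₂ (_ , l)) (inj₂ (_ , l′)) = <-asym l l′

≻⇒≢ : ∀ {x y} → x ≻ y → x ≢ y
≻⇒≢ x≻y refl = ≻-asym x≻y x≻y

≻-≥ : ∀ {k j k′ j′} → (k , j) ≻ (k′ , j′) → k′ ≤ k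
≻-≥ (inj₁ l) = <⇒≤ l
≻-≥ (inj₂ (refl , _)) = ≤-refl

Decreasing : List Biletter → Set
Decreasing = AllPairs _≻_

Decreasing-Unique : ∀ {B} → Decreasing B → Unique B
Decreasing-Unique = AllPairs.map ≻⇒≢

Decreasing-split : ∀ pre {x suf} → Decreasing (pre ++ x ∷ suf) → Decreasing pre × All (_≻ x) pre × All (x ≻_) suf
Decreasing-split [] (x≻ ∷ _) = [] , [] , x≻
Decreasing-split (y ∷ pre) (y≻ ∷ d) with Decreasing-split pre d
... | d′ , l , r = Allₚ.++⁻ˡ pre y≻ ∷ d′ , All.lookup y≻ (∈-insert pre) ∷ l , r

-- Positions count from 0 as in the charge algorithm, whereas `nth` counts from 1; hence the
-- successor.
At : List Biletter → ℕ → Biletter → Set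
At B i y = i < length B × nth (0 , 0) B (suc i) ≡ y

At-mid : ∀ pre {x suf} → At (pre ++ x ∷ suf) (length pre) x
At-mid pre {x} {suf} = subst (length pre <_) (sym (length-++ pre)) (m<m+n (length pre) (s≤s z≤n)) , nth-mid (0 , 0) pre x suf

At-++ : ∀ pre {suf i y} → At pre i y → At (pre ++ suf) i y
At-++ pre {suf} (i< , e) = subst (_ <_) (sym (length-++ pre)) (≤-trans i< (m≤m+n _ _)) , trans (nth-++ˡ (0 , 0) pre i< (s≤s z≤n)) e

At-∈ : ∀ {B i y} → At B i y → y ∈ B
At-∈ {B} (i< , e) = subst (_∈ B) e (nth-∈ (0 , 0) (s≤s z≤n) i<)

At-injective : ∀ {B i j y} → Unique B → At B i y → At B j y → i ≡ j
At-injective u (i< , e) (j< , e′) = suc-injective (nth-injective (0 , 0) u (s≤s z≤n) i< (s≤s z≤n) j< (trans e (sym e′)))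

At-functional : ∀ {B i y z} → At B i y → At B i z → y ≡ z
At-functional (_ , e) (_ , e′) = trans (sym e) e′

At-split : ∀ {B i y} → At B i y → ∃ λ pre → ∃ λ suf → B ≡ pre ++ y ∷ suf × length pre ≡ i
At-split {B} {i} (i< , refl) with nth-split (0 , 0) B {suc i} (s≤s z≤n) i<
... | pre , suf , e , l = pre , suf , e , suc-injective l

word : List Biletter → List ℕ
word = map proj₂

∈-word⁻ : ∀ {j B} → j ∈ word B → ∃ λ k → (k , j) ∈ B
∈-word⁻ j∈ with ∈-map⁻ proj₂ j∈
... | (k , _) , kj∈ , refl = k , kj∈

-- Among biletters with the same lower letter, those further right have smaller upper letters.
rightmost-smallest : ∀ {B k j} → Decreasing B → (k , j) ∈ B → (∀ {z} → (z , j) ∈ B → k ≤ z) →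
  ∃ λ p → At B p (k , j) × rightmost j (word B) ≡ just p
rightmost-smallest {B} {k} {j} d kj∈ least with ∈-∃++ kj∈
... | pre , suf , refl = length pre , At-mid pre , (begin
  rightmost j (word (pre ++ (k , j) ∷ suf))        ≡⟨ cong (rightmost j) (map-++ proj₂ pre _) ⟩
  rightmost j (word pre ++ j ∷ word suf)           ≡⟨ rightmost-last j (word pre) j∉ ⟩
  just (length (word pre))                         ≡⟨ cong just (length-map proj₂ pre) ⟩
  just (length pre)                                ∎)
  where
  open ≡-Reasoning
  j∉ : j ∉ word suf
  j∉ j∈ with ∈-word⁻ j∈
  ... | z , zj∈ with All.lookup (proj₂ (proj₂ (Decreasing-split pre d))) zj∈
  ...   | inj₁ z<k = <⇒≱ z<k (least (∈-++⁺ʳ pre (there zj∈)))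
  ...   | inj₂ (_ , j<j) = <-irrefl refl j<j

module _ {B p y} (d : Decreasing B) (at : At B p y) where

  private
    nearestLeft≡ : ∀ {pre suf} → B ≡ pre ++ y ∷ suf → length pre ≡ p → ∀ j → nearestLeft j p (word B) ≡ rightmost j (word pre)
    nearestLeft≡ {pre} {suf} refl refl j = cong (rightmost j) (begin
      take (length pre) (word (pre ++ y ∷ suf))    ≡⟨ take-map (length pre) (pre ++ y ∷ suf) ⟩
      word (take (length pre) (pre ++ y ∷ suf))    ≡⟨ cong word (take-++ˡ pre (y ∷ suf) ≤-refl) ⟩
      word (take (length pre) pre)                 ≡⟨ cong word (take-all (length pre) pre ≤-refl) ⟩
      word pre                                     ∎)
      where open ≡-Reasoning

  -- In a decreasing biword the biletters to the left of `y` are exactly those `≻ y`, so the search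
  -- to the left becomes a minimum over this set.
  nearestLeft-smallest : ∀ {k j} → (k , j) ∈ B → (k , j) ≻ y → (∀ {z} → (z , j) ∈ B → (z , j) ≻ y → k ≤ z) →
    ∃ λ q → At B q (k , j) × nearestLeft j p (word B) ≡ just q
  nearestLeft-smallest {k} {j} kj∈ kj≻y least with At-split at
  ... | pre , suf , e , l = q , subst (λ X → At X q (k , j)) (sym e) (At-++ pre (proj₁ (proj₂ found))) ,
      trans (nearestLeft≡ e l j) (proj₂ (proj₂ found))
    where
    split = Decreasing-split pre (subst Decreasing e d)
    in-pre : (k , j) ∈ pre
    in-pre with ∈-++⁻ pre (subst ((k , j) ∈_) e kj∈)
    ... | inj₁ ∈pre = ∈pre
    ... | inj₂ (here refl) = contradiction refl (≻⇒≢ kj≻y)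
    ... | inj₂ (there ∈suf) = contradiction (All.lookup (proj₂ (proj₂ split)) ∈suf) (≻-asym kj≻y)
    found = rightmost-smallest (proj₁ split) in-pre
      (λ {z} z∈ → least (subst ((z , j) ∈_) (sym e) (∈-++⁺ˡ z∈)) (All.lookup (proj₁ (proj₂ split)) z∈))
    q = proj₁ found

  nearestLeft-none : ∀ {j} → (∀ {z} → (z , j) ∈ B → ¬ (z , j) ≻ y) → nearestLeft j p (word B) ≡ nothing
  nearestLeft-none {j} none with At-split at
  ... | pre , suf , e , l = trans (nearestLeft≡ e l j) (rightmost-∉ λ j∈ →
      let (z , z∈) = ∈-word⁻ j∈ in
      none (subst ((z , j) ∈_) (sym e) (∈-++⁺ˡ z∈)) (All.lookup (proj₁ (proj₂ (Decreasing-split pre (subst Decreasing e d)))) z∈))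

-- The function `f` absorbs the index shift of the recursion; `upTo` is the case of `id`.
filter-zip : (P : ℕ → Bool) (Q : Biletter → Bool) (f : ℕ → ℕ) (B : List Biletter) → (∀ {i y} → At B i y → P (f i) ≡ Q y) →
  map proj₂ (filterᵇ (λ iv → P (proj₁ iv)) (zip (applyUpTo f (length (word B))) (word B))) ≡ word (filterᵇ Q B)
filter-zip P Q f [] _ = refl
filter-zip P Q f (b ∷ B) PQ with P (f 0) | Q b | PQ {0} (s≤s z≤n , refl) | filter-zip P Q (f ∘ suc) B (λ {i} (i< , e) → PQ {suc i} (s≤s i< , e))
... | true | true | _ | e = cong (proj₂ b ∷_) e
... | false | false | _ | e = e

removeAt-word : ∀ (Q : Biletter → Bool) s B → (∀ {i y} → At B i y → not (elemᵇ i s) ≡ Q y) →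
  removeAt s (word B) ≡ word (filterᵇ Q B)
removeAt-word Q s B = filter-zip (λ i → not (elemᵇ i s)) Q id B

-- Charge of a filling whose columns are matched greedily in the circular order

-- Column j has height h j and entries C j 1 , … , C j (h j); row a has length len a.
record Columns (M N : ℕ) (h len : ℕ → ℕ) (C : ℕ → ℕ → ℕ) : Set where
  field
    height⇒row : ∀ {a j} → 1 ≤ a → a ≤ h j → j ≤ len a
    row⇒height : ∀ {a j} → 1 ≤ a → 1 ≤ j → j ≤ len a → a ≤ h j
    len≤M : ∀ {a} → 1 ≤ a → len a ≤ M
    h≤N : ∀ {j} → 1 ≤ j → h j ≤ N
    distinct : ∀ {j a c} → 1 ≤ j → 1 ≤ a → a ≤ h j → 1 ≤ c → c ≤ h j → C j a ≡ C j c → a ≡ c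
    circular : ∀ {j a c} → 1 ≤ j → j < M → 1 ≤ a → a < c → c ≤ h (suc j) → Circular (C j a) (C (suc j) a) (C (suc j) c)
    increasing : 0 < M → ∀ {a c} → 1 ≤ a → a < c → c ≤ h 1 → C 1 a < C 1 c

module Charge {M N h len C} (cols : Columns M N h len C) where

  open Columns cols

  -- `len a ∸ j` is the arm of the cell in row a of column j, and also the amount k - j that the
  -- algorithm adds when it wraps around after selecting j, with k = `len a`.
  desc : ℕ → ℕ → ℕ
  desc a j = if C (suc j) a <ᵇ C j a then len a ∸ j else 0

  -- B consists of the biletters of the rows below row r.
  record Stage (r : ℕ) (B : List Biletter) : Set where
    field
      decreasing : Decreasing B
      sound : ∀ {z j} → (z , j) ∈ B → 1 ≤ j × ∃ λ c → r < c × c ≤ h j × C j c ≡ z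
      complete : ∀ {j c} → 1 ≤ j → j ≤ M → r < c → c ≤ h j → (C j c , j) ∈ B

  module Pass {r B} (stage : Stage r B) (r<h : r < h 1) where

    open Stage stage

    a = suc r
    k = len a
    v = word B
    1≤a : 1 ≤ a
    1≤a = s≤s z≤n

    1≤k : 1 ≤ k
    1≤k = height⇒row 1≤a r<h

    letter∈ : ∀ {j} → 1 ≤ j → j ≤ k → (C j a , j) ∈ B
    letter∈ 1≤j j≤k = complete 1≤j (≤-trans j≤k (len≤M 1≤a)) ≤-refl (row⇒height 1≤a 1≤j j≤k)

    top≡ : topLetter v ≡ k
    top≡ = topLetter-max k v (λ j 1≤j j≤k → ∈-map⁺ proj₂ (letter∈ 1≤j j≤k)) k+1∉
      where
      -- A remaining letter k + 1 would come from a row at or below row a, so column k + 1 would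
      -- reach row a, beyond the length of that row.
      k+1∉ : suc k ∉ v
      k+1∉ ∈v with ∈-word⁻ ∈v
      ... | z , z∈ with sound z∈
      ...   | _ , c , r<c , c≤h , _ = <-irrefl refl (height⇒row 1≤a (≤-trans r<c c≤h))

    first : ∃ λ p → At B p (C 1 a , 1) × rightmost 1 v ≡ just p
    first = rightmost-smallest decreasing (letter∈ ≤-refl 1≤k) least
      where
      least : ∀ {z} → (z , 1) ∈ B → C 1 a ≤ z
      least z∈ with sound z∈
      ... | _ , c , r<c , c≤h , refl with a ≟ c
      ...   | yes refl = ≤-refl
      ...   | no a≢c = <⇒≤ (increasing (≤-trans 1≤k (len≤M 1≤a)) 1≤a (≤∧≢⇒< r<c a≢c) c≤h)

    letters : ℕ → ℕ → List Biletter
    letters j zero = []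
    letters j (suc m) = (C (suc j) a , suc j) ∷ letters (suc j) m

    -- If C^j(a) ≤ C^{j+1}(a), then `Circular` makes C^{j+1}(a) the least remaining entry of its
    -- column that stands to the left, so it is the nearest. Otherwise all remaining entries of that
    -- column are below C^j(a), none stands to the left, and the wrap selects the least of them,
    -- again C^{j+1}(a).
    next : ∀ {j p} → 1 ≤ j → suc j ≤ k → At B p (C j a , j) → ∀ m → ∃ λ q → At B q (C (suc j) a , suc j) ×
      selectFrom k v j p (suc m) ≡ (q ∷ proj₁ (selectFrom k v (suc j) q m) , desc a j + proj₂ (selectFrom k v (suc j) q m))
    next {j} {p} 1≤j j<k at m with C j a ≤? C (suc j) a
    ... | yes x≤x₀ = q , at′ , trans (selectFrom-near {k} {v} {j} {p} m eq)
        (cong (λ t → (q ∷ proj₁ (selectFrom k v (suc j) q m) , (if t then k ∸ j else 0) + proj₂ (selectFrom k v (suc j) q m))) (sym (<ᵇ-false x≤x₀)))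
      where
      j<M = ≤-trans j<k (len≤M 1≤a)
      -- For equal entries the larger column number comes first in the word, so j + 1 is still found
      -- to the left of j.
      before : (C (suc j) a , suc j) ≻ (C j a , j)
      before with C j a ≟ C (suc j) a
      ... | yes e = inj₂ (sym e , n<1+n j)
      ... | no ne = inj₁ (≤∧≢⇒< x≤x₀ ne)
      least : ∀ {z} → (z , suc j) ∈ B → (z , suc j) ≻ (C j a , j) → C (suc j) a ≤ z
      least z∈ z≻ with sound z∈
      ... | _ , c , r<c , c≤h , refl with a ≟ c
      ...   | yes refl = ≤-refl
      ...   | no a≢c = <⇒≤ (Circular-increasing x≤x₀ (≻-≥ z≻) (circular 1≤j j<M 1≤a (≤∧≢⇒< r<c a≢c) c≤h))
      found = nearestLeft-smallest decreasing at (letter∈ (s≤s z≤n) j<k) before least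
      q = proj₁ found
      at′ = proj₁ (proj₂ found)
      eq = proj₂ (proj₂ found)
    ... | no x≰x₀ = q , at′ , trans (selectFrom-far {k} {v} {j} {p} m none eq)
        (cong (λ t → (q ∷ proj₁ (selectFrom k v (suc j) q m) , (if t then k ∸ j else 0) + proj₂ (selectFrom k v (suc j) q m))) (sym (<ᵇ-true x₀<x)))
      where
      j<M = ≤-trans j<k (len≤M 1≤a)
      x₀<x = ≰⇒> x≰x₀
      inside : ∀ {z} → (z , suc j) ∈ B → C (suc j) a ≤ z × z < C j a
      inside z∈ with sound z∈
      ... | _ , c , r<c , c≤h , refl with a ≟ c
      ...   | yes refl = ≤-refl , x₀<x
      ...   | no a≢c with circular 1≤j j<M 1≤a (≤∧≢⇒< r<c a≢c) c≤h
      ...     | inj₁ (x≤x₀ , _) = contradiction x≤x₀ x≰x₀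
      ...     | inj₂ (_ , x₀<z , z<x) = <⇒≤ x₀<z , z<x
      none : nearestLeft (suc j) p v ≡ nothing
      none = nearestLeft-none decreasing at λ z∈ z≻ → <⇒≱ (proj₂ (inside z∈)) (≻-≥ z≻)
      found = rightmost-smallest decreasing (letter∈ (s≤s z≤n) j<k) (proj₁ ∘ inside)
      q = proj₁ found
      at′ = proj₁ (proj₂ found)
      eq = proj₂ (proj₂ found)

    descFrom : ℕ → ℕ → ℕ
    descFrom j zero = 0
    descFrom j (suc m) = desc a j + descFrom (suc j) m

    select : ∀ m {j p} → 1 ≤ j → j + m ≡ k → At B p (C j a , j) →
      Pointwise (At B) (proj₁ (selectFrom k v j p m)) (letters j m) × proj₂ (selectFrom k v j p m) ≡ descFrom j m
    select zero _ _ _ = [] , refl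
    select (suc m) {j} {p} 1≤j j+m≡k at with next 1≤j (≤-trans (m<m+n j (s≤s z≤n)) (≤-reflexive j+m≡k)) at m
    ... | q , at′ , e with select m (s≤s z≤n) (trans (sym (+-suc j m)) j+m≡k) at′
    ...   | pw , c≡ = subst (λ t → Pointwise (At B) (proj₁ t) (letters j (suc m))) (sym e) (at′ ∷ pw) ,
                      trans (cong proj₂ e) (cong (desc a j +_) c≡)

    p = proj₁ first
    s = proj₁ (selectFrom k v 1 p (k ∸ 1))
    selected = select (k ∸ 1) ≤-refl (m+[n∸m]≡n 1≤k) (proj₁ (proj₂ first))

    -- Row a is recognised by its values, which works because the entries of a column are distinct;
    -- `removed` matches this with the algorithm's removal by position.
    keep : Biletter → Bool
    keep (z , j) = not (z ≡ᵇ C j a)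

    B′ = filterᵇ keep B

    ∈-letters : ∀ m j i → j < i → i ≤ j + m → (C i a , i) ∈ letters j m
    ∈-letters zero j i j<i i≤ = contradiction (≤-trans i≤ (≤-reflexive (+-identityʳ j))) (<⇒≱ j<i)
    ∈-letters (suc m) j i j<i i≤ with i ≟ suc j
    ... | yes refl = here refl
    ... | no i≢ = there (∈-letters m (suc j) i (≤∧≢⇒< j<i (i≢ ∘ sym)) (≤-trans i≤ (≤-reflexive (+-suc j m))))

    letters-value : ∀ m j {z i} → (z , i) ∈ letters j m → z ≡ C i a
    letters-value (suc m) j (here refl) = refl
    letters-value (suc m) j (there zi∈) = letters-value m (suc j) zi∈

    Pointwise-∈ˡ : ∀ {s S} → Pointwise (At B) s S → ∀ {i} → i ∈ s → ∃ λ y → y ∈ S × At B i y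
    Pointwise-∈ˡ (at ∷ _) (here refl) = _ , here refl , at
    Pointwise-∈ˡ (_ ∷ pw) (there i∈) with Pointwise-∈ˡ pw i∈
    ... | y , y∈ , at = y , there y∈ , at

    Pointwise-∈ʳ : ∀ {s S} → Pointwise (At B) s S → ∀ {y} → y ∈ S → ∃ λ i → i ∈ s × At B i y
    Pointwise-∈ʳ (at ∷ _) (here refl) = _ , here refl , at
    Pointwise-∈ʳ (_ ∷ pw) (there y∈) with Pointwise-∈ʳ pw y∈
    ... | i , i∈ , at = i , there i∈ , at

    all-selected : Pointwise (At B) (p ∷ s) (letters 0 (suc (k ∸ 1)))
    all-selected = proj₁ (proj₂ first) ∷ proj₁ selected

    removed : ∀ {i y} → At B i y → not (elemᵇ i (p ∷ s)) ≡ keep y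
    removed {i} {z , j} at with z ≟ C j a
    ... | yes refl rewrite ≡ᵇ-refl (C j a) = cong not (elemᵇ-true i∈)
      where
      bounds = sound (At-∈ at)
      -- Every remaining biletter lies in a column that reaches row a, so the selection has taken a
      -- letter from that column.
      j≤k : j ≤ k
      j≤k = let (_ , _ , r<c , c≤h , _) = bounds in height⇒row 1≤a (≤-trans r<c c≤h)
      at′ = Pointwise-∈ʳ all-selected (∈-letters (suc (k ∸ 1)) 0 j (proj₁ bounds) (≤-trans j≤k (≤-reflexive (sym (m+[n∸m]≡n 1≤k)))))
      i∈ : i ∈ p ∷ s
      i∈ = subst (_∈ p ∷ s) (At-injective (Decreasing-Unique decreasing) (proj₂ (proj₂ at′)) at) (proj₁ (proj₂ at′))
    ... | no z≢ rewrite ≡ᵇ-false z≢ = cong not (elemᵇ-false i∉)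
      where
      i∉ : i ∉ p ∷ s
      i∉ i∈ with Pointwise-∈ˡ all-selected i∈
      ... | y , y∈ , at′ with At-functional {B} at at′
      ...   | refl = z≢ (letters-value (suc (k ∸ 1)) 0 y∈)

    keep-true : ∀ {z j} → z ≢ C j a → T (keep (z , j))
    keep-true z≢ rewrite ≡ᵇ-false z≢ = tt

    keep-false : ∀ j → ¬ T (keep (C j a , j))
    keep-false j t rewrite ≡ᵇ-refl (C j a) = t

    stage′ : Stage (suc r) B′
    stage′ = record
      { decreasing = AllPairsₚ.filter⁺ _ decreasing
      ; sound = sound′
      ; complete = λ {j} {c} 1≤j j≤M a<c c≤h → ∈-filter⁺ _ (complete 1≤j j≤M (<⇒≤ a<c) c≤h)
          (keep-true λ e → <⇒≢ a<c (sym (distinct 1≤j (≤-trans 1≤a (<⇒≤ a<c)) c≤h 1≤a (≤-trans (<⇒≤ a<c) c≤h) e))) }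
      where
      sound′ : ∀ {z j} → (z , j) ∈ B′ → 1 ≤ j × ∃ λ c → suc r < c × c ≤ h j × C j c ≡ z
      sound′ {z} {j} z∈ with ∈-filter⁻ _ {xs = B} z∈
      ... | z∈B , kept with sound z∈B
      ...   | 1≤j , c , r<c , c≤h , refl = 1≤j , c ,
                ≤∧≢⇒< r<c (λ { refl → keep-false j kept }) , c≤h , refl

    shorter : length B′ < length B
    shorter = filter-notAll _ B (lose (letter∈ ≤-refl 1≤k) (keep-false 1))

    rowCharge : ∀ m j → 1 ≤ j → j + m ≡ k → ∑ (j ∸ 1) (desc a) + descFrom j m ≡ ∑ k (desc a)
    rowCharge zero (suc j) _ e = begin
      ∑ j (desc a) + 0                  ≡⟨ cong (∑ j (desc a) +_) last ⟨
      ∑ j (desc a) + desc a (suc j)     ≡⟨ ∑-suc j (desc a) ⟨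
      ∑ (suc j) (desc a)                ≡⟨ cong (λ t → ∑ t (desc a)) j≡k ⟩
      ∑ k (desc a)                      ∎
      where
      open ≡-Reasoning
      j≡k : suc j ≡ k
      j≡k = trans (sym (+-identityʳ (suc j))) e
      -- The selection makes k - 1 moves while the sum has k terms; the extra one belongs to the
      -- leftmost cell of the row, whose arm is 0.
      last : desc a (suc j) ≡ 0
      last = if-zero (C (suc (suc j)) a <ᵇ C (suc j) a) (m≤n⇒m∸n≡0 (≤-reflexive (sym j≡k)))
    rowCharge (suc m) (suc j) _ e = begin
      ∑ j (desc a) + (desc a (suc j) + descFrom (suc (suc j)) m)   ≡⟨ +-assoc (∑ j (desc a)) _ _ ⟨
      ∑ j (desc a) + desc a (suc j) + descFrom (suc (suc j)) m     ≡⟨ cong (_+ descFrom (suc (suc j)) m) (∑-suc j (desc a)) ⟨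
      ∑ (suc j) (desc a) + descFrom (suc (suc j)) m                ≡⟨ rowCharge m (suc (suc j)) (s≤s z≤n) (trans (sym (+-suc (suc j) m)) e) ⟩
      ∑ k (desc a)                                                 ∎
      where open ≡-Reasoning

    chargeF-pass : ∀ f → chargeF (suc f) (word B) ≡ ∑ k (desc a) + chargeF f (word B′)
    chargeF-pass f = trans (chargeF-step f (proj₂ (proj₂ first)) top≡)
      (cong₂ _+_ (trans (proj₂ selected) (rowCharge (k ∸ 1) 1 ≤-refl (m+[n∸m]≡n 1≤k)))
                 (cong (chargeF f) (removeAt-word keep (p ∷ s) B removed)))

  rowTotal : ℕ → ℕ
  rowTotal a = ∑ (len a) (desc a)

  -- Each pass shortens the word, so fuel equal to its length suffices. Once the rows are exhausted
  -- no letter 1 is left, the algorithm stops, and the remaining row totals are empty sums.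
  chargeF-stage : ∀ f {r B} → Stage r B → length B ≤ f → r ≤ N →
    ∑ r rowTotal + chargeF f (word B) ≡ ∑ N rowTotal
  chargeF-stage f {r} {B} stage len≤ r≤N with suc r ≤? h 1
  ... | no r≮h = begin
    ∑ r rowTotal + chargeF f (word B)   ≡⟨ cong (∑ r rowTotal +_) (chargeF-stop f (rightmost-∉ 1∉)) ⟩
    ∑ r rowTotal + 0                    ≡⟨ +-identityʳ _ ⟩
    ∑ r rowTotal                        ≡⟨ ∑-extend rowTotal r≤N (λ a r<a _ → empty a r<a) ⟩
    ∑ N rowTotal                        ∎
    where
    open ≡-Reasoning
    1∉ : 1 ∉ word B
    1∉ 1∈ with ∈-word⁻ 1∈
    ... | z , z∈ with Stage.sound stage z∈
    ...   | _ , c , r<c , c≤h , _ = r≮h (≤-trans r<c c≤h)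
    empty : ∀ a → r < a → rowTotal a ≡ 0
    empty a r<a = cong (λ t → ∑ t (desc a)) (n<1⇒n≡0 (≰⇒> λ 1≤len →
      r≮h (≤-trans r<a (row⇒height (≤-trans (s≤s z≤n) r<a) ≤-refl 1≤len))))
  chargeF-stage zero {r} {B} stage len≤ r≤N | yes r<h = contradiction (≤-trans (Pass.shorter stage r<h) len≤) λ ()
  chargeF-stage (suc f) {r} {B} stage len≤ r≤N | yes r<h = begin
    ∑ r rowTotal + chargeF (suc f) (word B)                    ≡⟨ cong (∑ r rowTotal +_) (chargeF-pass f) ⟩
    ∑ r rowTotal + (rowTotal (suc r) + chargeF f (word B′))    ≡⟨ +-assoc (∑ r rowTotal) _ _ ⟨
    ∑ r rowTotal + rowTotal (suc r) + chargeF f (word B′)      ≡⟨ cong (_+ chargeF f (word B′)) (∑-suc r rowTotal) ⟨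
    ∑ (suc r) rowTotal + chargeF f (word B′)
      ≡⟨ chargeF-stage f stage′ (≤-pred (≤-trans shorter len≤)) (≤-trans r<h (h≤N ≤-refl)) ⟩
    ∑ N rowTotal                                               ∎
    where
    open ≡-Reasoning
    open Pass stage r<h

  charge-stage : ∀ {B} → Stage 0 B → charge (word B) ≡ ∑ N rowTotal
  charge-stage {B} stage = chargeF-stage (length (word B)) stage (≤-reflexive (sym (length-map proj₂ B))) z≤n

-- The charge word of a filling

[…1]-decreasing : ∀ n → AllPairs _>_ [ n …1]
[…1]-decreasing n = AllPairsₚ.map⁺ (AllPairsₚ.applyDownFrom⁺₁ id n (λ j<i _ → s≤s j<i))

Decreasing-concatMap : ∀ (f : ℕ → List Biletter) {xs} → AllPairs _>_ xs → All (Decreasing ∘ f) xs →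
  (∀ {x y} → x > y → All (λ b → All (b ≻_) (f y)) (f x)) → Decreasing (concatMap f xs)
Decreasing-concatMap f pairs all between = AllPairsₚ.concat⁺ (Allₚ.map⁺ all) (AllPairsₚ.map⁺ (AllPairs.map between pairs))

count-≡ᵇ-Unique : ∀ {k xs} → Unique xs → count (_≡ᵇ k) xs ≤ 1
count-≡ᵇ-Unique [] = z≤n
count-≡ᵇ-Unique {k} {x ∷ xs} (x∉ ∷ u) with x ≡ᵇ k in e
... | false = count-≡ᵇ-Unique u
... | true = s≤s (≤-reflexive (count-none {p = _≡ᵇ k} {xs}
      (All.map (λ x≢y → ≡ᵇ-false λ y≡k → x≢y (trans (≡ᵇ⇒≡ x k (≡true⇒T e)) (sym y≡k))) x∉)))

count-≡ᵇ-∈ : ∀ {k xs} → k ∈ xs → 1 ≤ count (_≡ᵇ k) xs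
count-≡ᵇ-∈ {k} {xs} k∈ = filter-some _ (lose k∈ (≡⇒≡ᵇ k k refl))

count-≡ᵇ-sound : ∀ {k} xs → 1 ≤ count (_≡ᵇ k) xs → k ∈ xs
count-≡ᵇ-sound {k} (x ∷ xs) 1≤ with x ≡ᵇ k in e
... | true = here (sym (≡ᵇ⇒≡ x k (≡true⇒T e)))
... | false = there (count-≡ᵇ-sound xs 1≤)

Decreasing-replicate : ∀ {m} b → m ≤ 1 → Decreasing (replicate m b)
Decreasing-replicate {zero} b _ = []
Decreasing-replicate {suc zero} b _ = [] ∷ []
Decreasing-replicate {suc (suc _)} b (s≤s ())

∈-replicate⁻ : ∀ m {b c : Biletter} → b ∈ replicate m c → 1 ≤ m × b ≡ c
∈-replicate⁻ (suc m) (here e) = s≤s z≤n , e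
∈-replicate⁻ (suc m) (there b∈) = s≤s z≤n , proj₂ (∈-replicate⁻ m b∈)

module _ (τ : Filling) where

  private
    letterCount : ℕ → ℕ → ℕ
    letterCount k j = count (λ x → x ≡ᵇ k) (colAt τ j)

    letters : ℕ → List Biletter
    letters k = concatMap (λ j → replicate (letterCount k j) (k , j)) [ length τ …1]

    letters-upper : ∀ k → All (λ b → proj₁ b ≡ k) (letters k)
    letters-upper k = Allₚ.concat⁺ (Allₚ.map⁺ (All.universal (λ j → Allₚ.replicate⁺ (letterCount k j) refl) [ length τ …1]))

  -- Distinct entries in each column mean that no biletter is repeated, which makes the order of the
  -- charge word strict.
  cw-Decreasing : (∀ j → 1 ≤ j → j ≤ length τ → Unique (colAt τ j)) → Decreasing (cw τ)
  cw-Decreasing unique = Decreasing-concatMap letters ([…1]-decreasing (maxEntry τ)) (All.universal inner [ maxEntry τ …1])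
    λ {x} {y} x>y → All.map (λ {b} b≡x → All.map (λ {c} c≡y → inj₁ (subst₂ _<_ (sym c≡y) (sym b≡x) x>y)) (letters-upper y)) (letters-upper x)
    where
    inner : ∀ k → Decreasing (letters k)
    inner k = Decreasing-concatMap (λ j → replicate (letterCount k j) (k , j)) ([…1]-decreasing (length τ))
      (All-[…1] (length τ) λ j 1≤j j≤ → Decreasing-replicate (k , j) (count-≡ᵇ-Unique (unique j 1≤j j≤)))
      (λ {i} {j} i>j → Allₚ.replicate⁺ (letterCount k i) (Allₚ.replicate⁺ (letterCount k j) (inj₂ (refl , i>j))))

  ∈-cw⁻ : ∀ {z j} → (z , j) ∈ cw τ → 1 ≤ j × j ≤ length τ × z ∈ colAt τ j
  ∈-cw⁻ {z} {j} ∈cw with find (∈-concatMap⁻ letters {xs = [ maxEntry τ …1]} ∈cw)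
  ... | k , _ , ∈letters with find (∈-concatMap⁻ (λ j → replicate (letterCount k j) (k , j)) {xs = [ length τ …1]} ∈letters)
  ... | i , i∈ , ∈rep with ∈-replicate⁻ (letterCount k i) ∈rep
  ... | 1≤count , refl = proj₁ (∈-[…1]⁻ i∈) , proj₂ (∈-[…1]⁻ i∈) , count-≡ᵇ-sound (colAt τ j) 1≤count

  private
    ⊔-seed : ∀ m c → m ≤ foldr _⊔_ m c
    ⊔-seed m [] = ≤-refl
    ⊔-seed m (x ∷ c) = ≤-trans (⊔-seed m c) (m≤n⊔m x _)

    ⊔-entry : ∀ m {c x} → x ∈ c → x ≤ foldr _⊔_ m c
    ⊔-entry m (here refl) = m≤m⊔n _ _
    ⊔-entry m {y ∷ c} (there x∈) = ≤-trans (⊔-entry m x∈) (m≤n⊔m y _)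

    entry≤maxEntry : ∀ {σ : Filling} {c x} → c ∈ σ → x ∈ c → x ≤ maxEntry σ
    entry≤maxEntry {c ∷ σ} (here refl) x∈ = ⊔-entry (maxEntry σ) x∈
    entry≤maxEntry {c ∷ σ} (there c∈) x∈ = ≤-trans (entry≤maxEntry c∈ x∈) (⊔-seed (maxEntry σ) c)

  ∈-cw⁺ : ∀ {z j} → 1 ≤ z → 1 ≤ j → j ≤ length τ → z ∈ colAt τ j → (z , j) ∈ cw τ
  ∈-cw⁺ {z} {j} 1≤z 1≤j j≤ z∈ = ∈-concatMap⁺ letters
    (lose (∈-[…1]⁺ 1≤z (entry≤maxEntry {τ} (nth-∈ [] 1≤j j≤) z∈))
      (∈-concatMap⁺ (λ j → replicate (letterCount z j) (z , j)) (lose (∈-[…1]⁺ 1≤j j≤) (head∈ (count-≡ᵇ-∈ z∈)))))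
    where
    head∈ : ∀ {m} → 1 ≤ m → (z , j) ∈ replicate m (z , j)
    head∈ {suc m} _ = here refl

nth-map : (f : A → B) (d : A) (xs : List A) → ∀ j → nth (f d) (map f xs) j ≡ f (nth d xs j)
nth-map f d [] j = refl
nth-map f d (x ∷ xs) zero = refl
nth-map f d (x ∷ xs) (suc zero) = refl
nth-map f d (x ∷ xs) (suc (suc j)) = nth-map f d xs (suc j)

if-cong : ∀ {s t : Bool} {x y : ℕ} → s ≡ t → x ≡ y → (if s then x else 0) ≡ (if t then y else 0)
if-cong refl refl = refl

-- Descents, arms and charge for the filling of a folding pair

module Statistics (n : ℕ) (μ w : List ℕ) (J : List Bool) (1≤n : 1 ≤ n) (μ-part : AllPairs _≥_ μ) (μn≡0 : part μ n ≡ 0)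
  (w∈S : Perm n w) (lenJ : length J ≡ length (Γ n μ)) (w,J∈F̄ : InFbar n μ w J) where

  open Chain n μ w J 1≤n μ-part μn≡0 w∈S lenJ w,J∈F̄
  open Conjugate μ-part
  open ≡-Reasoning

  private
    σ = fill n μ w J
    τ = ord σ

    column : ℕ → List ℕ
    column j = take (conj μ j) (π j)

    length-σ : length σ ≡ M
    length-σ = trans (length-map column [1… M ]) (length-[1…] M)

    colAt-σ : ∀ {j} → 1 ≤ j → j ≤ M → colAt σ j ≡ column j
    colAt-σ = nth-map-[1…] [] column

    length-column : ∀ {j} → 1 ≤ j → length (column j) ≡ conj μ j
    length-column {j} 1≤j = length-take-≤ (subst (conj μ j ≤_) (sym (Perm-length π∈S)) (k≤n 1≤j))

    length-colAt : ∀ {j} → 1 ≤ j → j ≤ M → length (colAt σ j) ≡ conj μ j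
    length-colAt 1≤j j≤M = trans (cong length (colAt-σ 1≤j j≤M)) (length-column 1≤j)

    entry : ∀ {j a} → 1 ≤ j → j ≤ M → a ≤ conj μ j → colAt σ j ⟨ a ⟩ ≡ π j ⟨ a ⟩
    entry {j} {a} 1≤j j≤M a≤ = trans (cong (_⟨ a ⟩) (colAt-σ 1≤j j≤M)) (nth-take 0 (conj μ j) (π j) a≤)

    arm≡ : ∀ {a} → 1 ≤ a → ∀ j → arm σ (a , j) ≡ part μ a ∸ j
    arm≡ {a} 1≤a j = begin
      count (λ i → (j <ᵇ i) ∧ (a ≤ᵇ length (colAt σ i))) [1… length σ ]   ≡⟨ cong (λ t → count (λ i → (j <ᵇ i) ∧ (a ≤ᵇ length (colAt σ i))) [1… t ]) length-σ ⟩
      count (λ i → (j <ᵇ i) ∧ (a ≤ᵇ length (colAt σ i))) [1… M ]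
        ≡⟨ count-cong (All-[1…] M λ i 1≤i i≤M → cong ((j <ᵇ i) ∧_) (trans (cong (a ≤ᵇ_) (length-colAt 1≤i i≤M)) (≤ᵇ-conj 1≤a 1≤i))) ⟩
      count (λ i → (j <ᵇ i) ∧ (i ≤ᵇ part μ a)) [1… M ]                    ≡⟨ count≡sum (λ i → (j <ᵇ i) ∧ (i ≤ᵇ part μ a)) [1… M ] ⟩
      ∑ M (λ i → 𝟙 ((j <ᵇ i) ∧ (i ≤ᵇ part μ a)))                          ≡⟨ ∑-interval M j (part μ a) (part-≤-first 1≤a) ⟩
      part μ a ∸ j                                                        ∎

    cell : ℕ → ℕ → ℕ
    cell j a = if isDescent σ (a , j) then arm σ (a , j) else 0

    cell≡ : ∀ {j a} → 1 ≤ j → j ≤ M → 1 ≤ a → a ≤ conj μ j → cell j a ≡ descent j a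
    cell≡ {j} {a} 1≤j j≤M 1≤a a≤ with j ≟ M
    -- The leftmost column gives 0 on both sides for different reasons: `isDescent` finds no further
    -- column, and `descent` has arm 0.
    ... | yes refl = trans (if-false (∧-falseˡ (≤ᵇ-false (s≤s (≤-reflexive length-σ))))) (sym (descent-last a 1≤a))
    ... | no j≢M = if-cong (trans (cong (_∧ ((a ≤ᵇ length (colAt σ (suc j))) ∧ (colAt σ (suc j) ⟨ a ⟩ <ᵇ colAt σ j ⟨ a ⟩)))
                             (≤ᵇ-true (subst (suc j ≤_) (sym length-σ) j<M))) test) (arm≡ 1≤a j)
      where
      j<M = ≤∧≢⇒< j≤M j≢M
      test : (a ≤ᵇ length (colAt σ (suc j))) ∧ (colAt σ (suc j) ⟨ a ⟩ <ᵇ colAt σ j ⟨ a ⟩) ≡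
             (a ≤ᵇ conj μ (suc j)) ∧ (π (suc j) ⟨ a ⟩ <ᵇ π j ⟨ a ⟩)
      test with a ≤? conj μ (suc j)
      ... | yes a≤′ = cong₂ _∧_ (cong (a ≤ᵇ_) (length-colAt (s≤s z≤n) j<M)) (cong₂ _<ᵇ_ (entry (s≤s z≤n) j<M a≤′) (entry 1≤j j≤M a≤))
      -- Below the bottom of C^{j+1} the filling yields the default 0 while π^{j+1} still has an
      -- entry; the test on the row makes both sides false.
      ... | no a≰ = trans (∧-falseˡ (trans (cong (a ≤ᵇ_) (length-colAt (s≤s z≤n) j<M)) (≤ᵇ-false (≰⇒> a≰))))
                          (sym (∧-falseˡ (≤ᵇ-false (≰⇒> a≰))))

  desArmSum≡∑descent : desArmSum σ ≡ ∑ M (λ j → ∑ n (descent j))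
  desArmSum≡∑descent = begin
    sum (map (arm σ) (filterᵇ (isDescent σ) (cells σ)))
      ≡⟨ sum-filter (isDescent σ) (arm σ) (cells σ) ⟩
    sum (map value (cells σ))
      ≡⟨ sum-concatMap value (λ j → map (λ i → (i , j)) [1… length (colAt σ j) ]) [1… length σ ] ⟩
    ∑ (length σ) (λ j → sum (map value (map (λ i → (i , j)) [1… length (colAt σ j) ])))
      ≡⟨ cong (λ t → ∑ t (λ j → sum (map value (map (λ i → (i , j)) [1… length (colAt σ j) ])))) length-σ ⟩
    ∑ M (λ j → sum (map value (map (λ i → (i , j)) [1… length (colAt σ j) ])))
      ≡⟨ ∑-cong M columnSum ⟩
    ∑ M (λ j → ∑ n (descent j)) ∎
    where
    value : ℕ × ℕ → ℕ
    value c = if isDescent σ c then arm σ c else 0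
    columnSum : ∀ j → 1 ≤ j → j ≤ M → sum (map value (map (λ i → (i , j)) [1… length (colAt σ j) ])) ≡ ∑ n (descent j)
    columnSum j 1≤j j≤M = begin
      sum (map value (map (λ i → (i , j)) [1… length (colAt σ j) ]))   ≡⟨ sum-map-map value (λ i → (i , j)) [1… length (colAt σ j) ] ⟩
      ∑ (length (colAt σ j)) (cell j)                                  ≡⟨ cong (λ t → ∑ t (cell j)) (length-colAt 1≤j j≤M) ⟩
      ∑ (conj μ j) (cell j)                                            ≡⟨ ∑-cong (conj μ j) (λ a 1≤a a≤ → cell≡ 1≤j j≤M 1≤a a≤) ⟩
      ∑ (conj μ j) (descent j)                                         ≡⟨ ∑-extend (descent j) (k≤n 1≤j) outside ⟩
      ∑ n (descent j)                                                  ∎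
      where
      outside : ∀ a → conj μ j < a → a ≤ n → descent j a ≡ 0
      outside a k<a _ = if-false (∧-falseˡ (≤ᵇ-false (≤-trans (s≤s (conj-antitone 1≤j (n≤1+n j))) k<a)))

  private
    columns : Columns M n (conj μ) (part μ) (λ j a → π j ⟨ a ⟩)
    columns = record
      { height⇒row = conj⇒part μ-part
      ; row⇒height = part⇒conj μ-part
      ; len≤M = part-≤-first
      ; h≤N = k≤n
      ; distinct = λ 1≤j 1≤a a≤ 1≤c c≤ → Perm-injective π∈S 1≤a (≤-trans a≤ (k≤n 1≤j)) 1≤c (≤-trans c≤ (k≤n 1≤j))
      ; circular = λ _ j<M → π-circular j<M
      ; increasing = first-increasing }

    open Charge columns

    length-τ : length τ ≡ M
    length-τ = trans (length-map sort σ) length-σ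

    colAt-τ : ∀ {j} → 1 ≤ j → j ≤ M → colAt τ j ≡ sort (column j)
    -- The default column agrees on both sides because `sort []` reduces to `[]`.
    colAt-τ {j} 1≤j j≤M = trans (nth-map sort [] σ j) (cong sort (colAt-σ 1≤j j≤M))

    colAt-↭ : ∀ {j} → 1 ≤ j → j ≤ M → colAt τ j ↭ column j
    colAt-↭ {j} 1≤j j≤M = subst (_↭ column j) (sym (colAt-τ 1≤j j≤M)) (sort-↭ (column j))

    -- A `Stage` speaks only of membership in columns, so the unsorted columns describe the charge
    -- word of the sorted filling; their row structure is what the passes then use.
    initial : Stage 0 (cw τ)
    initial = record
      { decreasing = cw-Decreasing τ unique
      ; sound = sound
      ; complete = complete }
      where
      unique : ∀ j → 1 ≤ j → j ≤ length τ → Unique (colAt τ j)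
      unique j 1≤j j≤ = Permₛ.Unique-resp-↭ (setoid ℕ) (↭⇒↭ₛ (↭-sym (colAt-↭ 1≤j (subst (j ≤_) length-τ j≤))))
        (Uniqueₚ.take⁺ (conj μ j) (Perm-Unique π∈S))
      sound : ∀ {z j} → (z , j) ∈ cw τ → 1 ≤ j × ∃ λ c → 0 < c × c ≤ conj μ j × π j ⟨ c ⟩ ≡ z
      sound {z} {j} ∈cw = 1≤j , c , 1≤c , c≤′ , trans (sym (nth-take 0 (conj μ j) (π j) c≤′)) e
        where
        bounds = ∈-cw⁻ τ ∈cw
        1≤j = proj₁ bounds
        j≤M = subst (j ≤_) length-τ (proj₁ (proj₂ bounds))
        found = ∈-nth 0 (∈-resp-↭ (colAt-↭ 1≤j j≤M) (proj₂ (proj₂ bounds)))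
        c = proj₁ found
        1≤c = proj₁ (proj₂ found)
        c≤′ = subst (c ≤_) (length-column 1≤j) (proj₁ (proj₂ (proj₂ found)))
        e = proj₂ (proj₂ (proj₂ found))
      complete : ∀ {j c} → 1 ≤ j → j ≤ M → 0 < c → c ≤ conj μ j → (π j ⟨ c ⟩ , j) ∈ cw τ
      complete {j} {c} 1≤j j≤M 1≤c c≤ = ∈-cw⁺ τ (proj₁ (Perm-range π∈S 1≤c (≤-trans c≤ (k≤n 1≤j)))) 1≤j (subst (j ≤_) (sym length-τ) j≤M)
        (∈-resp-↭ (↭-sym (colAt-↭ 1≤j j≤M)) (subst (_∈ column j) (nth-take 0 (conj μ j) (π j) c≤)
          (nth-∈ 0 1≤c (subst (c ≤_) (sym (length-column 1≤j)) c≤))))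

    rowTotal≡ : ∀ a → 1 ≤ a → rowTotal a ≡ ∑ M (λ j → descent j a)
    rowTotal≡ a 1≤a = begin
      ∑ (part μ a) (desc a)                  ≡⟨ ∑-cong (part μ a) same ⟩
      ∑ (part μ a) (λ j → descent j a)       ≡⟨ ∑-extend (λ j → descent j a) (part-≤-first 1≤a) outside ⟩
      ∑ M (λ j → descent j a)                ∎
      where
      test : ℕ → Bool
      test j = π (suc j) ⟨ a ⟩ <ᵇ π j ⟨ a ⟩
      outside : ∀ j → part μ a < j → j ≤ M → descent j a ≡ 0
      outside j len<j _ = if-zero ((a ≤ᵇ conj μ (suc j)) ∧ test j) (m≤n⇒m∸n≡0 (<⇒≤ len<j))
      same : ∀ j → 1 ≤ j → j ≤ part μ a → desc a j ≡ descent j a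
      same j 1≤j j≤ with suc j ≤? part μ a
      ... | yes j< = if-cong (cong (_∧ test j) (sym (≤ᵇ-true (part⇒conj μ-part 1≤a (s≤s z≤n) j<)))) refl
      -- At the left end of the row, j = μ_a, only `descent` tests whether the next column reaches
      -- row a; both values are 0 since the arm is.
      ... | no j≮ = trans (if-zero (test j) zero′) (sym (if-zero ((a ≤ᵇ conj μ (suc j)) ∧ test j) zero′))
        where
        zero′ : part μ a ∸ j ≡ 0
        zero′ = m≤n⇒m∸n≡0 (≮⇒≥ j≮)

  charge≡∑descent : charge (cw₂ τ) ≡ ∑ M (λ j → ∑ n (descent j))
  charge≡∑descent = begin
    charge (cw₂ τ)                            ≡⟨ charge-stage initial ⟩
    ∑ n rowTotal                              ≡⟨ ∑-cong n (λ a 1≤a _ → rowTotal≡ a 1≤a) ⟩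
    ∑ n (λ a → ∑ M (λ j → descent j a))       ≡⟨ sum-swap (λ a j → descent j a) [1… n ] [1… M ] ⟩
    ∑ M (λ j → ∑ n (descent j))               ∎

theorem4p11 : (n : ℕ) (μ w : List ℕ) (J : List Bool) →
    2 ≤ n → IsPartition μ → part μ n ≡ 0 →
    w ↭ [1… n ] → length J ≡ length (Γ n μ) → InFbar n μ w J →
    level n μ w J ≡ desArmSum (fill n μ w J)
    × desArmSum (fill n μ w J) ≡ charge (cw₂ (ord (fill n μ w J)))
theorem4p11 n μ w J 2≤n μ-part μn≡0 w∈S lenJ w,J∈F̄ =
  trans level≡∑descent (sym desArmSum≡∑descent) , trans desArmSum≡∑descent (sym charge≡∑descent)
  where
  1≤n = ≤-trans (n≤1+n 1) 2≤n
  open Chain n μ w J 1≤n (AllPairs-≥ μ-part) μn≡0 w∈S lenJ w,J∈F̄ using (level≡∑descent)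
  open Statistics n μ w J 1≤n (AllPairs-≥ μ-part) μn≡0 w∈S lenJ w,J∈F̄
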